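{- Let $\lambda$ be a partition and $n\ge 2$. Then \[\mathrm{SVT}^n(\lambda)\cong\bigoplus_\mu B(\mu)^{\oplus F^\lambda_\mu}\] as $U_q(\mathfrak{sl}_n)$-crystals, where the sum is over partitions $\mu\supseteq\lambda$ and $F^\lambda_\mu$ is the number of flagged increasing tableaux of shape $\mu/\lambda$.
   Context: A semistandard set-valued tableau of shape $\lambda$ (English convention) is a filling of the boxes by nonempty finite sets of positive integers such that every choice of one integer per box gives a semistandard tableau (rows weakly increasing, columns strictly increasing); $\mathrm{SVT}^n(\lambda)$ is the set of those with entries at most $n$, and $\mathrm{SSYT}^n(\lambda)$ the subset with all sets singletons. Crystal operators, $1\le i<n$: write $+$ above each column containing (in some box) $i$ but not $i+1$, $-$ above each column containing $i+1$ but not $i$; reading columns left to right, repeatedly delete adjacent pairs $-+$. If no $+$ remains, $f_iT=0$; otherwise let $\mathsf b$ be the box containing $i$ in the column of the rightmost remaining $+$ and $\mathsf b^{\rightarrow}$ the box immediately right; if $i\notin\mathsf b^{\rightarrow}$, $f_iT$ replaces $i$ by $i+1$ in $\mathsf b$, otherwise removes $i$ from $\mathsf b^{\rightarrow}$ and adds $i+1$ to $\mathsf b$. If no $-$ remains, $e_iT=0$; otherwise let $\mathsf b$ be the box containing $i+1$ in the column of the leftmost remaining $-$ and $\mathsf b^{\leftarrow}$ the box immediately left; if $i+1\notin\mathsf b^{\leftarrow}$, $e_iT$ replaces $i+1$ by $i$ in $\mathsf b$, otherwise removes $i+1$ from $\mathsf b^{\leftarrow}$ and adds $i$ to $\mathsf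 b$. Weight: $\mathrm{wt}(T)=(c_1,\dots,c_n)$, $c_j$ = number of boxes containing $j$. $B(\mu)$ is $\mathrm{SSYT}^n(\mu)$ with the restricted operators (the crystal of the irreducible highest weight module of highest weight $\mu$; it is empty if $\mu$ has more than $n$ parts). An increasing tableau of shape $\mu/\lambda$ is a filling of the skew diagram by positive integers strictly increasing along rows (left to right) and columns (top to bottom); it is flagged if every entry in row $r$ (top row is row $1$) is at most $r-1$. Crystal isomorphism: weight-preserving bijection commuting with all $e_i,f_i$. -}

module Defs where

open import Data.Bool using (Bool; true; false; if_then_else_; _∧_; not)
open import Data.Nat using (ℕ; zero; suc; _+_; _∸_; _≤_; _<_; _<ᵇ_; _⊔_)
open import Data.Fin using (Fin; toℕ)
import Data.Fin as Fin
open import Data.Fin.Subset using (Subset; _∈_; ∣_∣)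
open import Data.Vec using (Vec; []; _∷_; lookup; tabulate)
open import Data.List using (List; []; _∷_; map; length; foldr; upTo; concatMap)
open import Data.Bool.ListAction using (any)
open import Data.List.Relation.Unary.All using (All)
open import Data.List.Relation.Unary.Linked using (Linked)
open import Data.Maybe using (Maybe; just; nothing; maybe′)
import Data.Maybe as Maybe
open import Data.Product using (Σ; ∃; _×_; _,_)
open import Data.Sum using (_⊎_)
open import Relation.Binary.PropositionalEquality using (_≡_)

sumL : List ℕ → ℕ
sumL = foldr _+_ 0

at : ∀ {A : Set} → List A → ℕ → Maybe A
at []       _       = nothing
at (x ∷ xs) zero    = just x
at (x ∷ xs) (suc k) = at xs k

rowAt : ∀ {A : Set} → List (List A) → ℕ → List A
rowAt []         _       = []
rowAt (xs ∷ xss) zero    = xs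
rowAt (xs ∷ xss) (suc k) = rowAt xss k

-- entry in row r, column c (both 0-based; row 0 = top row, English convention)
entry : ∀ {A : Set} → List (List A) → ℕ → ℕ → Maybe A
entry T r c = at (rowAt T r) c

modifyAt : ∀ {A : Set} → List A → ℕ → (A → A) → List A
modifyAt []       _       g = []
modifyAt (x ∷ xs) zero    g = g x ∷ xs
modifyAt (x ∷ xs) (suc k) g = x ∷ modifyAt xs k g

modify2 : ∀ {A : Set} → List (List A) → ℕ → ℕ → (A → A) → List (List A)
modify2 T r c g = modifyAt T r (λ row → modifyAt row c g)

IsPartition : List ℕ → Set
IsPartition l = All (λ k → 1 ≤ k) l × Linked (λ a b → b ≤ a) l

part : List ℕ → ℕ → ℕ
part []       _       = 0
part (x ∷ xs) zero    = x
part (x ∷ xs) (suc r) = part xs r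

Contains : List ℕ → List ℕ → Set
Contains la mu = ∀ r → part la r ≤ part mu r

-- Set-valued fillings.  A box holds a subset of {1,…,n}, encoded as
-- Subset n, where index j : Fin n stands for the integer toℕ j + 1.

Tableau : ℕ → Set
Tableau n = List (List (Subset n))

has : ∀ {n} → Subset n → ℕ → Bool
has []      _             = false
has (b ∷ s) zero          = false
has (b ∷ s) (suc zero)    = b
has (b ∷ s) (suc (suc k)) = has s (suc k)

put : ∀ {n} → Subset n → ℕ → Bool → Subset n
put []      _             v = []
put (b ∷ s) zero          v = b ∷ s
put (b ∷ s) (suc zero)    v = v ∷ s
put (b ∷ s) (suc (suc k)) v = b ∷ put s (suc k) v

shape : ∀ {A : Set} → List (List A) → List ℕ
shape T = map length T

NonemptyBoxes : ∀ {n} → Tableau n → Set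
NonemptyBoxes {n} T = ∀ r c S → entry T r c ≡ just S → ∃ λ (j : Fin n) → j ∈ S

IsChoice : ∀ {n} → List (List (Fin n)) → Tableau n → Set
IsChoice C T = shape C ≡ shape T
             × (∀ r c j S → entry C r c ≡ just j → entry T r c ≡ just S → j ∈ S)

Semistandard : ∀ {n} → List (List (Fin n)) → Set
Semistandard C =
    (∀ r c a b → entry C r c ≡ just a → entry C r (suc c) ≡ just b → a Fin.≤ b)
  × (∀ r c a b → entry C r c ≡ just a → entry C (suc r) c ≡ just b → a Fin.< b)

IsSVT : ∀ {n} → List ℕ → Tableau n → Set
IsSVT la T = shape T ≡ la × NonemptyBoxes T
           × (∀ C → IsChoice C T → Semistandard C)

IsSSYT : ∀ {n} → List ℕ → Tableau n → Set
IsSSYT la T = IsSVT la T × (∀ r c S → entry T r c ≡ just S → ∣ S ∣ ≡ 1)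

-- Crystal operators on set-valued fillings (i is the integer i, 1 ≤ i < n)

data Sign : Set where
  plus minus : Sign

colHas : ∀ {n} → Tableau n → ℕ → ℕ → Bool
colHas T c k = any (λ row → maybe′ (λ S → has S k) false (at row c)) T

ncols : ∀ {A : Set} → List (List A) → ℕ
ncols T = foldr _⊔_ 0 (map length T)

signs : ∀ {n} → Tableau n → ℕ → List (ℕ × Sign)
signs T i = concatMap sgn (upTo (ncols T))
  where
  sgn : ℕ → List (ℕ × Sign)
  sgn c = if colHas T c i ∧ not (colHas T c (suc i)) then (c , plus) ∷ []
          else if colHas T c (suc i) ∧ not (colHas T c i) then (c , minus) ∷ []
          else []

deleteFirst : List (ℕ × Sign) → Maybe (List (ℕ × Sign))
deleteFirst ((c , minus) ∷ (d , plus) ∷ w) = just w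
deleteFirst [] = nothing
deleteFirst (x ∷ w) = Maybe.map (x ∷_) (deleteFirst w)

-- repeatedly delete adjacent pairs  - +  (each deletion shortens the word,
-- so length-many rounds suffice)
reduceWith : ℕ → List (ℕ × Sign) → List (ℕ × Sign)
reduceWith zero    w = w
reduceWith (suc k) w with deleteFirst w
... | nothing = w
... | just w' = reduceWith k w'

reduce : List (ℕ × Sign) → List (ℕ × Sign)
reduce w = reduceWith (length w) w

lastPlus : List (ℕ × Sign) → Maybe ℕ
lastPlus [] = nothing
lastPlus ((c , plus) ∷ w) with lastPlus w
... | nothing = just c
... | just d  = just d
lastPlus ((c , minus) ∷ w) = lastPlus w

firstMinus : List (ℕ × Sign) → Maybe ℕ
firstMinus [] = nothing
firstMinus ((c , minus) ∷ w) = just c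
firstMinus ((c , plus) ∷ w) = firstMinus w

findRow : ∀ {n} → Tableau n → ℕ → ℕ → Maybe ℕ
findRow []         c k = nothing
findRow (row ∷ T)  c k =
  if maybe′ (λ S → has S k) false (at row c) then just zero else Maybe.map suc (findRow T c k)

boxHas : ∀ {n} → Tableau n → ℕ → ℕ → ℕ → Bool
boxHas T r c k = maybe′ (λ S → has S k) false (entry T r c)

-- f_i ; nothing encodes 0
fOp : ∀ {n} → ℕ → Tableau n → Maybe (Tableau n)
fOp {n} i T = go (lastPlus (reduce (signs T i)))
  where
  go : Maybe ℕ → Maybe (Tableau n)
  go nothing = nothing
  go (just c) with findRow T c i
  ... | nothing = nothing
  ... | just r  =
    just (if boxHas T r (suc c) i
          then modify2 (modify2 T r (suc c) (λ S → put S i false)) r c (λ S → put S (suc i) true)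
          else modify2 T r c (λ S → put (put S i false) (suc i) true))

-- e_i ; nothing encodes 0
eOp : ∀ {n} → ℕ → Tableau n → Maybe (Tableau n)
eOp {n} i T = go (firstMinus (reduce (signs T i)))
  where
  replace : ℕ → ℕ → Tableau n
  replace r c = modify2 T r c (λ S → put (put S (suc i) false) i true)
  go : Maybe ℕ → Maybe (Tableau n)
  go nothing = nothing
  go (just c) with findRow T c (suc i)
  ... | nothing = nothing
  ... | just r with c
  ...   | zero   = just (replace r zero)
  ...   | suc c' = just (if boxHas T r c' (suc i)
                         then modify2 (modify2 T r c' (λ S → put S (suc i) false)) r (suc c') (λ S → put S i true)
                         else replace r (suc c'))

-- wt(T) = (c_1,…,c_n), c_j = number of boxes containing j
-- (component j : Fin n corresponds to the integer toℕ j + 1)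
wt : ∀ {n} → Tableau n → Vec ℕ n
wt T = tabulate (λ j → sumL (map (λ row → sumL (map (λ S → if lookup S j then 1 else 0) row)) T))

-- Flagged increasing tableaux of skew shape mu/la.
-- P lists, for each row r of mu, the entries of the boxes of mu/la in
-- row r from left to right (the boxes in columns part la r, …, part mu r - 1).

skewEntry : List ℕ → List (List ℕ) → ℕ → ℕ → Maybe ℕ
skewEntry la P r c = if c <ᵇ part la r then nothing else at (rowAt P r) (c ∸ part la r)

IsSkewFilling : List ℕ → List ℕ → List (List ℕ) → Set
IsSkewFilling la mu P = length P ≡ length mu × (∀ r → part la r + length (rowAt P r) ≡ part mu r)

IsFlaggedIncreasing : List ℕ → List ℕ → List (List ℕ) → Set
IsFlaggedIncreasing la mu P =
    IsSkewFilling la mu P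
  -- positive integers, and flagged: entries of row r+1 (1-based) are ≤ r
  × (∀ r c a → skewEntry la P r c ≡ just a → 1 ≤ a × a ≤ r)
  × (∀ r c a b → skewEntry la P r c ≡ just a → skewEntry la P r (suc c) ≡ just b → a < b)
  × (∀ r c a b → skewEntry la P r c ≡ just a → skewEntry la P (suc r) c ≡ just b → a < b)

-- Crystals.  Elements carry an underlying raw datum; the raw operators
-- fR i / eR i act on raw data (nothing = 0).  "f_i x = y" means
-- fR i (raw x) ≡ just (raw y).

record Crystal (n : ℕ) : Set₁ where
  field
    Elt : Set
    Raw : Set
    raw : Elt → Raw
    fR  : ℕ → Raw → Maybe Raw
    eR  : ℕ → Raw → Maybe Raw
    wtC : Elt → Vec ℕ n

open Crystal public

CommutesAt : ∀ {n} (A B : Crystal n) → (Elt A → Elt B)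
           → (Raw A → Maybe (Raw A)) → (Raw B → Maybe (Raw B)) → Elt A → Set
CommutesAt A B φ opA opB x =
    (opA (raw A x) ≡ nothing × opB (raw B (φ x)) ≡ nothing)
  ⊎ Σ (Elt A) (λ y → opA (raw A x) ≡ just (raw A y) × opB (raw B (φ x)) ≡ just (raw B (φ y)))

record CrystalIso {n : ℕ} (A B : Crystal n) : Set where
  field
    to      : Elt A → Elt B
    from    : Elt B → Elt A
    from∘to : ∀ x → from (to x) ≡ x
    to∘from : ∀ y → to (from y) ≡ y
    wt-pres : ∀ x → wtC B (to x) ≡ wtC A x
    f-comm  : ∀ i → 1 ≤ i → i < n → ∀ x → CommutesAt A B to (fR A i) (fR B i) x
    e-comm  : ∀ i → 1 ≤ i → i < n → ∀ x → CommutesAt A B to (eR A i) (eR B i) x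

record SVTElt (n : ℕ) (la : List ℕ) : Set where
  constructor svt
  field
    tab    : Tableau n
    .valid : IsSVT la tab

SVT : (n : ℕ) → List ℕ → Crystal n
SVT n la = record
  { Elt = SVTElt n la ; Raw = Tableau n ; raw = SVTElt.tab
  ; fR = fOp ; eR = eOp ; wtC = λ x → wt (SVTElt.tab x) }

-- ⊕_{mu ⊇ la} B(mu)^{⊕ F^la_mu}: an element is a partition mu ⊇ la, a
-- flagged increasing tableau P of shape mu/la (indexing the F^la_mu copies)
-- and an element T of B(mu) = SSYT^n(mu); the operators act on T.

record SumElt (n : ℕ) (la : List ℕ) : Set where
  constructor sumElt
  field
    mu      : List ℕ
    .mu-par : IsPartition mu
    .mu-sup : Contains la mu
    P       : List (List ℕ)
    .P-ok   : IsFlaggedIncreasing la mu P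
    T       : Tableau n
    .T-ok   : IsSSYT mu T

SumRaw : ℕ → Set
SumRaw n = List ℕ × List (List ℕ) × Tableau n

onT : ∀ {n} → (Tableau n → Maybe (Tableau n)) → SumRaw n → Maybe (SumRaw n)
onT op (m , p , t) = Maybe.map (λ t' → m , p , t') (op t)

SumB : (n : ℕ) → List ℕ → Crystal n
SumB n la = record
  { Elt = SumElt n la ; Raw = SumRaw n
  ; raw = λ x → SumElt.mu x , SumElt.P x , SumElt.T x
  ; fR = λ i → onT (fOp i) ; eR = λ i → onT (eOp i)
  ; wtC = λ x → wt (SumElt.T x) }

-- Uncrowding.  A row of a set-valued tableau is the row R of the minima of its
-- boxes together with the set E of its non-minimal entries.  Going through the
-- rows from bottom to top, the strictly decreasing word E is row inserted into
-- the semistandard tableau obtained from the rows below.  Each of its rows grows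
-- by at most one box, and labelling the new box by its distance from the row of
-- E gives the flagged increasing tableau.  Read along the alphabet, the insertion
-- of E into one row is a transducer with a single bit of state whose steps are
-- bijections, so it can be run backwards.  For fixed i the operators act on
-- reading words by the tensor product rule; the insertion respects them because
-- only its two steps at i and i + 1 matter, which is a finite check, and the
-- column signs of a set-valued tableau cancel to those of its reading word.

module Submission where

-- Two things make the coordinates (E , R) work. The awkward clause of the operators, which moves a
-- letter between neighbouring boxes, disappears: an operator always changes one k to k + 1 in a
-- single E or R. If k + 1 is already a non-minimal entry, lowering the number of minima k also
-- shifts the box that holds this entry one step to the left, and that is the clause. Column
-- strictness becomes an inequality between partial sums, and the state bit of the transducer is the
-- excess of the partial sums of the new row over those of the old one, so validity can be followed
-- letter by letter. The operators e need no second theory on reading words: f is kept as a relation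
-- that is deterministic in both directions, and e is this relation read backwards. Uncrowding is
-- undone by means of the flag: when a word inserted from distance d arrives at a row, the labels
-- there are below d, so a last label equal to d tells that this insertion made the row grow.

open import Defs
open import Data.Bool using (Bool; true; false; if_then_else_; _∧_; _∨_; not; T)
import Data.Bool.Properties as Bool
open import Data.Bool.Properties using (T-∧; T-∨)
open import Data.Nat using (ℕ; zero; suc; _+_; _*_; _∸_; _≤_; _<_; _≤ᵇ_; _<ᵇ_; _≡ᵇ_; z≤n; s≤s)
open import Data.Nat.Properties
open import Data.Nat.Tactic.RingSolver using (solve-∀)
open import Data.Fin using (Fin; zero; suc; toℕ)
import Data.Fin as Fin
open import Data.Fin.Subset using (Subset; _∈_; ∣_∣) renaming (⊥ to ∅)
open import Data.Fin.Subset.Properties using (nonempty?; ∣⊥∣≡0)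
open import Data.Vec using (Vec; []; _∷_; lookup; zipWith; replicate; allFin; sum; tabulate; here; there)
import Data.Vec as Vec
import Data.Vec.Properties as Vec
open import Data.Vec.N-ary using (N-ary; _$ⁿ_; curryⁿ; ∀ⁿ)
open import Data.List using (List; []; _∷_; _++_; map; length; upTo; applyUpTo; concatMap)
import Data.List as List
import Data.List.Properties as List
open import Data.List.Properties using (length-++; length-map; length-applyUpTo; map-∘; map-cong; ∷-injective)
open import Data.List.Relation.Unary.All using ([]; _∷_)
open import Data.List.Relation.Unary.Linked using ([]; [-]; _∷_)
open import Data.Maybe using (Maybe; just; nothing; maybe′)
import Data.Maybe as Maybe
import Data.Maybe.Properties as Maybe
open import Data.Maybe.Properties using (just-injective)
open import Data.Product using (∃; _×_; _,_; proj₁; proj₂)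
import Data.Product.Properties as Product
open import Data.Sum using (_⊎_; inj₁; inj₂)
open import Data.Unit using (⊤; tt)
open import Data.Empty using (⊥; ⊥-elim)
open import Function using (const)
open import Function.Bundles using (Equivalence)
open import Relation.Nullary using (¬_; Dec; yes; no; recompute)
open import Relation.Binary.Definitions using (DecidableEquality; tri<; tri≈; tri>)
open import Relation.Binary.PropositionalEquality

-- Linear arithmetic over ℕ

infixl 7 _:+_
infix 5 _:≤_ _:<_ _:=_
infixr 4 _:⇒_

data Lin (n : ℕ) : Set where
  var  : Fin n → Lin n
  #_   : ℕ → Lin n
  _:+_ : Lin n → Lin n → Lin n

data Goal (n : ℕ) : Set where
  _:≤_ _:<_ _:=_ : Lin n → Lin n → Goal n
  :⊥ : Goal n
  _:⇒_ : Goal n → Goal n → Goal n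

⟦_⟧ : ∀ {n} → Lin n → Vec ℕ n → ℕ
⟦ var x ⟧ ρ = lookup ρ x
⟦ # k ⟧ ρ = k
⟦ a :+ b ⟧ ρ = ⟦ a ⟧ ρ + ⟦ b ⟧ ρ

⟦_⟧ᵍ : ∀ {n} → Goal n → Vec ℕ n → Set
⟦ a :≤ b ⟧ᵍ ρ = ⟦ a ⟧ ρ ≤ ⟦ b ⟧ ρ
⟦ a :< b ⟧ᵍ ρ = ⟦ a ⟧ ρ < ⟦ b ⟧ ρ
⟦ a := b ⟧ᵍ ρ = ⟦ a ⟧ ρ ≡ ⟦ b ⟧ ρ
⟦ :⊥ ⟧ᵍ ρ = ⊥
⟦ g :⇒ h ⟧ᵍ ρ = ⟦ g ⟧ᵍ ρ → ⟦ h ⟧ᵍ ρ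

-- Affine forms: constant term first, then the coefficients.
Aff : ℕ → Set
Aff n = Vec ℕ (suc n)

_⊕_ : ∀ {m} → Vec ℕ m → Vec ℕ m → Vec ℕ m
_⊕_ = zipWith _+_

unit : ∀ {n} → Fin n → Vec ℕ n
unit zero    = 1 ∷ replicate _ 0
unit (suc x) = 0 ∷ unit x

affine : ∀ {n} → Lin n → Aff n
affine (var x)  = 0 ∷ unit x
affine (# k)    = k ∷ replicate _ 0
affine (a :+ b) = affine a ⊕ affine b

dot : ∀ {m} → Vec ℕ m → Vec ℕ m → ℕ
dot []       []      = 0
dot (c ∷ cs) (x ∷ ρ) = c * x + dot cs ρ

dot-0 : ∀ {m} (ρ : Vec ℕ m) → dot (replicate m 0) ρ ≡ 0
dot-0 []      = refl
dot-0 (x ∷ ρ) = dot-0 ρ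

dot-unit : ∀ {m} (x : Fin m) (ρ : Vec ℕ m) → dot (unit x) ρ ≡ lookup ρ x
dot-unit zero    (y ∷ ρ) = trans (cong₂ _+_ (*-identityˡ y) (dot-0 ρ)) (+-identityʳ y)
dot-unit (suc x) (y ∷ ρ) = dot-unit x ρ

dot-⊕ : ∀ {m} (a b ρ : Vec ℕ m) → dot (a ⊕ b) ρ ≡ dot a ρ + dot b ρ
dot-⊕ [] [] [] = refl
dot-⊕ (a ∷ as) (b ∷ bs) (x ∷ ρ) rewrite dot-⊕ as bs ρ = rearrange a b x (dot as ρ) (dot bs ρ)
  where
  rearrange : ∀ a b x u v → (a + b) * x + (u + v) ≡ a * x + u + (b * x + v)
  rearrange = solve-∀

affine-sound : ∀ {n} (a : Lin n) ρ → dot (affine a) (1 ∷ ρ) ≡ ⟦ a ⟧ ρ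
affine-sound (var x)  ρ = dot-unit x ρ
affine-sound (# k)    ρ = trans (cong₂ _+_ (*-identityʳ k) (dot-0 ρ)) (+-identityʳ k)
affine-sound (a :+ b) ρ = trans (dot-⊕ (affine a) (affine b) (1 ∷ ρ))
                                (cong₂ _+_ (affine-sound a ρ) (affine-sound b ρ))

leq : ∀ {m} → Vec ℕ m → Vec ℕ m → Bool
leq []       []       = true
leq (a ∷ as) (b ∷ bs) = (a ≤ᵇ b) ∧ leq as bs

leq-sound : ∀ {m} (as bs : Vec ℕ m) → T (leq as bs) → ∀ ρ → dot as ρ ≤ dot bs ρ
leq-sound [] [] _ [] = z≤n
leq-sound (a ∷ as) (b ∷ bs) t (x ∷ ρ) with Equivalence.to T-∧ t
... | t₁ , t₂ = +-mono-≤ (*-monoˡ-≤ x (≤ᵇ⇒≤ a b t₁)) (leq-sound as bs t₂ ρ)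

Hyps : ℕ → Set
Hyps n = List (Aff n × Aff n)

Holds : ∀ {n} → Hyps n → Vec ℕ n → Set
Holds []             ρ = ⊤
Holds ((a , b) ∷ hs) ρ = (dot a (1 ∷ ρ) ≤ dot b (1 ∷ ρ)) × Holds hs ρ

-- An inequality A ≤ B is searched as a nonnegative combination, with
-- multiplicities at most two, of the hypotheses: using a ≤ b turns
-- the goal into A + b ≤ B + a.
search : ∀ {n} → Hyps n → Aff n → Aff n → Bool
search []             A B = leq A B
search ((a , b) ∷ hs) A B =
  search hs (A ⊕ b) (B ⊕ a) ∨ (search hs A B ∨ search hs ((A ⊕ b) ⊕ b) ((B ⊕ a) ⊕ a))

use : ∀ {m} (a b A B ρ : Vec ℕ m) → dot a ρ ≤ dot b ρ
    → dot (A ⊕ b) ρ ≤ dot (B ⊕ a) ρ → dot A ρ ≤ dot B ρ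
use a b A B ρ h g = +-cancelʳ-≤ (dot b ρ) _ _
  (≤-trans (subst₂ _≤_ (dot-⊕ A b ρ) (dot-⊕ B a ρ) g) (+-monoʳ-≤ (dot B ρ) h))

search-sound : ∀ {n} (hs : Hyps n) (A B : Aff n) → T (search hs A B)
             → ∀ ρ → Holds hs ρ → dot A (1 ∷ ρ) ≤ dot B (1 ∷ ρ)
search-sound [] A B t ρ _ = leq-sound A B t (1 ∷ ρ)
search-sound ((a , b) ∷ hs) A B t ρ (h , ok)
  with Equivalence.to (T-∨ {search hs (A ⊕ b) (B ⊕ a)}) t
... | inj₁ t₁ = use a b A B (1 ∷ ρ) h (search-sound hs _ _ t₁ ρ ok)
... | inj₂ t' with Equivalence.to (T-∨ {search hs A B}) t'
...   | inj₁ t₂ = search-sound hs A B t₂ ρ ok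
...   | inj₂ t₃ = use a b A B (1 ∷ ρ) h (use a b (A ⊕ b) (B ⊕ a) (1 ∷ ρ) h (search-sound hs _ _ t₃ ρ ok))

check : ∀ {n} → Hyps n → Goal n → Bool
check hs (a :≤ b) = search hs (affine a) (affine b)
check hs (a :< b) = search hs (affine (# 1 :+ a)) (affine b)
check hs (a := b) = search hs (affine a) (affine b) ∧ search hs (affine b) (affine a)
check hs :⊥       = search hs (affine (# 1)) (affine (# 0))
check hs ((a :≤ b) :⇒ g) = check ((affine a , affine b) ∷ hs) g
check hs ((a :< b) :⇒ g) = check ((affine (# 1 :+ a) , affine b) ∷ hs) g
check hs ((a := b) :⇒ g) = check ((affine a , affine b) ∷ (affine b , affine a) ∷ hs) g
check hs (:⊥ :⇒ g)       = true
check hs ((_ :⇒ _) :⇒ g) = check hs g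

hold : ∀ {n} (a b : Lin n) ρ → ⟦ a ⟧ ρ ≤ ⟦ b ⟧ ρ → dot (affine a) (1 ∷ ρ) ≤ dot (affine b) (1 ∷ ρ)
hold a b ρ = subst₂ _≤_ (sym (affine-sound a ρ)) (sym (affine-sound b ρ))

release : ∀ {n} (a b : Lin n) ρ → dot (affine a) (1 ∷ ρ) ≤ dot (affine b) (1 ∷ ρ) → ⟦ a ⟧ ρ ≤ ⟦ b ⟧ ρ
release a b ρ = subst₂ _≤_ (affine-sound a ρ) (affine-sound b ρ)

check-sound : ∀ {n} (hs : Hyps n) (g : Goal n) → T (check hs g)
            → ∀ ρ → Holds hs ρ → ⟦ g ⟧ᵍ ρ
check-sound hs (a :≤ b) t ρ ok = release a b ρ (search-sound hs _ _ t ρ ok)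
check-sound hs (a :< b) t ρ ok = release (# 1 :+ a) b ρ (search-sound hs _ _ t ρ ok)
check-sound hs (a := b) t ρ ok with Equivalence.to T-∧ t
... | t₁ , t₂ = ≤-antisym (release a b ρ (search-sound hs _ _ t₁ ρ ok))
                          (release b a ρ (search-sound hs _ _ t₂ ρ ok))
check-sound hs :⊥ t ρ ok with release (# 1) (# 0) ρ (search-sound hs _ _ t ρ ok)
... | ()
check-sound hs ((a :≤ b) :⇒ g) t ρ ok h = check-sound _ g t ρ (hold a b ρ h , ok)
check-sound hs ((a :< b) :⇒ g) t ρ ok h = check-sound _ g t ρ (hold (# 1 :+ a) b ρ h , ok)
check-sound hs ((a := b) :⇒ g) t ρ ok h =
  check-sound _ g t ρ (hold a b ρ (≤-reflexive h) , hold b a ρ (≤-reflexive (sym h)) , ok)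
check-sound hs (:⊥ :⇒ g) t ρ ok ()
check-sound hs ((_ :⇒ _) :⇒ g) t ρ ok _ = check-sound hs g t ρ ok

vars : ∀ n → Vec (Lin n) n
vars n = Vec.map var (allFin n)

∀ⁿ-intro : ∀ n {P : Vec ℕ n → Set} → (∀ ρ → P ρ) → ∀ⁿ n (curryⁿ P)
∀ⁿ-intro zero    p = p []
∀ⁿ-intro (suc n) p = λ x → ∀ⁿ-intro n (λ ρ → p (x ∷ ρ))

-- Proof by reflection: for a concrete goal the Boolean test evaluates to `true`, so the implicit
-- argument has the unit type and is filled in by eta. The explicit arguments of a call are the
-- values of the variables and then proofs of the hypotheses.
lin : ∀ n (f : N-ary n (Lin n) (Goal n)) → {T (check [] (f $ⁿ vars n))}
    → ∀ⁿ n (curryⁿ {n = n} (⟦ f $ⁿ vars n ⟧ᵍ))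
lin n f {t} = ∀ⁿ-intro n (λ ρ → check-sound [] (f $ⁿ vars n) t ρ tt)

-- Signatures and tensor products

-- A signature (p , m) is the reduced word +ᵖ −ᵐ; the product is
-- concatenation followed by deletion of the pairs − +.
Sig : Set
Sig = ℕ × ℕ

P M : Sig → ℕ
P = proj₁
M = proj₂

infixl 6 _∙_
_∙_ : Sig → Sig → Sig
(p , m) ∙ (q , n) = p + (q ∸ m) , n + (m ∸ q)

ε : Sig
ε = 0 , 0

∙-identityˡ : ∀ s → ε ∙ s ≡ s
∙-identityˡ (p , m) = cong₂ _,_ refl (trans (cong (m +_) (0∸n≡0 p)) (+-identityʳ m))

∙-identityʳ : ∀ s → s ∙ ε ≡ s
∙-identityʳ (p , m) = cong₂ _,_ (trans (cong (p +_) (0∸n≡0 m)) (+-identityʳ p)) refl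

∸-cases : ∀ x y → (x ∸ y ≡ 0 × x ≤ y) ⊎ (x ∸ y + y ≡ x)
∸-cases x y with ≤-total x y
... | inj₁ x≤y = inj₁ (m≤n⇒m∸n≡0 x≤y , x≤y)
... | inj₂ y≤x = inj₂ (m∸n+n≡m y≤x)

-- Subtraction from a sum uses up the first summand before it touches the second; this is how a
-- block of signs cancels against two neighbouring blocks in turn.
∸-+-assoc′ : ∀ n k r → (n + k) ∸ r ≡ (n ∸ r) + (k ∸ (r ∸ n))
∸-+-assoc′ zero    k r       = cong (_+ (k ∸ r)) (sym (0∸n≡0 r))
∸-+-assoc′ (suc n) k zero    = refl
∸-+-assoc′ (suc n) k (suc r) = ∸-+-assoc′ n k r

∙-assoc : ∀ a b c → (a ∙ b) ∙ c ≡ a ∙ (b ∙ c)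
∙-assoc (p , m) (q , n) (r , o) = cong₂ _,_ plusPart minusPart
  where
  open ≡-Reasoning
  plusPart : p + (q ∸ m) + (r ∸ (n + (m ∸ q))) ≡ p + ((q + (r ∸ n)) ∸ m)
  plusPart = begin
    p + (q ∸ m) + (r ∸ (n + (m ∸ q)))    ≡⟨ +-assoc p _ _ ⟩
    p + ((q ∸ m) + (r ∸ (n + (m ∸ q))))  ≡⟨ cong (λ z → p + ((q ∸ m) + z)) (sym (∸-+-assoc r n (m ∸ q))) ⟩
    p + ((q ∸ m) + (r ∸ n ∸ (m ∸ q)))    ≡⟨ cong (p +_) (sym (∸-+-assoc′ q (r ∸ n) m)) ⟩
    p + ((q + (r ∸ n)) ∸ m)              ∎
  minusPart : o + ((n + (m ∸ q)) ∸ r) ≡ o + (n ∸ r) + (m ∸ (q + (r ∸ n)))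
  minusPart = begin
    o + ((n + (m ∸ q)) ∸ r)              ≡⟨ cong (o +_) (∸-+-assoc′ n (m ∸ q) r) ⟩
    o + ((n ∸ r) + ((m ∸ q) ∸ (r ∸ n)))  ≡⟨ cong (λ z → o + ((n ∸ r) + z)) (∸-+-assoc m q (r ∸ n)) ⟩
    o + ((n ∸ r) + (m ∸ (q + (r ∸ n))))  ≡⟨ sym (+-assoc o _ _) ⟩
    o + (n ∸ r) + (m ∸ (q + (r ∸ n)))    ∎

-- The tensor product rule: f acts on the factor that carries the last
-- uncancelled +.  The arguments of Ten are "f a = a′", "a = a′", the
-- signature of a, and the same for b.
Ten : Set → Set → Sig → Set → Set → Sig → Set
Ten FA A≡ a FB B≡ b = (FB × A≡ × M a < P b) ⊎ (FA × B≡ × P b ≤ M a)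

module _ {X Y Z : Set} {FX FY FZ : Set} {x x′ : X} {y y′ : Y} {z z′ : Z} (a b c : Sig) where

  private
    Left Right : Set
    Left  = Ten (Ten FX (x ≡ x′) a FY (y ≡ y′) b) ((x , y) ≡ (x′ , y′)) (a ∙ b) FZ (z ≡ z′) c
    Right = Ten FX (x ≡ x′) a (Ten FY (y ≡ y′) b FZ (z ≡ z′) c) ((y , z) ≡ (y′ , z′)) (b ∙ c)

  -- Which of three factors carries the last uncancelled + does not depend on the bracketing. The
  -- cases follow the acting factor; `∸-cases` is needed wherever a product signature contains a
  -- truncated difference.
  Ten-assocʳ : Left → Right
  Ten-assocʳ (inj₁ (fz , refl , l)) with ∸-cases (M a) (P b) | ∸-cases (P c) (M b)
  ... | inj₁ (d , h) | inj₁ (_ , k) = ⊥-elim (lin 4 (λ mb d pc ma → mb :+ d :< pc :⇒ pc :≤ mb :⇒ :⊥) (M b) _ (P c) 0 l k)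
  ... | inj₂ d | inj₁ (_ , k) = ⊥-elim (lin 4 (λ mb d pc ma → mb :+ d :< pc :⇒ pc :≤ mb :⇒ :⊥) (M b) _ (P c) 0 l k)
  ... | inj₁ (d , h) | inj₂ e =
    inj₁ (inj₁ (fz , refl , lin 3 (λ mb d pc → mb :+ d :< pc :⇒ mb :< pc) (M b) _ (P c) l) , refl
         , lin 6 (λ ma pb d e pc mb → mb :+ d :< pc :⇒ d := # 0 :⇒ ma :≤ pb :⇒ e :+ mb := pc :⇒ ma :< pb :+ e)
             (M a) (P b) _ _ (P c) (M b) l d h e)
  ... | inj₂ d | inj₂ e =
    inj₁ (inj₁ (fz , refl , lin 3 (λ mb d pc → mb :+ d :< pc :⇒ mb :< pc) (M b) _ (P c) l) , refl
         , lin 6 (λ ma pb d e pc mb → mb :+ d :< pc :⇒ d :+ pb := ma :⇒ e :+ mb := pc :⇒ ma :< pb :+ e)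
             (M a) (P b) _ _ (P c) (M b) l d e)
  Ten-assocʳ (inj₂ (inj₁ (fy , refl , l) , refl , h)) =
    inj₁ (inj₂ (fy , refl , subst (P c ≤_) (trans (cong (M b +_) (m≤n⇒m∸n≡0 (<⇒≤ l))) (+-identityʳ _)) h) , refl
         , ≤-trans l (m≤m+n _ _))
  Ten-assocʳ (inj₂ (inj₂ (fx , refl , l) , refl , h)) =
    inj₂ (fx , refl , bound)
    where
    bound : P b + (P c ∸ M b) ≤ M a
    bound with ∸-cases (P c) (M b)
    ... | inj₁ (e , _) = subst (λ z → P b + z ≤ M a) (sym e) (subst (_≤ M a) (sym (+-identityʳ _)) l)
    ... | inj₂ e = lin 6 (λ ma pb d e pc mb → pc :≤ mb :+ d :⇒ d :+ pb := ma :⇒ e :+ mb := pc :⇒ pb :+ e :≤ ma)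
                     (M a) (P b) (M a ∸ P b) _ (P c) (M b) h (m∸n+n≡m l) e

  Ten-assocˡ : Right → Left
  Ten-assocˡ (inj₁ (inj₁ (fz , refl , l) , refl , h)) = inj₁ (fz , refl , bound)
    where
    bound : M b + (M a ∸ P b) < P c
    bound with ∸-cases (M a) (P b)
    ... | inj₁ (e , _) = subst (λ z → M b + z < P c) (sym e) (subst (_< P c) (sym (+-identityʳ _)) l)
    ... | inj₂ d = lin 6 (λ ma pb d e pc mb → ma :< pb :+ e :⇒ d :+ pb := ma :⇒ e :+ mb := pc :⇒ mb :+ d :< pc)
                     (M a) (P b) _ (P c ∸ M b) (P c) (M b) h d (m∸n+n≡m (<⇒≤ l))
  Ten-assocˡ (inj₁ (inj₂ (fy , refl , l) , refl , h)) =
    inj₂ (inj₁ (fy , refl , subst (M a <_) (trans (cong (P b +_) (m≤n⇒m∸n≡0 l)) (+-identityʳ _)) h) , refl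
         , ≤-trans l (m≤m+n _ _))
  Ten-assocˡ (inj₂ (fx , refl , l)) =
    inj₂ (inj₂ (fx , refl , ≤-trans (m≤m+n _ _) l) , refl , bound)
    where
    bound : P c ≤ M b + (M a ∸ P b)
    bound with ∸-cases (P c) (M b) 
    ... | inj₁ (_ , h) = ≤-trans h (m≤m+n _ _)
    ... | inj₂ e = lin 6 (λ ma pb d e pc mb → pb :+ e :≤ ma :⇒ d :+ pb := ma :⇒ e :+ mb := pc :⇒ pc :≤ mb :+ d)
                     (M a) (P b) (M a ∸ P b) _ (P c) (M b) l (m∸n+n≡m (m+n≤o⇒m≤o (P b) l)) e

-- f turns the last uncancelled + of a signature into a −.
Moves : Sig → Sig → Set
Moves s s′ = P s ≡ suc (P s′) × M s′ ≡ suc (M s)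

-- The inequality of the branch says that the + in question survives cancellation both before and
-- after the move. If the right factor acts, its remaining + still absorb every - on the left; if
-- the left factor acts, its - already absorb every + on the right, so one more - cancels nothing.
Ten-moves : ∀ {FA A≡ a a′ FB B≡ b b′} → (FA → Moves a a′) → (A≡ → a ≡ a′) → (FB → Moves b b′) → (B≡ → b ≡ b′)
          → Ten FA A≡ a FB B≡ b → Moves (a ∙ b) (a′ ∙ b′)
Ten-moves {a = a} {b = p , m} {b′ = p′ , m′} fa ea fb eb (inj₁ (x , e , l)) with ea e | fb x
... | refl | refl , refl =
  trans (cong (P a +_) (+-∸-assoc 1 (≤-pred l))) (+-suc _ _)
  , cong suc (cong (m +_) (trans (m≤n⇒m∸n≡0 (≤-pred l)) (sym (m≤n⇒m∸n≡0 (<⇒≤ l)))))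
Ten-moves {a = p , m} {a′ = p′ , m′} {b = b} fa ea fb eb (inj₂ (x , e , l)) with eb e | fa x
... | refl | refl , refl =
  cong suc (cong (p′ +_) (trans (m≤n⇒m∸n≡0 l) (sym (m≤n⇒m∸n≡0 (m≤n⇒m≤1+n l)))))
  , trans (cong (M b +_) (+-∸-assoc 1 l)) (+-suc _ _)

-- Rows and the insertion of a column into a row

bit : Bool → ℕ
bit true  = 1
bit false = 0

bit≤1 : ∀ b → bit b ≤ 1
bit≤1 true  = ≤-refl
bit≤1 false = z≤n

-- Letters are 0-based below: the letter k stands for the integer k + 1.
_‼_ : ∀ {n} → Vec ℕ n → ℕ → ℕ
[]      ‼ _     = 0
(x ∷ R) ‼ zero  = x
(x ∷ R) ‼ suc k = R ‼ k

mem : ∀ {n} → Subset n → ℕ → Bool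
mem []      _       = false
mem (b ∷ E) zero    = b
mem (b ∷ E) (suc k) = mem E k

cum : ∀ {n} → Vec ℕ n → ℕ → ℕ
cum R       zero    = 0
cum []      (suc k) = 0
cum (x ∷ R) (suc k) = x + cum R k

stepE stepP : Bool → Bool → ℕ → Bool
stepR : Bool → Bool → ℕ → ℕ
stepE false e     r       = false
stepE true  true  r       = true
stepE true  false zero    = false
stepE true  false (suc r) = true
stepR false true  r       = suc r
stepR false false r       = r
stepR true  true  r       = r
stepR true  false zero    = zero
stepR true  false (suc r) = r
stepP false e     r       = e
stepP true  true  r       = true
stepP true  false zero    = true
stepP true  false (suc r) = false

-- Row insertion of a strictly decreasing word E into a row R, letter by
-- letter of the alphabet: the state bit says that one inserted letter is
-- still waiting for the next larger letter of the row, which it bumps.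
insE : ∀ {n} → Bool → Subset n → Vec ℕ n → Subset n
insR : ∀ {n} → Bool → Subset n → Vec ℕ n → Vec ℕ n
insP : ∀ {n} → Bool → Subset n → Vec ℕ n → Bool
insE p []      []      = []
insE p (e ∷ E) (r ∷ R) = stepE p e r ∷ insE (stepP p e r) E R
insR p []      []      = []
insR p (e ∷ E) (r ∷ R) = stepR p e r ∷ insR (stepP p e r) E R
insP p []      []      = p
insP p (e ∷ E) (r ∷ R) = insP (stepP p e r) E R

-- Two kinds of steps leave a letter pending without bumping one: the insertion of k, which makes
-- its multiplicity positive, and the idle step across an empty cell. The new multiplicity tells
-- them apart, and this is why the step can be inverted.
unstepE unstepP : Bool → Bool → ℕ → Bool
unstepR : Bool → Bool → ℕ → ℕ
unstepE false e     r       = false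
unstepE true  true  r       = true
unstepE true  false zero    = false
unstepE true  false (suc r) = true
unstepP q     true  r       = true
unstepP false false r       = false
unstepP true  false zero    = true
unstepP true  false (suc r) = false
unstepR false true  r       = suc r
unstepR false false r       = r
unstepR true  true  r       = r
unstepR true  false zero    = zero
unstepR true  false (suc r) = r

-- The run goes from the last letter of the alphabet down, because the state that is known is the
-- final one: whether the row has grown.
delE : ∀ {n} → Bool → Subset n → Vec ℕ n → Subset n
delR : ∀ {n} → Bool → Subset n → Vec ℕ n → Vec ℕ n
delP : ∀ {n} → Bool → Subset n → Vec ℕ n → Bool
delP q []      []      = q
delP q (e ∷ E) (r ∷ R) = unstepP (delP q E R) e r
delE q []      []      = []
delE q (e ∷ E) (r ∷ R) = unstepE (delP q E R) e r ∷ delE q E R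
delR q []      []      = []
delR q (e ∷ E) (r ∷ R) = unstepR (delP q E R) e r ∷ delR q E R

unstep∘step : ∀ p e r → unstepP (stepP p e r) (stepE p e r) (stepR p e r) ≡ p
              × unstepE (stepP p e r) (stepE p e r) (stepR p e r) ≡ e
              × unstepR (stepP p e r) (stepE p e r) (stepR p e r) ≡ r
unstep∘step false true  r       = refl , refl , refl
unstep∘step false false r       = refl , refl , refl
unstep∘step true  true  r       = refl , refl , refl
unstep∘step true  false zero    = refl , refl , refl
unstep∘step true  false (suc r) = refl , refl , refl

step∘unstep : ∀ q e r → stepP (unstepP q e r) (unstepE q e r) (unstepR q e r) ≡ q
              × stepE (unstepP q e r) (unstepE q e r) (unstepR q e r) ≡ e
              × stepR (unstepP q e r) (unstepE q e r) (unstepR q e r) ≡ r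
step∘unstep false true  r       = refl , refl , refl
step∘unstep true  true  r       = refl , refl , refl
step∘unstep false false r       = refl , refl , refl
step∘unstep true  false zero    = refl , refl , refl
step∘unstep true  false (suc r) = refl , refl , refl

del∘ins : ∀ {n} p (E : Subset n) R → let q = insP p E R; E′ = insE p E R; R′ = insR p E R in
      delP q E′ R′ ≡ p × delE q E′ R′ ≡ E × delR q E′ R′ ≡ R
del∘ins p []      []      = refl , refl , refl
del∘ins p (e ∷ E) (r ∷ R) with del∘ins (stepP p e r) E R | unstep∘step p e r
... | a , b , c | x , y , z rewrite a | b | c = x , cong (_∷ E) y , cong (_∷ R) z

ins∘del : ∀ {n} q (E′ : Subset n) R′ → let p = delP q E′ R′; E = delE q E′ R′; R = delR q E′ R′ in
      insP p E R ≡ q × insE p E R ≡ E′ × insR p E R ≡ R′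
ins∘del q []      []      = refl , refl , refl
ins∘del q (e ∷ E) (r ∷ R) with ins∘del q E R | step∘unstep (delP q E R) e r
... | a , b , c | x , y , z rewrite x | y | z = a , cong (e ∷_) b , cong (r ∷_) c

cell-weight : ∀ p e r → stepR p e r + bit (stepE p e r) ≡ r + bit e
cell-weight false true  r       = lin 1 (λ r → # 1 :+ r :+ # 0 := r :+ # 1) r
cell-weight false false r       = refl
cell-weight true  true  r       = refl
cell-weight true  false zero    = refl
cell-weight true  false (suc r) = lin 1 (λ r → r :+ # 1 := # 1 :+ r :+ # 0) r

cell-flow : ∀ p e r → bit (stepP p e r) + bit (stepE p e r) ≡ bit p + bit e
cell-flow false true  r       = refl
cell-flow false false r       = refl
cell-flow true  true  r       = refl
cell-flow true  false zero    = refl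
cell-flow true  false (suc r) = refl

cell-bump : ∀ p e r → bit (stepE p e r) ≤ bit p
cell-bump false e     r       = z≤n
cell-bump true  true  r       = s≤s z≤n
cell-bump true  false zero    = z≤n
cell-bump true  false (suc r) = s≤s z≤n

-- A pending letter survives an idle step only across an empty cell.
cell-idle : ∀ p e r → bit (stepE p e r) ≡ bit p ⊎ (stepE p e r ≡ false × stepR p e r ≡ 0 × r ≡ 0 × e ≡ false)
cell-idle false e     r       = inj₁ refl
cell-idle true  true  r       = inj₁ refl
cell-idle true  false zero    = inj₂ (refl , refl , refl , refl)
cell-idle true  false (suc r) = inj₁ refl

-- Summed over the letters, this identifies the state bit with the excess of the partial sum of the
-- new row over that of the old row. All compatibility proofs below rest on it.
cell-row : ∀ p e r → bit p + stepR p e r ≡ r + bit (stepP p e r)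
cell-row p e r = lin 6 (λ p e r r′ e′ p′ → r′ :+ e′ := r :+ e :⇒ p′ :+ e′ := p :+ e :⇒ p :+ r′ := r :+ p′)
  (bit p) (bit e) r (stepR p e r) (bit (stepE p e r)) (bit (stepP p e r)) (cell-weight p e r) (cell-flow p e r)

ins-weight : ∀ {n} p (E : Subset n) R k → insR p E R ‼ k + bit (mem (insE p E R) k) ≡ R ‼ k + bit (mem E k)
ins-weight p []      []      k       = refl
ins-weight p (e ∷ E) (r ∷ R) zero    = cell-weight p e r
ins-weight p (e ∷ E) (r ∷ R) (suc k) = ins-weight (stepP p e r) E R k

ins-sum : ∀ {n} p (E : Subset n) R → bit p + sum (insR p E R) ≡ sum R + bit (insP p E R)
ins-sum p []      []      = +-identityʳ _
ins-sum p (e ∷ E) (r ∷ R) =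
  lin 7 (λ p r′ s′ r p′ s q → p :+ r′ := r :+ p′ :⇒ p′ :+ s′ := s :+ q :⇒ p :+ (r′ :+ s′) := r :+ s :+ q)
    (bit p) (stepR p e r) _ r (bit (stepP p e r)) (sum R) _ (cell-row p e r) (ins-sum (stepP p e r) E R)

card-∷ : ∀ {n} b (E : Subset n) → ∣ b ∷ E ∣ ≡ bit b + ∣ E ∣
card-∷ true  E = refl
card-∷ false E = refl

ins-card : ∀ {n} p (E : Subset n) R → bit (insP p E R) + ∣ insE p E R ∣ ≡ bit p + ∣ E ∣
ins-card p []      []      = refl
ins-card p (e ∷ E) (r ∷ R) rewrite card-∷ e E | card-∷ (stepE p e r) (insE (stepP p e r) E R) =
  lin 7 (λ p e e′ p′ c′ c q → p′ :+ e′ := p :+ e :⇒ q :+ c′ := p′ :+ c :⇒ q :+ (e′ :+ c′) := p :+ (e :+ c))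
    (bit p) (bit e) _ (bit (stepP p e r)) _ ∣ E ∣ (bit (insP (stepP p e r) E R)) (cell-flow p e r) (ins-card (stepP p e r) E R)

ins-pending : ∀ {n} (E : Subset n) → insP true E (replicate n 0) ≡ true
ins-pending []          = refl
ins-pending (true  ∷ E) = ins-pending E
ins-pending (false ∷ E) = ins-pending E

-- In an empty row the letters of E bump one another until only the smallest is left. So each new
-- row takes one letter and passes on the others, and E adds exactly `∣ E ∣` rows at the bottom.
ins-new : ∀ {n m} (E : Subset n) → ∣ E ∣ ≡ suc m → insP false E (replicate n 0) ≡ true
ins-new (true  ∷ E) _  = ins-pending E
ins-new (false ∷ E) eq = ins-new E eq

card-0 : ∀ {n} (E : Subset n) → ∣ E ∣ ≡ 0 → E ≡ ∅
card-0 []          _  = refl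
card-0 (false ∷ E) eq = cong (false ∷_) (card-0 E eq)

sum-0 : ∀ {n} (R : Vec ℕ n) → sum R ≡ 0 → R ≡ replicate n 0
sum-0 []         _  = refl
sum-0 (zero ∷ R) eq = cong (0 ∷_) (sum-0 R eq)

sum-replicate0 : ∀ n → sum (replicate n 0) ≡ 0
sum-replicate0 zero    = refl
sum-replicate0 (suc n) = sum-replicate0 n

-- CompatFrom 0 0 E R R₂ says that a row with minima R and further entries E can
-- stand on a row with minima R₂; u and v accumulate the partial sums of R
-- and R₂, see CompatFrom⇒Compat.
CompatFrom : ∀ {n} → ℕ → ℕ → Subset n → Vec ℕ n → Vec ℕ n → Set
CompatFrom u v []      []      []        = v ≤ u
CompatFrom u v (e ∷ E) (r ∷ R) (r₂ ∷ R₂) = v + r₂ + bit e ≤ u × CompatFrom (u + r) (v + r₂) E R R₂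

-- Lower boxes with minimum at most k must lie under upper boxes whose entries are all less than k.
-- There are `cum R k` upper boxes with minimum less than k, and the last of them is excluded if it
-- also holds k, that is, if k is in E.
Compat : ∀ {n} → Subset n → Vec ℕ n → Vec ℕ n → Set
Compat E R R₂ = ∀ k → cum R₂ (suc k) + bit (mem E k) ≤ cum R k

CompatFrom⇒ : ∀ {n u v} (E : Subset n) R R₂ → CompatFrom u v E R R₂ → ∀ k → v + cum R₂ (suc k) + bit (mem E k) ≤ u + cum R k
CompatFrom⇒ {u = u} {v} []      []      []        h k       = lin 3 (λ u v c → v :≤ u :⇒ v :+ # 0 :+ # 0 :≤ u :+ c) u v _ h
CompatFrom⇒ {u = u} {v} (e ∷ E) (r ∷ R) (r₂ ∷ R₂) (h , _) zero    = lin 4 (λ u v r₂ b → v :+ r₂ :+ b :≤ u :⇒ v :+ (r₂ :+ # 0) :+ b :≤ u :+ # 0) u v r₂ (bit e) h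
CompatFrom⇒ {u = u} {v} (e ∷ E) (r ∷ R) (r₂ ∷ R₂) (_ , h) (suc k) =
  lin 7 (λ u v r r₂ c c₂ b → v :+ r₂ :+ c₂ :+ b :≤ u :+ r :+ c :⇒ v :+ (r₂ :+ c₂) :+ b :≤ u :+ (r :+ c))
    u v r r₂ (cum R k) (cum R₂ (suc k)) _ (CompatFrom⇒ E R R₂ h k)

⇒Cpt : ∀ {n u v} (E : Subset n) R R₂ → v ≤ u → (∀ k → v + cum R₂ (suc k) + bit (mem E k) ≤ u + cum R k) → CompatFrom u v E R R₂
⇒Cpt []      []      []        h f = h
⇒Cpt {u = u} {v} (e ∷ E) (r ∷ R) (r₂ ∷ R₂) h f =
  lin 4 (λ u v r₂ b → v :+ (r₂ :+ # 0) :+ b :≤ u :+ # 0 :⇒ v :+ r₂ :+ b :≤ u) u v r₂ (bit e) (f 0)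
  , ⇒Cpt E R R₂ (lin 5 (λ u v r r₂ b → v :+ (r₂ :+ # 0) :+ b :≤ u :+ # 0 :⇒ v :+ r₂ :≤ u :+ r) u v r r₂ (bit e) (f 0))
      (λ k → lin 7 (λ u v r r₂ c c₂ b → v :+ (r₂ :+ c₂) :+ b :≤ u :+ (r :+ c) :⇒ v :+ r₂ :+ c₂ :+ b :≤ u :+ r :+ c)
               u v r r₂ (cum R k) (cum R₂ (suc k)) _ (f (suc k)))

CompatFrom⇒Compat : ∀ {n} (E : Subset n) R R₂ → CompatFrom 0 0 E R R₂ → Compat E R R₂
CompatFrom⇒Compat E R R₂ h = CompatFrom⇒ E R R₂ h

Compat⇒Cpt : ∀ {n} (E : Subset n) R R₂ → Compat E R R₂ → CompatFrom 0 0 E R R₂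
Compat⇒Cpt E R R₂ h = ⇒Cpt E R R₂ z≤n h

CompatFrom⇒≤ : ∀ {n u v} (E : Subset n) R R₂ → CompatFrom u v E R R₂ → v ≤ u
CompatFrom⇒≤ []      []      []        h       = h
CompatFrom⇒≤ {u = u} {v} (e ∷ E) (r ∷ R) (r₂ ∷ R₂) (h , _) = lin 4 (λ u v r₂ b → v :+ r₂ :+ b :≤ u :⇒ v :≤ u) u v r₂ (bit e) h

CompatFrom⇒sum : ∀ {n u v} (E : Subset n) R R₂ → CompatFrom u v E R R₂ → v + sum R₂ ≤ u + sum R
CompatFrom⇒sum {u = u} {v} []      []      []        h       = +-mono-≤ h z≤n
CompatFrom⇒sum {u = u} {v} (e ∷ E) (r ∷ R) (r₂ ∷ R₂) (_ , h) =
  lin 6 (λ u v r r₂ c c₂ → v :+ r₂ :+ c₂ :≤ u :+ r :+ c :⇒ v :+ (r₂ :+ c₂) :≤ u :+ (r :+ c))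
    u v r r₂ (sum R) (sum R₂) (CompatFrom⇒sum E R R₂ h)

-- By `cell-row` the partial sum of the new lower row is v plus the state bit. If the bumped letter
-- uses up the pending one, `cell-weight` turns the old bound into the new one. An idle step adds
-- nothing to the row, and the bound `l` inherited from the previous letter is enough.
CompatFrom-upper : ∀ {n} p u v (E : Subset n) R₀ R → v + bit p ≤ u → CompatFrom u v E R₀ R → CompatFrom u (v + bit p) ∅ R₀ (insR p E R)
CompatFrom-upper p u v []      []        []      l h = l
CompatFrom-upper p u v (e ∷ E) (r₀ ∷ R₀) (r ∷ R) l (h , hs) =
  first , subst (λ z → CompatFrom (u + r₀) z ∅ R₀ (insR (stepP p e r) E R)) eq
    (CompatFrom-upper (stepP p e r) (u + r₀) (v + r) E R₀ R next hs)
  where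
  eq : v + r + bit (stepP p e r) ≡ v + bit p + stepR p e r
  eq = lin 5 (λ v r p′ p r′ → p :+ r′ := r :+ p′ :⇒ v :+ r :+ p′ := v :+ p :+ r′) v r _ (bit p) _ (cell-row p e r)
  first : v + bit p + stepR p e r + 0 ≤ u
  first with cell-idle p e r
  ... | inj₁ i = lin 7 (λ u v r e r′ e′ p → v :+ r :+ e :≤ u :⇒ r′ :+ e′ := r :+ e :⇒ e′ := p :⇒ v :+ p :+ r′ :+ # 0 :≤ u)
                   u v r (bit e) _ _ _ h (cell-weight p e r) i
  ... | inj₂ (_ , i , _ , _) = lin 4 (λ u v p r′ → v :+ p :≤ u :⇒ r′ := # 0 :⇒ v :+ p :+ r′ :+ # 0 :≤ u) u v _ _ l i
  next : v + r + bit (stepP p e r) ≤ u + r₀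
  next = subst (_≤ u + r₀) (sym eq) (lin 5 (λ u v p r′ r₀ → v :+ p :+ r′ :+ # 0 :≤ u :⇒ v :+ p :+ r′ :≤ u :+ r₀) u v _ _ r₀ first)

-- A letter is bumped only if another one is pending, and the pending letter has already raised the
-- partial sum of the upper row by the one unit that is needed.
CompatFrom-lower : ∀ {n} p u v (E : Subset n) R R₃ → CompatFrom u v ∅ R R₃ → CompatFrom (u + bit p) v (insE p E R) (insR p E R) R₃
CompatFrom-lower p u v []      []      []        h = ≤-trans h (m≤m+n u _)
CompatFrom-lower p u v (e ∷ E) (r ∷ R) (r₃ ∷ R₃) (h , hs) =
  lin 5 (λ u v r₃ e′ p → v :+ r₃ :+ # 0 :≤ u :⇒ e′ :≤ p :⇒ v :+ r₃ :+ e′ :≤ u :+ p) u v r₃ _ _ h (cell-bump p e r)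
  , subst (λ z → CompatFrom z (v + r₃) (insE (stepP p e r) E R) (insR (stepP p e r) E R) R₃)
      (lin 5 (λ u r p′ p r′ → p :+ r′ := r :+ p′ :⇒ u :+ r :+ p′ := u :+ p :+ r′) u r _ (bit p) _ (cell-row p e r))
      (CompatFrom-lower (stepP p e r) (u + r) (v + r₃) E R R₃ hs)

-- The two converses, stated for the source (p , E , R) of the transducer.
CompatFrom-upper⁻¹ : ∀ {n} p u v (E : Subset n) R₀ R → CompatFrom u (v + bit p) ∅ R₀ (insR p E R) → CompatFrom u v E R₀ R
CompatFrom-upper⁻¹ p u v []      []        []      h = m+n≤o⇒m≤o v h
CompatFrom-upper⁻¹ p u v (e ∷ E) (r₀ ∷ R₀) (r ∷ R) (h , hs) =
  lin 7 (λ u v r e r′ e′ p → v :+ p :+ r′ :+ # 0 :≤ u :⇒ r′ :+ e′ := r :+ e :⇒ e′ :≤ p :⇒ v :+ r :+ e :≤ u)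
    u v r _ _ _ _ h (cell-weight p e r) (cell-bump p e r)
  , CompatFrom-upper⁻¹ (stepP p e r) (u + r₀) (v + r) E R₀ R
      (subst (λ z → CompatFrom (u + r₀) z ∅ R₀ (insR (stepP p e r) E R))
        (lin 5 (λ v r p′ p r′ → p :+ r′ := r :+ p′ :⇒ v :+ p :+ r′ := v :+ r :+ p′) v r _ (bit p) _ (cell-row p e r)) hs)

CompatFrom-lower⁻¹ : ∀ {n} p u v (E : Subset n) R R₃ → v + sum R₃ ≤ u + sum R
            → CompatFrom (u + bit p) v (insE p E R) (insR p E R) R₃ → CompatFrom u v ∅ R R₃
CompatFrom-lower⁻¹ p u v []      []      []        l h = subst₂ _≤_ (+-identityʳ v) (+-identityʳ u) l
CompatFrom-lower⁻¹ p u v (e ∷ E) (r ∷ R) (r₃ ∷ R₃) l (h , hs) = first , rest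
  where
  rest : CompatFrom (u + r) (v + r₃) ∅ R R₃
  rest = CompatFrom-lower⁻¹ (stepP p e r) (u + r) (v + r₃) E R R₃
    (subst₂ _≤_ (sym (+-assoc v r₃ _)) (sym (+-assoc u r _)) l)
    (subst (λ z → CompatFrom z (v + r₃) (insE (stepP p e r) E R) (insR (stepP p e r) E R) R₃)
      (lin 5 (λ u r p′ p r′ → p :+ r′ := r :+ p′ :⇒ u :+ p :+ r′ := u :+ r :+ p′) u r _ (bit p) _ (cell-row p e r)) hs)
  first : v + r₃ + 0 ≤ u
  first with cell-idle p e r
  ... | inj₁ i = lin 5 (λ u v r₃ e′ p → v :+ r₃ :+ e′ :≤ u :+ p :⇒ e′ := p :⇒ v :+ r₃ :+ # 0 :≤ u) u v r₃ _ _ h i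
  -- Here the pending letter raises the right side without bumping anything, so `h` is too weak by
  -- one. Since the cell is empty, the bound can be taken from the next letter; for the last letter
  -- it comes from the hypothesis on the sums.
  ... | inj₂ (_ , _ , refl , _) = lin 3 (λ u v r₃ → v :+ r₃ :≤ u :+ # 0 :⇒ v :+ r₃ :+ # 0 :≤ u) u v r₃ (CompatFrom⇒≤ ∅ R R₃ rest)

-- As long as the partial sum of R is 0, `CompatFrom` keeps the letters out of E. Hence the smallest
-- letter of the row meets the backward step with e = `false` and positive multiplicity, which
-- always ends in the state `false`; smaller letters leave the state alone.
del-start : ∀ {n v} q (E : Subset n) R R₃ → CompatFrom 0 v E R R₃ → (q ≡ true → 1 ≤ sum R) → delP q E R ≡ false
del-start true  [] [] [] _ l with l refl
... | ()
del-start false [] [] [] _ l = refl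
del-start {v = v} q (true ∷ E) (r ∷ R) (r₃ ∷ R₃) (h , _) l =
  ⊥-elim (lin 1 (λ v → v :+ # 1 :≤ # 0 :⇒ :⊥) (v + r₃) h)
del-start q (false ∷ E) (zero ∷ R) (r₃ ∷ R₃) (_ , hs) l rewrite del-start q E R R₃ hs l = refl
del-start q (false ∷ E) (suc r ∷ R) (r₃ ∷ R₃) (_ , hs) l with delP q E R
... | false = refl
... | true  = refl

-- FR and FE turn one k into k + 1.
data FR : ∀ {n} → ℕ → Vec ℕ n → Vec ℕ n → Set where
  here  : ∀ {n x y} {R : Vec ℕ n} → FR 0 (suc x ∷ y ∷ R) (x ∷ suc y ∷ R)
  there : ∀ {n k x} {R R′ : Vec ℕ n} → FR k R R′ → FR (suc k) (x ∷ R) (x ∷ R′)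

data FE : ∀ {n} → ℕ → Subset n → Subset n → Set where
  here  : ∀ {n} {E : Subset n} → FE 0 (true ∷ false ∷ E) (false ∷ true ∷ E)
  there : ∀ {n k x} {E E′ : Subset n} → FE k E E′ → FE (suc k) (x ∷ E) (x ∷ E′)

-- The reading word of a tableau lists the rows from bottom to top, and of
-- each row first E in decreasing order, then R.  In the signatures of these
-- two pieces the letter k is a + and k + 1 is a −.
sigR : ∀ {n} → ℕ → Vec ℕ n → Sig
sigR k R = R ‼ k , R ‼ suc k

sigE : ∀ {n} → ℕ → Subset n → Sig
sigE k E = bit (mem E k) ∸ bit (mem E (suc k)) , bit (mem E (suc k)) ∸ bit (mem E k)

-- Only k and k + 1 carry signs, so the entry state, two bits of E and the vanishing of x or y
-- exhaust the cases. The order of the factors is that of the reading word: E comes from the row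
-- above and so follows R, while the bumped letters go on to the rows below and so precede the new
-- row.
window-sig : ∀ p e f x y →
  (x , y) ∙ (bit e ∸ bit f , bit f ∸ bit e)
  ≡ (bit (stepE p e x) ∸ bit (stepE (stepP p e x) f y) , bit (stepE (stepP p e x) f y) ∸ bit (stepE p e x))
    ∙ (stepR p e x , stepR (stepP p e x) f y)
window-sig false false false x       zero    rewrite 0∸n≡0 x | +-identityʳ x = refl
window-sig false false false x       (suc y) rewrite 0∸n≡0 x | +-identityʳ x | +-identityʳ y = refl
window-sig false false true  x       zero    rewrite 0∸n≡0 x | +-identityʳ x = refl
window-sig false false true  x       (suc y) rewrite 0∸n≡0 x | +-identityʳ x | +-identityʳ y = refl
window-sig false true  false x       zero    = cong (_, 0) (+-comm x 1)
window-sig false true  false x       (suc y) rewrite 0∸n≡0 x | 0∸n≡0 y | +-identityʳ x | +-identityʳ y = refl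
window-sig false true  true  x       zero    rewrite 0∸n≡0 x | +-identityʳ x = refl
window-sig false true  true  x       (suc y) rewrite 0∸n≡0 x | +-identityʳ x | +-identityʳ y = refl
window-sig true  false false zero    zero    = refl
window-sig true  false false zero    (suc y) = cong (0 ,_) (+-comm 1 y)
window-sig true  false false (suc x) zero    rewrite 0∸n≡0 x | +-identityʳ x = refl
window-sig true  false false (suc x) (suc y) rewrite 0∸n≡0 x | +-identityʳ x | +-identityʳ y = refl
window-sig true  false true  zero    zero    = refl
window-sig true  false true  zero    (suc y) = cong (0 ,_) (sym (+-comm (suc y) 1))
window-sig true  false true  (suc x) zero    rewrite 0∸n≡0 x | +-identityʳ x = refl
window-sig true  false true  (suc x) (suc y) rewrite 0∸n≡0 x | +-identityʳ x | +-identityʳ y = refl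
window-sig true  true  false x       zero    rewrite 0∸n≡0 x = cong (_, 0) (+-comm x 1)
window-sig true  true  false zero    (suc y) rewrite 0∸n≡0 y | +-identityʳ y = refl
window-sig true  true  false (suc x) (suc y) rewrite 0∸n≡0 y | +-identityʳ x | +-identityʳ y = refl
window-sig true  true  true  x       zero    rewrite 0∸n≡0 x | +-identityʳ x = refl
window-sig true  true  true  x       (suc y) rewrite 0∸n≡0 x | +-identityʳ x | +-identityʳ y = refl

ins-sig : ∀ {n} k p (E : Subset n) R → suc k < n → sigR k R ∙ sigE k E ≡ sigE k (insE p E R) ∙ sigR k (insR p E R)
ins-sig zero    p (e ∷ f ∷ E) (x ∷ y ∷ R) _ = window-sig p e f x y
ins-sig zero    p (e ∷ [])    (x ∷ [])    (s≤s ())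
ins-sig (suc k) p (e ∷ E)     (x ∷ R)     (s≤s l) = ins-sig k (stepP p e x) E R l

FRE FER : ∀ {n} → ℕ → Vec ℕ n → Vec ℕ n → Subset n → Subset n → Set
FRE k R R₁ E E₁ = Ten (FR k R R₁) (R ≡ R₁) (sigR k R) (FE k E E₁) (E ≡ E₁) (sigE k E)
FER k R R₁ E E₁ = Ten (FE k E E₁) (E ≡ E₁) (sigE k E) (FR k R R₁) (R ≡ R₁) (sigR k R)

InsF : ∀ {n} → Bool → ℕ → Vec ℕ n → Vec ℕ n → Subset n → Subset n → Set
InsF p k R R₁ E E₁ = FER k (insR p E R) (insR p E₁ R₁) (insE p E R) (insE p E₁ R₁) × insP p E R ≡ insP p E₁ R₁

InsF-∷ : ∀ {n k} p e x (R R₁ : Vec ℕ n) (E E₁ : Subset n) → InsF (stepP p e x) k R R₁ E E₁ → InsF p (suc k) (x ∷ R) (x ∷ R₁) (e ∷ E) (e ∷ E₁)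
InsF-∷ p e x R R₁ E E₁ (inj₁ (f , eq , l) , q) = inj₁ (there f , cong (stepE p e x ∷_) eq , l) , q
InsF-∷ p e x R R₁ E E₁ (inj₂ (f , eq , l) , q) = inj₂ (there f , cong (stepR p e x ∷_) eq , l) , q

-- Below k the two runs coincide, at k and k + 1 the cases are finite, and after k + 1 both runs are
-- in the same state again. Equality of the final states says that f does not change whether the row
-- grows; hence the labels are constant along the crystal.
ins-F : ∀ {n} k p {R R₁ : Vec ℕ n} {E E₁ : Subset n} → FRE k R R₁ E E₁ → InsF p k R R₁ E E₁
ins-F (suc k) p {x ∷ R} {E = e ∷ E} (inj₁ (there f , refl , l)) = InsF-∷ p e x _ _ _ _ (ins-F k (stepP p e x) (inj₁ (f , refl , l)))
ins-F (suc k) p {x ∷ R} {E = e ∷ E} (inj₂ (there f , refl , l)) = InsF-∷ p e x _ _ _ _ (ins-F k (stepP p e x) (inj₂ (f , refl , l)))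
ins-F zero false {x ∷ zero ∷ R} (inj₁ (here , refl , _)) = inj₁ (here , refl , s≤s z≤n) , refl
ins-F zero true {zero ∷ zero ∷ R} (inj₁ (here , refl , _)) = inj₂ (here , refl , z≤n) , refl
ins-F zero true {suc x ∷ zero ∷ R} (inj₁ (here , refl , _)) = inj₁ (here , refl , s≤s z≤n) , refl
ins-F zero p {x ∷ suc y ∷ R} (inj₁ (here , refl , s≤s ()))
ins-F zero false {suc x ∷ y ∷ R} {E = false ∷ false ∷ E} (inj₂ (here , refl , l)) = inj₁ (here , refl , s≤s z≤n) , refl
ins-F zero false {suc x ∷ y ∷ R} {E = false ∷ true ∷ E} (inj₂ (here , refl , l)) = inj₁ (here , refl , s≤s z≤n) , refl
ins-F zero false {suc x ∷ suc y ∷ R} {E = true ∷ false ∷ E} (inj₂ (here , refl , l)) = inj₁ (here , refl , s≤s (s≤s z≤n)) , refl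
ins-F zero false {suc x ∷ y ∷ R} {E = true ∷ true ∷ E} (inj₂ (here , refl , l)) = inj₁ (here , refl , s≤s (s≤s z≤n)) , refl
ins-F zero true {suc zero ∷ y ∷ R} {E = false ∷ false ∷ E} (inj₂ (here , refl , l)) = inj₂ (here , refl , z≤n) , refl
ins-F zero true {suc (suc x) ∷ y ∷ R} {E = false ∷ false ∷ E} (inj₂ (here , refl , l)) = inj₁ (here , refl , s≤s z≤n) , refl
ins-F zero true {suc zero ∷ y ∷ R} {E = false ∷ true ∷ E} (inj₂ (here , refl , l)) = inj₂ (here , refl , z≤n) , refl
ins-F zero true {suc (suc x) ∷ y ∷ R} {E = false ∷ true ∷ E} (inj₂ (here , refl , l)) = inj₁ (here , refl , s≤s z≤n) , refl
ins-F zero true {suc x ∷ suc y ∷ R} {E = true ∷ false ∷ E} (inj₂ (here , refl , l)) = inj₁ (here , refl , s≤s z≤n) , refl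
ins-F zero true {suc x ∷ y ∷ R} {E = true ∷ true ∷ E} (inj₂ (here , refl , l)) = inj₁ (here , refl , s≤s z≤n) , refl

-- Uncrowding

at-< : ∀ {A : Set} (p : List A) x {a} → at p x ≡ just a → x < length p
at-< (y ∷ p) zero    _ = s≤s z≤n
at-< (y ∷ p) (suc x) h = s≤s (at-< p x h)

<-at : ∀ {A : Set} (p : List A) x → x < length p → ∃ λ a → at p x ≡ just a
<-at (y ∷ p) zero    _       = y , refl
<-at (y ∷ p) (suc x) (s≤s l) = <-at p x l

at-snoc : ∀ {A : Set} (p : List A) k x {a} → at (p ++ k ∷ []) x ≡ just a → at p x ≡ just a ⊎ (x ≡ length p × a ≡ k)
at-snoc []      k zero    h = inj₂ (refl , sym (just-injective h))
at-snoc (y ∷ p) k zero    h = inj₁ h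
at-snoc (y ∷ p) k (suc x) h with at-snoc p k x h
... | inj₁ e       = inj₁ e
... | inj₂ (e , f) = inj₂ (cong suc e , f)

at-++ : ∀ {A : Set} (p q : List A) x {a} → at p x ≡ just a → at (p ++ q) x ≡ just a
at-++ (y ∷ p) q zero    h = h
at-++ (y ∷ p) q (suc x) h = at-++ p q x h

at-last : ∀ {A : Set} (p : List A) k → at (p ++ k ∷ []) (length p) ≡ just k
at-last []      k = refl
at-last (y ∷ p) k = at-last p k

URow : ℕ → Set
URow n = Vec ℕ n × List ℕ

DRow : ℕ → Set
DRow n = Subset n × Vec ℕ n

zeros : ∀ {n} → Vec ℕ n
zeros = replicate _ 0

addLabel : Bool → ℕ → List ℕ → List ℕ
addLabel true  k p = p ++ k ∷ []
addLabel false k p = p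

insRow : ∀ {n} → ℕ → Subset n → URow n → URow n
insRow k E (R , p) = insR false E R , addLabel (insP false E R) k p

newRows : ∀ {n} → ℕ → ℕ → Subset n → List (URow n)
newRows zero    k E = []
newRows (suc m) k E = insRow k E (zeros , []) ∷ newRows m (suc k) (insE false E zeros)

-- The k-th row below the one that E comes from gets the label k when it
-- grows; these labels fill the flagged increasing tableau.
insCol : ∀ {n} → ℕ → Subset n → List (URow n) → List (URow n)
insCol k E []            = newRows ∣ E ∣ k E
insCol k E ((R , p) ∷ U) = insRow k E (R , p) ∷ insCol (suc k) (insE false E R) U

uncrowd : ∀ {n} → List (DRow n) → List (URow n)
uncrowd []            = []
uncrowd ((E , R) ∷ D) = (R , []) ∷ insCol 1 E (uncrowd D)

lastIs : ℕ → List ℕ → Bool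
lastIs k []          = false
lastIs k (a ∷ [])    = a ≡ᵇ k
lastIs k (_ ∷ b ∷ p) = lastIs k (b ∷ p)

dropLast : List ℕ → List ℕ
dropLast []          = []
dropLast (_ ∷ [])    = []
dropLast (a ∷ b ∷ p) = a ∷ dropLast (b ∷ p)

dropLabel : Bool → List ℕ → List ℕ
dropLabel true  p = dropLast p
dropLabel false p = p

-- Deletion can empty only the last row, since a row above a nonempty one is at least as long.
-- Dropping the emptied row undoes `newRows`.
consNonzero : ∀ {n} → URow n → List (URow n) → List (URow n)
consNonzero (R , p) []      = if sum R ≡ᵇ 0 then [] else (R , p) ∷ []
consNonzero (R , p) (x ∷ U) = (R , p) ∷ x ∷ U

-- The rows below come first: the letters to be put back into a row are known only after the next
-- row has released them. Label k is the largest one that a row at this distance can have, so its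
-- presence at the end is the final state of the insertion.
delCol : ∀ {n} → ℕ → List (URow n) → Subset n × List (URow n)
delCol k []            = ∅ , []
delCol k ((R , p) ∷ U) =
  delE (lastIs k p) (proj₁ (delCol (suc k) U)) R ,
  consNonzero (delR (lastIs k p) (proj₁ (delCol (suc k) U)) R , dropLabel (lastIs k p) p) (proj₂ (delCol (suc k) U))

-- The recursion is on the partition, whose length is the number of rows to be restored; the list
-- returned by `delCol` is not structurally smaller.
crowd : ∀ {n} → List ℕ → List (URow n) → List (DRow n)
crowd (_ ∷ la) ((R , p) ∷ U) = (proj₁ (delCol 1 U) , R) ∷ crowd la (proj₂ (delCol 1 U))
crowd _        _             = []

hd : List ℕ → ℕ
hd []      = 0
hd (x ∷ _) = x

tl : List ℕ → List ℕ
tl []       = []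
tl (_ ∷ xs) = xs

topU : ∀ {n} → List (URow n) → Vec ℕ n
topU []            = zeros
topU ((R , _) ∷ _) = R

topL : ∀ {n} → List (URow n) → List ℕ
topL []            = []
topL ((_ , p) ∷ _) = p

topD : ∀ {n} → List (DRow n) → Vec ℕ n
topD []            = zeros
topD ((_ , R) ∷ _) = R

PosHd : List ℕ → Set
PosHd []      = ⊤
PosHd (l ∷ _) = 1 ≤ l

Flagged : ℕ → List ℕ → Set
Flagged s p = ∀ x a → at p x ≡ just a → 1 ≤ a × a ≤ s

Increasing : List ℕ → Set
Increasing p = ∀ x a b → at p x ≡ just a → at p (suc x) ≡ just b → a < b

-- Strict increase down the columns, for rows of labels p and q that start
-- in the columns l and l₂.
ColInc : ℕ → List ℕ → ℕ → List ℕ → Set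
ColInc l p l₂ q = ∀ x y a b → l + x ≡ l₂ + y → at p x ≡ just a → at q y ≡ just b → a < b

record RowOK {n} (s : ℕ) (la : List ℕ) (R : Vec ℕ n) (p : List ℕ) (U : List (URow n)) : Set where
  constructor rowOK
  field
    len      : hd la + length p ≡ sum R
    nonempty : 1 ≤ sum R
    pos      : PosHd la
    dec      : hd (tl la) ≤ hd la
    flagged  : Flagged s p
    incr     : Increasing p
    compat   : CompatFrom 0 0 ∅ R (topU U)
    colInc   : ColInc (hd la) p (hd (tl la)) (topL U)

-- Pairs of a semistandard tableau and a flagged increasing tableau, from
-- row s on.
UValid : ∀ {n} → ℕ → List ℕ → List (URow n) → Set
UValid s la []            = la ≡ []
UValid s la ((R , p) ∷ U) = RowOK s la R p U × UValid (suc s) (tl la) U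

DValid : ∀ {n} → List ℕ → List (DRow n) → Set
DValid la []            = la ≡ []
DValid la ((E , R) ∷ D) = (hd la ≡ sum R) × (1 ≤ sum R) × CompatFrom 0 0 E R (topD D) × DValid (tl la) D

Parts : List ℕ → Set
Parts []       = ⊤
Parts (l ∷ la) = 1 ≤ l × hd la ≤ l × Parts la

flagged-suc : ∀ {s p} → Flagged s p → Flagged (suc s) p
flagged-suc f x a h = proj₁ (f x a h) , m≤n⇒m≤1+n (proj₂ (f x a h))

flagged-add : ∀ {s p} q → Flagged s p → Flagged (suc s) (addLabel q (suc s) p)
flagged-add {s} {p} false f = flagged-suc {s} {p} f
flagged-add {s} {p} true f x a h with at-snoc p (suc s) x h
... | inj₁ e          = flagged-suc {s} {p} f x a e
... | inj₂ (_ , refl) = s≤s z≤n , ≤-refl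

incr-add : ∀ {s p} q → Flagged s p → Increasing p → Increasing (addLabel q (suc s) p)
incr-add false f i = i
incr-add {s} {p} true f i x a b h k with at-snoc p (suc s) (suc x) k
... | inj₁ e with at-snoc p (suc s) x h
...   | inj₁ e₀         = i x a b e₀ e
...   | inj₂ (refl , _) = ⊥-elim (<-irrefl refl (<-trans (n<1+n _) (at-< p _ e)))
incr-add {s} {p} true f i x a b h k | inj₂ (e , refl) with at-snoc p (suc s) x h
...   | inj₁ e₀         = s≤s (proj₂ (f x a e₀))
...   | inj₂ (refl , _) = ⊥-elim (1+n≢n e)

length-add : ∀ q k p → length (addLabel q k p) ≡ length p + bit q
length-add true  k p = length-++ p
length-add false k p = sym (+-identityʳ _)

topL-ins : ∀ {n} k (E : Subset n) U → ∃ λ q → topL (insCol k E U) ≡ addLabel q k (topL U)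
topL-ins k E ((R , p) ∷ U) = insP false E R , refl
topL-ins k E [] with ∣ E ∣
... | zero  = false , refl
... | suc m = insP false E zeros , refl

CompatFrom-zeros : ∀ {n} u v (R : Vec ℕ n) → v ≤ u → CompatFrom u v ∅ R zeros
CompatFrom-zeros u v []      l = l
CompatFrom-zeros u v (r ∷ R) l = subst (_≤ u) (sym (trans (+-identityʳ _) (+-identityʳ v))) l
                        , CompatFrom-zeros (u + r) (v + 0) R (lin 3 (λ u v r → v :≤ u :⇒ v :+ # 0 :≤ u :+ r) u v r l)

len-top : ∀ {n s la} (U : List (URow n)) → UValid s la U → hd la + length (topL U) ≡ sum (topU U)
len-top {n} [] refl = sym (sum-replicate0 n)
len-top ((R , p) ∷ U) (ok , _) = RowOK.len ok

-- A new label of the lower row is `suc (suc s)` and exceeds everything in the upper row. A new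
-- label of the upper row stands at the end of a row that was already as long as the lower one, so
-- no old label is below it.
colInc-ins : ∀ {n} {s l l₂} q (R : Vec ℕ n) p E U → l + length p ≡ sum R → Flagged s p
           → l₂ + length (topL U) ≡ sum (topU U) → CompatFrom 0 0 ∅ R (topU U) → ColInc l p l₂ (topL U)
           → ColInc l (addLabel q (suc s) p) l₂ (topL (insCol (suc (suc s)) E U))
colInc-ins {s = s} {l} {l₂} q R p E U len fl len₂ mapCompat ci x y a b eq h k with topL-ins (suc (suc s)) E U
... | q₂ , e rewrite e = go q q₂ h k
  where
  old : ∀ q → at (addLabel q (suc s) p) x ≡ just a → at (topL U) y ≡ just b → a < b
  old false h k = ci x y a b eq h k
  old true  h k with at-snoc p (suc s) x h
  ... | inj₁ e         = ci x y a b eq e k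
  ... | inj₂ (refl , _) = ⊥-elim (lin 7 (λ l p l₂ y t sigR st → l :+ p := l₂ :+ y :⇒ y :< t :⇒ l :+ p := sigR :⇒ l₂ :+ t := st :⇒ st :≤ sigR :⇒ :⊥)
          l (length p) l₂ y (length (topL U)) (sum R) (sum (topU U)) eq (at-< (topL U) y k) len len₂ (CompatFrom⇒sum ∅ R (topU U) mapCompat))
  go : ∀ q q₂ → at (addLabel q (suc s) p) x ≡ just a → at (addLabel q₂ (suc (suc s)) (topL U)) y ≡ just b → a < b
  go q false h k = old q h k
  go q true  h k with at-snoc (topL U) (suc (suc s)) y k
  ... | inj₁ e          = old q h e
  ... | inj₂ (_ , refl) = s≤s (proj₂ (flagged-add {s} {p} q fl x a h))

rowOK-ins : ∀ {n s la} (E : Subset n) R p U → hd la + length p ≡ sum R → 1 ≤ sum (insR false E R) → PosHd la → hd (tl la) ≤ hd la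
          → Flagged s p → Increasing p → CompatFrom 0 0 ∅ R (topU U) → ColInc (hd la) p (hd (tl la)) (topL U) → UValid (suc s) (tl la) U
          → CompatFrom 0 0 ∅ (insR false E R) (topU (insCol (suc (suc s)) (insE false E R) U))
          → RowOK (suc s) la (insR false E R) (addLabel (insP false E R) (suc s) p) (insCol (suc (suc s)) (insE false E R) U)
rowOK-ins {la = la} E R p U len ne ps dc fl ic cp ci ok cp′ = rowOK
  (lin 6 (λ l p′ p q sR′ sigR → p′ := p :+ q :⇒ l :+ p := sigR :⇒ sR′ := sigR :+ q :⇒ l :+ p′ := sR′)
     (hd la) _ (length p) (bit (insP false E R)) _ (sum R) (length-add (insP false E R) _ p) len (ins-sum false E R))
  ne ps dc (flagged-add {_} {p} (insP false E R) fl) (incr-add {_} {p} (insP false E R) fl ic) cp′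
  (colInc-ins (insP false E R) R p (insE false E R) U len fl (len-top U ok) cp ci)

insE-card : ∀ {n m} (E : Subset n) → ∣ E ∣ ≡ suc m → ∣ insE false E zeros ∣ ≡ m
insE-card E eq = suc-injective (trans (trans (cong (λ b → bit b + ∣ insE false E zeros ∣) (sym (ins-new E eq))) (ins-card false E zeros)) eq)

newRows-valid : ∀ {n} m s (E : Subset n) R₀ → ∣ E ∣ ≡ m → CompatFrom 0 0 E R₀ zeros
              → CompatFrom 0 0 ∅ R₀ (topU (newRows m (suc s) E)) × UValid (suc s) [] (newRows m (suc s) E)
newRows-valid zero s E R₀ eq h = CompatFrom-zeros 0 0 R₀ z≤n , refl
newRows-valid {n} (suc m) s E R₀ eq h =
  CompatFrom-upper false 0 0 E R₀ zeros z≤n h ,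
  subst (λ U → RowOK (suc s) [] _ _ U) rest
   (rowOK-ins E zeros [] [] (sym (sum-replicate0 n)) (≤-reflexive (sym grows)) tt z≤n
    (λ x a ()) (λ x a b ()) (CompatFrom-zeros 0 0 zeros z≤n) (λ x y a b _ ()) refl
    (subst (λ U → CompatFrom 0 0 ∅ (insR false E zeros) (topU U)) (sym rest) (proj₁ ih))) ,
  proj₂ ih
  where
  grows : sum (insR false E zeros) ≡ 1
  grows = trans (ins-sum false E zeros) (cong₂ _+_ (sum-replicate0 n) (cong bit (ins-new E eq)))
  card : ∣ insE false E zeros ∣ ≡ m
  card = insE-card E eq
  rest : insCol (suc (suc s)) (insE false E zeros) [] ≡ newRows m (suc (suc s)) (insE false E zeros)
  rest = cong (λ z → newRows z (suc (suc s)) (insE false E zeros)) card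
  ih = newRows-valid m (suc s) (insE false E zeros) (insR false E zeros) card
         (CompatFrom-lower false 0 0 E zeros zeros (CompatFrom-zeros 0 0 zeros z≤n))

-- R₀ is the row above in its final form. `CompatFrom-upper` fits the new row under it, and
-- `CompatFrom-lower` turns the bumped letters into the same hypothesis one row further down.
insCol-valid : ∀ {n} s la (E : Subset n) R₀ U → UValid s la U → CompatFrom 0 0 E R₀ (topU U)
             → CompatFrom 0 0 ∅ R₀ (topU (insCol (suc s) E U)) × UValid (suc s) la (insCol (suc s) E U)
insCol-valid s la E R₀ [] refl h = newRows-valid ∣ E ∣ s E R₀ refl h
insCol-valid s la E R₀ ((R , p) ∷ U) (rowOK len ne ps dc fl ic cp ci , ok) h =
  CompatFrom-upper false 0 0 E R₀ R z≤n h ,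
  rowOK-ins E R p U len (≤-trans ne (subst (sum R ≤_) (sym (ins-sum false E R)) (m≤m+n _ _))) ps dc fl ic cp ci ok (proj₁ ih) ,
  proj₂ ih
  where
  ih = insCol-valid (suc s) (tl la) (insE false E R) (insR false E R) U ok (CompatFrom-lower false 0 0 E R (topU U) cp)

topU-uncrowd : ∀ {n} (D : List (DRow n)) → topU (uncrowd D) ≡ topD D
topU-uncrowd []      = refl
topU-uncrowd (_ ∷ D) = refl

uncrowd-valid : ∀ {n} la (D : List (DRow n)) → Parts la → DValid la D → UValid 0 la (uncrowd D)
uncrowd-valid la [] ps ok = ok
uncrowd-valid [] ((E , R) ∷ D) ps (len , ne , _) = ⊥-elim (<-irrefl len ne)
uncrowd-valid (l ∷ la) ((E , R) ∷ D) (pl , dl , ps) (len , ne , cp , ok) =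
  rowOK (trans (+-identityʳ l) len) ne pl dl (λ x a ()) (λ x a b ()) (proj₁ ih) (λ x y a b _ ()) , proj₂ ih
  where
  ih = insCol-valid 0 la E R (uncrowd D) (uncrowd-valid la D ps ok) (subst (CompatFrom 0 0 E R) (sym (topU-uncrowd D)) cp)

-- The old labels are at most s, so `suc s` can only be the label just added.
lastIs-add : ∀ {s p} q → Flagged s p → lastIs (suc s) (addLabel q (suc s) p) ≡ q
lastIs-add {s} {[]}        true  f = n≡ᵇn s
  where
  n≡ᵇn : ∀ n → (n ≡ᵇ n) ≡ true
  n≡ᵇn zero    = refl
  n≡ᵇn (suc n) = n≡ᵇn n
lastIs-add {s} {a ∷ []}    true  f = lastIs-add {s} {[]} true (λ x a ())
lastIs-add {s} {a ∷ b ∷ p} true  f = lastIs-add {s} {b ∷ p} true (λ x → f (suc x))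
lastIs-add {s} {[]}        false f = refl
lastIs-add {s} {a ∷ []}    false f = small a (proj₂ (f 0 a refl))
  where
  small : ∀ a {s} → a ≤ s → (a ≡ᵇ suc s) ≡ false
  small zero    l       = refl
  small (suc a) (s≤s l) = small a l
lastIs-add {s} {a ∷ b ∷ p} false f = lastIs-add {s} {b ∷ p} false (λ x → f (suc x))

dropLast-snoc : ∀ p k → dropLast (p ++ k ∷ []) ≡ p
dropLast-snoc []          k = refl
dropLast-snoc (a ∷ [])    k = refl
dropLast-snoc (a ∷ b ∷ p) k = cong (a ∷_) (dropLast-snoc (b ∷ p) k)

dropLabel-add : ∀ q k p → dropLabel q (addLabel q k p) ≡ p
dropLabel-add true  k p = dropLast-snoc p k
dropLabel-add false k p = refl

add-dropLabel : ∀ k p → addLabel (lastIs k p) k (dropLabel (lastIs k p) p) ≡ p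
add-dropLabel k []          = refl
add-dropLabel k (a ∷ [])    with a ≡ᵇ k in eq
... | true  = cong (_∷ []) (sym (≡ᵇ⇒≡ a k (subst T (sym eq) tt)))
... | false = refl
add-dropLabel k (a ∷ b ∷ p) with lastIs k (b ∷ p) | add-dropLabel k (b ∷ p)
... | true  | e = cong (a ∷_) e
... | false | e = refl

-- As the labels increase, only the last one can attain the bound `suc s`.
flagged-drop : ∀ s p → Flagged (suc s) p → Increasing p → Flagged s (dropLabel (lastIs (suc s) p) p)
flagged-drop s []       f i x a ()
flagged-drop s (a ∷ []) f i x b h with a ≡ᵇ suc s in eq
flagged-drop s (a ∷ []) f i x b () | true
flagged-drop s (a ∷ []) f i zero .a refl | false with f 0 a refl
... | l , u = l , ≤-pred (≤∧≢⇒< u (λ e → subst T eq (≡⇒≡ᵇ a (suc s) e)))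
flagged-drop s (a ∷ b ∷ p) f i x c h
  with lastIs (suc s) (b ∷ p) | flagged-drop s (b ∷ p) (λ x → f (suc x)) (λ x → i (suc x))
flagged-drop s (a ∷ b ∷ p) f i zero    .a refl | true  | ih = proj₁ (f 0 a refl) , ≤-pred (≤-trans (i 0 a b refl refl) (proj₂ (f 1 b refl)))
flagged-drop s (a ∷ b ∷ p) f i (suc x) c  h    | true  | ih = ih x c h
flagged-drop s (a ∷ b ∷ p) f i zero    .a refl | false | ih = proj₁ (f 0 a refl) , ≤-pred (≤-trans (i 0 a b refl refl) (proj₂ (f 1 b refl)))
flagged-drop s (a ∷ b ∷ p) f i (suc x) c  h    | false | ih = ih x c h

at-add : ∀ q k p x {a} → at p x ≡ just a → at (addLabel q k p) x ≡ just a
at-add true  k p x h = at-++ p _ x h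
at-add false k p x h = h

delCol-newRows : ∀ {n} m s (E : Subset n) → ∣ E ∣ ≡ m → delCol (suc s) (newRows m (suc s) E) ≡ (E , [])
delCol-newRows zero    s E eq = cong (_, []) (sym (card-0 E eq))
delCol-newRows {n} (suc m) s E eq
  rewrite delCol-newRows m (suc s) (insE false E zeros) (insE-card E eq)
        | lastIs-add {s} {[]} (insP false E zeros) (λ x a ())
        | proj₁ (proj₂ (del∘ins false E zeros)) | proj₂ (proj₂ (del∘ins false E zeros)) | sum-replicate0 n = refl

delCol-insCol : ∀ {n} s la (E : Subset n) U → UValid s la U → delCol (suc s) (insCol (suc s) E U) ≡ (E , U)
delCol-insCol s la E [] ok = delCol-newRows ∣ E ∣ s E refl
delCol-insCol s la E ((R , p) ∷ U) (ok , oks)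
  rewrite delCol-insCol (suc s) (tl la) (insE false E R) U oks
        | lastIs-add {s} {p} (insP false E R) (RowOK.flagged ok)
        | proj₁ (proj₂ (del∘ins false E R)) | proj₂ (proj₂ (del∘ins false E R))
        | dropLabel-add (insP false E R) (suc s) p = cong (E ,_) (keep U (RowOK.nonempty ok))
  where
  keep : ∀ U → 1 ≤ sum R → consNonzero (R , p) U ≡ (R , p) ∷ U
  keep (_ ∷ U) _ = refl
  keep []      l with sum R
  keep []      (s≤s l) | suc _ = refl

crowd-uncrowd : ∀ {n} la (D : List (DRow n)) → Parts la → DValid la D → crowd la (uncrowd D) ≡ D
crowd-uncrowd la [] ps refl = refl
crowd-uncrowd [] ((E , R) ∷ D) ps (len , ne , _) = ⊥-elim (<-irrefl len ne)
crowd-uncrowd (l ∷ la) ((E , R) ∷ D) (_ , _ , ps) (_ , _ , _ , ok)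
  rewrite delCol-insCol 0 la E (uncrowd D) (uncrowd-valid la D ps ok) = cong ((E , R) ∷_) (crowd-uncrowd la D ps ok)

-- Crowding

flagged-top : ∀ {n s la} (U : List (URow n)) → UValid s la U → Flagged s (topL U)
flagged-top []      _        x a ()
flagged-top (_ ∷ U) (ok , _) = RowOK.flagged ok

-- A row whose last label is removed stays as long as the next row: a longer
-- next row would have a label below the removed one, hence larger than it.
shrunk-row : ∀ {n s la} (E : Subset n) R p V
  → RowOK (suc s) la (insR false E R) (addLabel (insP false E R) (suc s) p) (insCol (suc (suc s)) (insE false E R) V)
  → UValid (suc s) (tl la) V → CompatFrom 0 0 (insE false E R) (insR false E R) (topU V)
  → sum (topU V) ≤ sum R
shrunk-row {s = s} {la} E R p V ok okV cp
  with insP false E R | ins-sum false E R | CompatFrom⇒sum _ (insR false E R) (topU V) cp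
     | topL-ins (suc (suc s)) (insE false E R) V | topL V in eqL | len-top V okV | flagged-top V okV
... | false | ts | sm | _ | _ | _ | _ = ≤-trans sm (≤-reflexive (trans ts (+-identityʳ _)))
-- A next row without labels has length `hd (tl la)`, which is at most `hd la` and hence at most the
-- length of R.
... | true | ts | sm | _ | [] | lt | _ =
  lin 7 (λ l p′ p l₂ sV sR′ sigR → l :+ p′ := sR′ :⇒ p′ := p :+ # 1 :⇒ sR′ := sigR :+ # 1 :⇒ l₂ :≤ l :⇒ l₂ :+ # 0 := sV :⇒ sV :≤ sigR)
    (hd la) _ (length p) (hd (tl la)) _ _ (sum R) (RowOK.len ok) (length-add true (suc s) p) ts (RowOK.dec ok) lt
... | true | ts | sm | (b , eqT) | c ∷ q | lt | fl with sum (topU V) ≤? sum R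
...   | yes le = le
...   | no gt with <-at (c ∷ q) (length q) ≤-refl
...     | d , at-d = ⊥-elim (<⇒≱ (RowOK.colInc ok (length p) (length q) (suc s) d eq (at-last p (suc s)) at-d′) (proj₂ (fl (length q) d at-d)))
  where
  eq : hd la + length p ≡ hd (tl la) + length q
  -- By `gt` and `sm` the next row is exactly one box longer than R, so its last label stands below
  -- the removed one.
  eq = lin 8 (λ l p′ p l₂ q sV sR′ sigR → l :+ p′ := sR′ :⇒ p′ := p :+ # 1 :⇒ sR′ := sigR :+ # 1 :⇒ sigR :< sV :⇒ sV :≤ sR′
                :⇒ l₂ :+ (# 1 :+ q) := sV :⇒ l :+ p := l₂ :+ q)
        (hd la) _ (length p) (hd (tl la)) (length q) _ _ (sum R) (RowOK.len ok) (length-add true (suc s) p) ts (≰⇒> gt) sm lt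
  at-d′ : at (topL (insCol (suc (suc s)) (insE false E R) V)) (length q) ≡ just d
  at-d′ rewrite eqT | eqL = at-add b _ (c ∷ q) (length q) at-d

-- The equations present the given row as the result of an insertion into (R , p). Matching on them
-- turns the inverse problem into one about `insE` and `insR`, where the compatibility lemmas apply.
delRow : ∀ {n s la} (E : Subset n) R p V R₀ {q E′ R′ p′ U′}
  → insP false E R ≡ q → insE false E R ≡ E′ → insR false E R ≡ R′ → addLabel q (suc s) p ≡ p′ → insCol (suc (suc s)) E′ V ≡ U′
  → RowOK (suc s) la R′ p′ U′ → Flagged s p → UValid (suc s) (tl la) V → CompatFrom 0 0 E′ R′ (topU V) → CompatFrom 0 0 ∅ R₀ R′
  → let W = consNonzero (R , p) V in
    CompatFrom 0 0 E R₀ (topU W) × UValid s la W × insCol (suc s) E W ≡ (R′ , p′) ∷ U′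
delRow {n} {s} {la} E R p V R₀ refl refl refl refl refl ok fl okV cpE cp₀ = go V refl refl
  where
  q = insP false E R
  cpR : CompatFrom 0 0 ∅ R (topU V)
  cpR = CompatFrom-lower⁻¹ false 0 0 E R (topU V) (shrunk-row {la = la} E R p V ok okV cpE) cpE
  up : CompatFrom 0 0 E R₀ R
  up = CompatFrom-upper⁻¹ false 0 0 E R₀ R cp₀
  len : hd la + length p ≡ sum R
  len = lin 6 (λ l p′ p q sR′ sigR → p′ := p :+ q :⇒ l :+ p′ := sR′ :⇒ sR′ := sigR :+ q :⇒ l :+ p := sigR)
          (hd la) _ (length p) (bit q) _ (sum R) (length-add q (suc s) p) (RowOK.len ok) (ins-sum false E R)
  incr : Increasing p
  incr x a b h k = RowOK.incr ok x a b (at-add q _ p x h) (at-add q _ p (suc x) k)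
  colInc : ColInc (hd la) p (hd (tl la)) (topL V)
  colInc x y a b e h k with topL-ins (suc (suc s)) (insE false E R) V
  ... | b₂ , eqT = RowOK.colInc ok x y a b e (at-add q _ p x h)
        (subst (λ z → at z y ≡ just b) (sym eqT) (at-add b₂ _ (topL V) y k))
  row : 1 ≤ sum R → RowOK s la R p V
  row ne = rowOK len ne (RowOK.pos ok) (RowOK.dec ok) fl incr cpR colInc
  Goal′ : List (URow n) → Set
  Goal′ W = CompatFrom 0 0 E R₀ (topU W) × UValid s la W × insCol (suc s) E W ≡ insRow (suc s) E (R , p) ∷ insCol (suc (suc s)) (insE false E R) V
  go : ∀ V′ → V′ ≡ V → consNonzero (R , p) V′ ≡ consNonzero (R , p) V → Goal′ (consNonzero (R , p) V′)
  go ((R₃ , p₃) ∷ V₃) refl _ = up , (row (≤-trans (RowOK.nonempty (proj₁ okV)) (CompatFrom⇒sum ∅ R R₃ cpR)) , okV) , refl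
  go [] refl _ with sum R in eq
  ... | suc m = up , (row (subst (1 ≤_) (sym eq) (s≤s z≤n)) , okV) , refl
  -- With R empty, the row owes its only box to this insertion: it has no box of `la` and no earlier
  -- label, and `newRows` creates it again.
  ... | zero = subst (CompatFrom 0 0 E R₀) zR up , laEmpty la len (RowOK.pos ok) , new
    where
    zR : R ≡ zeros
    zR = sum-0 R eq
    pEmpty : ∀ p → hd la + length p ≡ sum R → p ≡ []
    pEmpty []      _ = refl
    pEmpty (x ∷ p) e with trans (sym (+-suc (hd la) (length p))) (trans e eq)
    ... | ()
    laEmpty : ∀ la → hd la + length p ≡ sum R → PosHd la → la ≡ []
    laEmpty []           _ _  = refl
    laEmpty (suc l ∷ la) e _ with trans e eq
    ... | ()
    grown : bit q ≡ 1
    grown = lin 3 (λ q sR′ sigR → sR′ := sigR :+ q :⇒ # 1 :≤ sR′ :⇒ sigR := # 0 :⇒ q :≤ # 1 :⇒ q := # 1) (bit q) _ (sum R)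
              (ins-sum false E R) (RowOK.nonempty ok) eq (bit≤1 q)
    new : newRows (∣ E ∣) (suc s) E ≡ insRow (suc s) E (R , p) ∷ newRows (∣ insE false E R ∣) (suc (suc s)) (insE false E R)
    new rewrite sym (ins-card false E R) | grown | pEmpty p len | zR = refl

delCol-valid : ∀ {n} s la (U : List (URow n)) R₀ → UValid (suc s) la U → CompatFrom 0 0 ∅ R₀ (topU U)
  → let E = proj₁ (delCol (suc s) U); V = proj₂ (delCol (suc s) U) in
    CompatFrom 0 0 E R₀ (topU V) × UValid s la V × insCol (suc s) E V ≡ U
delCol-valid {n} s la [] R₀ ok cp = cp , ok , cong (λ z → newRows z (suc s) ∅) (∣⊥∣≡0 n)
delCol-valid s la ((R′ , p′) ∷ U) R₀ (ok , oks) cp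
  with delCol (suc (suc s)) U | delCol-valid (suc s) (tl la) U R′ oks (RowOK.compat ok)
... | E′ , V | cpE , okV , eqU with ins∘del (lastIs (suc s) p′) E′ R′
                                 | del-start (lastIs (suc s) p′) E′ R′ (topU V) cpE (λ _ → RowOK.nonempty ok)
-- `ins∘del` recovers an insertion that starts in the state computed by `delP`; `pend` makes this
-- the state `false` in which every insertion starts.
...   | a , b , c | pend rewrite pend =
  delRow {la = la} _ _ _ V R₀ a b c (add-dropLabel (suc s) p′) eqU ok (flagged-drop s p′ (RowOK.flagged ok) (RowOK.incr ok)) okV cpE cp

flagged-0 : ∀ p → Flagged 0 p → p ≡ []
flagged-0 []      f = refl
flagged-0 (a ∷ p) f with f 0 a refl
... | s≤s _ , ()

crowd-valid : ∀ {n} la (U : List (URow n)) → Parts la → UValid 0 la U → DValid la (crowd la U) × uncrowd (crowd la U) ≡ U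
crowd-valid [] [] ps ok = refl , refl
crowd-valid [] ((R , p) ∷ U) ps (ok , _) with flagged-0 p (RowOK.flagged ok)
... | refl = ⊥-elim (<-irrefl (RowOK.len ok) (RowOK.nonempty ok))
crowd-valid (l ∷ la) ((R , p) ∷ U) (_ , _ , ps) (ok , oks) with flagged-0 p (RowOK.flagged ok)
... | refl with delCol 1 U | delCol-valid 0 la U R oks (RowOK.compat ok)
...   | E , V | cpE , okV , eqU with crowd-valid la V ps okV
...     | okD , eqV =
  (trans (sym (+-identityʳ l)) (RowOK.len ok) , RowOK.nonempty ok
  , subst (CompatFrom 0 0 E R) (trans (cong topU (sym eqV)) (topU-uncrowd (crowd la V))) cpE , okD)
  , cong ((R , []) ∷_) (trans (cong (insCol 1 E) eqV) eqU)

-- Uncrowding preserves the weight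

weightU : ∀ {n} → List (URow n) → ℕ → ℕ
weightU []            k = 0
weightU ((R , _) ∷ U) k = R ‼ k + weightU U k

weightD : ∀ {n} → List (DRow n) → ℕ → ℕ
weightD []            k = 0
weightD ((E , R) ∷ D) k = R ‼ k + bit (mem E k) + weightD D k

mem-∅ : ∀ n k → mem {n} ∅ k ≡ false
mem-∅ zero    k       = refl
mem-∅ (suc n) zero    = refl
mem-∅ (suc n) (suc k) = mem-∅ n k

zeros‼ : ∀ n k → zeros {n} ‼ k ≡ 0
zeros‼ zero    k       = refl
zeros‼ (suc n) zero    = refl
zeros‼ (suc n) (suc k) = zeros‼ n k

weightU-newRows : ∀ {n} m j (E : Subset n) k → ∣ E ∣ ≡ m → weightU (newRows m j E) k ≡ bit (mem E k)
weightU-newRows {n} zero j E k eq rewrite card-0 E eq | mem-∅ n k = refl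
weightU-newRows {n} (suc m) j E k eq =
  trans (cong (insR false E zeros ‼ k +_) (weightU-newRows m (suc j) (insE false E zeros) k (insE-card E eq)))
        (trans (ins-weight false E zeros k) (cong (_+ bit (mem E k)) (zeros‼ n k)))

weightU-insCol : ∀ {n} j (E : Subset n) U k → weightU (insCol j E U) k ≡ weightU U k + bit (mem E k)
weightU-insCol j E [] k = weightU-newRows (∣ E ∣) j E k refl
weightU-insCol j E ((R , p) ∷ U) k =
  lin 7 (λ w′ w r′ e′ r e z → w′ := w :+ e′ :⇒ r′ :+ e′ := r :+ e :⇒ r′ :+ w′ := r :+ w :+ e)
    _ (weightU U k) _ _ (R ‼ k) (bit (mem E k)) 0 (weightU-insCol (suc j) (insE false E R) U k) (ins-weight false E R k)

weightU-uncrowd : ∀ {n} (D : List (DRow n)) k → weightU (uncrowd D) k ≡ weightD D k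
weightU-uncrowd [] k = refl
weightU-uncrowd ((E , R) ∷ D) k =
  lin 5 (λ w′ w e r wd → w′ := w :+ e :⇒ w := wd :⇒ r :+ w′ := r :+ e :+ wd)
    _ (weightU (uncrowd D) k) (bit (mem E k)) (R ‼ k) (weightD D k) (weightU-insCol 1 E (uncrowd D) k) (weightU-uncrowd D k)

-- Uncrowding commutes with the operators on reading words

sigU : ∀ {n} → ℕ → List (URow n) → Sig
sigU k []            = ε
sigU k ((R , _) ∷ U) = sigU k U ∙ sigR k R

sigD : ∀ {n} → ℕ → List (DRow n) → Sig
sigD k []            = ε
sigD k ((E , R) ∷ D) = sigD k D ∙ sigE k E ∙ sigR k R

FU : ∀ {n} → ℕ → List (URow n) → List (URow n) → Set
FU k ((R , p) ∷ U) ((R₁ , p₁) ∷ U₁) = p ≡ p₁ × Ten (FU k U U₁) (U ≡ U₁) (sigU k U) (FR k R R₁) (R ≡ R₁) (sigR k R)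
FU k _             _                = ⊥

-- The tensor product rule for the factors D, E, R, kept as a relation so that exchanging its
-- arguments gives e.
FD : ∀ {n} → ℕ → List (DRow n) → List (DRow n) → Set
FD k ((E , R) ∷ D) ((E₁ , R₁) ∷ D₁) =
  Ten (Ten (FD k D D₁) (D ≡ D₁) (sigD k D) (FE k E E₁) (E ≡ E₁) (sigE k E)) ((D , E) ≡ (D₁ , E₁)) (sigD k D ∙ sigE k E)
      (FR k R R₁) (R ≡ R₁) (sigR k R)
FD k _             _                = ⊥

sigE-∅ : ∀ n k → sigE k (∅ {n}) ≡ ε
sigE-∅ n k rewrite mem-∅ n k | mem-∅ n (suc k) = refl

sigR-zeros : ∀ n k → sigR k (zeros {n}) ≡ ε
sigR-zeros n k = cong₂ _,_ (zeros‼ n k) (zeros‼ n (suc k))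

newRows-sig : ∀ {n} k → suc k < n → ∀ m j (E : Subset n) → ∣ E ∣ ≡ m → sigU k (newRows m j E) ≡ sigE k E
newRows-sig {n} k l zero j E eq rewrite card-0 E eq = sym (sigE-∅ n k)
newRows-sig {n} k l (suc m) j E eq = begin
  sigU k (newRows m (suc j) (insE false E zeros)) ∙ sigR k (insR false E zeros)
    ≡⟨ cong (_∙ _) (newRows-sig k l m (suc j) (insE false E zeros) (insE-card E eq)) ⟩
  sigE k (insE false E zeros) ∙ sigR k (insR false E zeros) ≡⟨ sym (ins-sig k false E zeros l) ⟩
  sigR k (zeros {n}) ∙ sigE k E                         ≡⟨ cong (_∙ sigE k E) (sigR-zeros n k) ⟩
  ε ∙ sigE k E                                        ≡⟨ ∙-identityˡ _ ⟩
  sigE k E                                            ∎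
  where open ≡-Reasoning

-- E is pushed through one row at a time: `ins-sig` replaces R E by the bumped letters followed by
-- the new row, and the bumped letters then stand next to the rows below.
insCol-sig : ∀ {n} k → suc k < n → ∀ j (E : Subset n) U → sigU k (insCol j E U) ≡ sigU k U ∙ sigE k E
insCol-sig k l j E [] = trans (newRows-sig k l ∣ E ∣ j E refl) (sym (∙-identityˡ _))
insCol-sig k l j E ((R , p) ∷ U) = begin
  sigU k (insCol (suc j) (insE false E R) U) ∙ sigR k (insR false E R) ≡⟨ cong (_∙ _) (insCol-sig k l (suc j) (insE false E R) U) ⟩
  sigU k U ∙ sigE k (insE false E R) ∙ sigR k (insR false E R)           ≡⟨ ∙-assoc (sigU k U) (sigE k (insE false E R)) (sigR k (insR false E R)) ⟩
  sigU k U ∙ (sigE k (insE false E R) ∙ sigR k (insR false E R))         ≡⟨ cong (sigU k U ∙_) (sym (ins-sig k false E R l)) ⟩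
  sigU k U ∙ (sigR k R ∙ sigE k E)                                   ≡⟨ sym (∙-assoc (sigU k U) (sigR k R) (sigE k E)) ⟩
  sigU k U ∙ sigR k R ∙ sigE k E                                     ∎
  where open ≡-Reasoning

uncrowd-sig : ∀ {n} k → suc k < n → (D : List (DRow n)) → sigU k (uncrowd D) ≡ sigD k D
uncrowd-sig k l []            = refl
uncrowd-sig k l ((E , R) ∷ D) = cong (_∙ sigR k R) (trans (insCol-sig k l 1 E (uncrowd D)) (cong (_∙ sigE k E) (uncrowd-sig k l D)))

P-E : ∀ {n k} {E E₁ : Subset n} → FE k E E₁ → P (sigE k E) ≡ 1
P-E here      = refl
P-E (there f) = P-E f

FE-card : ∀ {n k} {E E₁ : Subset n} → FE k E E₁ → ∣ E ∣ ≡ ∣ E₁ ∣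
FE-card here = refl
FE-card (there {x = true}  f) = cong suc (FE-card f)
FE-card (there {x = false} f) = FE-card f

newRows-F : ∀ {n} k → suc k < n → ∀ m j (E E₁ : Subset n) → ∣ E ∣ ≡ m → FE k E E₁ → FU k (newRows m j E) (newRows m j E₁)
newRows-F {n} k l zero j E E₁ eq f with card-0 E eq
... | refl with trans (sym (P-E f)) (cong P (sigE-∅ n k))
...   | ()
newRows-F {n} k l (suc m) j E E₁ eq f
  with ins-F k false {zeros} {zeros} (inj₁ (f , refl , subst₂ _<_ (sym (cong M (sigR-zeros n k))) (sym (P-E f)) ≤-refl))
... | r , q = cong (λ z → addLabel z j []) q , go r
  where
  sig = newRows-sig k l m (suc j) (insE false E zeros) (insE-card E eq)
  go : FER k (insR false E zeros) (insR false E₁ zeros) (insE false E zeros) (insE false E₁ zeros)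
     → Ten (FU k (newRows m (suc j) (insE false E zeros)) (newRows m (suc j) (insE false E₁ zeros)))
           (newRows m (suc j) (insE false E zeros) ≡ newRows m (suc j) (insE false E₁ zeros)) (sigU k (newRows m (suc j) (insE false E zeros)))
           (FR k (insR false E zeros) (insR false E₁ zeros)) (insR false E zeros ≡ insR false E₁ zeros) (sigR k (insR false E zeros))
  go (inj₁ (g , e , h)) = inj₁ (g , cong (newRows m (suc j)) e , subst (λ s → M s < P (sigR k (insR false E zeros))) (sym sig) h)
  go (inj₂ (g , e , h)) = inj₂ (newRows-F k l m (suc j) _ _ (insE-card E eq) g , e
                               , subst (λ s → P (sigR k (insR false E zeros)) ≤ M s) (sym sig) h)

-- Rebracket (U R) E as U (R E), replace the inner pair by means of `ins-F`, and rebracket so that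
-- the bumped letters join U, where the recursive call applies. The labels agree because `ins-F`
-- preserves the final state.
insCol-F : ∀ {n} k → suc k < n → ∀ j {E E₁ : Subset n} {U U₁}
         → Ten (FU k U U₁) (U ≡ U₁) (sigU k U) (FE k E E₁) (E ≡ E₁) (sigE k E)
         → FU k (insCol j E U) (insCol j E₁ U₁)
insCol-F k l j {E} {E₁} {[]} {[]} (inj₁ (f , _ , _)) = subst (λ m → FU k (newRows (∣ E ∣) j E) (newRows m j E₁)) (FE-card f)
  (newRows-F k l ∣ E ∣ j E E₁ refl f)
insCol-F k l j {U = _ ∷ _} {[]} (inj₁ (_ , () , _))
insCol-F k l j {U = _ ∷ _} {[]} (inj₂ (() , _ , _))
insCol-F {n} k l j {E} {E₁} {(R , p) ∷ U} {(R₁ , p₁) ∷ U₁} t = labels t , result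
  where
  left : Ten (FU k ((R , p) ∷ U) ((R₁ , p₁) ∷ U₁)) ((R , p) ∷ U ≡ (R₁ , p₁) ∷ U₁) (sigU k U ∙ sigR k R) (FE k E E₁) (E ≡ E₁) (sigE k E)
       → Ten (Ten (FU k U U₁) (U ≡ U₁) (sigU k U) (FR k R R₁) (R ≡ R₁) (sigR k R)) ((U , R) ≡ (U₁ , R₁)) (sigU k U ∙ sigR k R)
             (FE k E E₁) (E ≡ E₁) (sigE k E)
  left (inj₁ (f , refl , h))       = inj₁ (f , refl , h)
  left (inj₂ ((refl , f) , e , h)) = inj₂ (f , e , h)
  right = Ten-assocʳ (sigU k U) (sigR k R) (sigE k E) (left t)
  pend : Ten (FU k U U₁) (U ≡ U₁) (sigU k U) (FRE k R R₁ E E₁) ((R , E) ≡ (R₁ , E₁)) (sigR k R ∙ sigE k E)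
       → insP false E R ≡ insP false E₁ R₁
  pend (inj₁ (f , _ , _))    = proj₂ (ins-F k false f)
  pend (inj₂ (_ , refl , _)) = refl
  labels : _ → addLabel (insP false E R) j p ≡ addLabel (insP false E₁ R₁) j p₁
  labels (inj₁ (_ , refl , _))       = cong (λ q → addLabel q j p) (pend right)
  labels (inj₂ ((refl , _) , _ , _)) = cong (λ q → addLabel q j p) (pend right)
  mid : Ten (FU k U U₁) (U ≡ U₁) (sigU k U) (FRE k R R₁ E E₁) ((R , E) ≡ (R₁ , E₁)) (sigR k R ∙ sigE k E)
      → Ten (FU k U U₁) (U ≡ U₁) (sigU k U) (FER k (insR false E R) (insR false E₁ R₁) (insE false E R) (insE false E₁ R₁))
            ((insE false E R , insR false E R) ≡ (insE false E₁ R₁ , insR false E₁ R₁)) (sigE k (insE false E R) ∙ sigR k (insR false E R))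
  mid (inj₁ (f , e , h))    = inj₁ (proj₁ (ins-F k false f) , e , subst (λ s → M (sigU k U) < P s) (ins-sig k false E R l) h)
  mid (inj₂ (f , refl , h)) = inj₂ (f , refl , subst (λ s → P s ≤ M (sigU k U)) (ins-sig k false E R l) h)
  sig = insCol-sig k l (suc j) (insE false E R) U
  finish : Ten (Ten (FU k U U₁) (U ≡ U₁) (sigU k U) (FE k (insE false E R) (insE false E₁ R₁)) (insE false E R ≡ insE false E₁ R₁) (sigE k (insE false E R)))
               ((U , insE false E R) ≡ (U₁ , insE false E₁ R₁)) (sigU k U ∙ sigE k (insE false E R))
               (FR k (insR false E R) (insR false E₁ R₁)) (insR false E R ≡ insR false E₁ R₁) (sigR k (insR false E R))
         → Ten (FU k (insCol (suc j) (insE false E R) U) (insCol (suc j) (insE false E₁ R₁) U₁))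
               (insCol (suc j) (insE false E R) U ≡ insCol (suc j) (insE false E₁ R₁) U₁) (sigU k (insCol (suc j) (insE false E R) U))
               (FR k (insR false E R) (insR false E₁ R₁)) (insR false E R ≡ insR false E₁ R₁) (sigR k (insR false E R))
  finish (inj₁ (f , e , h)) = inj₁ (f , cong (λ (V , X) → insCol (suc j) X V) e , subst (λ s → M s < P (sigR k (insR false E R))) (sym sig) h)
  finish (inj₂ (f , e , h)) = inj₂ (insCol-F k l (suc j) f , e , subst (λ s → P (sigR k (insR false E R)) ≤ M s) (sym sig) h)
  result = finish (Ten-assocˡ (sigU k U) (sigE k (insE false E R)) (sigR k (insR false E R)) (mid right))

uncrowd-F : ∀ {n} k → suc k < n → ∀ {D D₁ : List (DRow n)} → FD k D D₁ → FU k (uncrowd D) (uncrowd D₁)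
uncrowd-F k l {(E , R) ∷ D} {(E₁ , R₁) ∷ D₁} t = refl , go t
  where
  sig = uncrowd-sig k l D
  sig₁ = uncrowd-sig k l ((E , R) ∷ D)
  inner : Ten (FD k D D₁) (D ≡ D₁) (sigD k D) (FE k E E₁) (E ≡ E₁) (sigE k E)
        → Ten (FU k (uncrowd D) (uncrowd D₁)) (uncrowd D ≡ uncrowd D₁) (sigU k (uncrowd D)) (FE k E E₁) (E ≡ E₁) (sigE k E)
  inner (inj₁ (f , e , h)) = inj₁ (f , cong uncrowd e , subst (λ s → M s < P (sigE k E)) (sym sig) h)
  inner (inj₂ (f , e , h)) = inj₂ (uncrowd-F k l f , e , subst (λ s → P (sigE k E) ≤ M s) (sym sig) h)
  tail = trans (insCol-sig k l 1 E (uncrowd D)) (cong (_∙ sigE k E) sig)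
  go : FD k ((E , R) ∷ D) ((E₁ , R₁) ∷ D₁)
     → Ten (FU k (insCol 1 E (uncrowd D)) (insCol 1 E₁ (uncrowd D₁))) (insCol 1 E (uncrowd D) ≡ insCol 1 E₁ (uncrowd D₁))
           (sigU k (insCol 1 E (uncrowd D))) (FR k R R₁) (R ≡ R₁) (sigR k R)
  go (inj₁ (f , e , h)) = inj₁ (f , cong (λ (V , X) → insCol 1 X (uncrowd V)) e , subst (λ s → M s < P (sigR k R)) (sym tail) h)
  go (inj₂ (f , e , h)) = inj₂ (insCol-F k l 1 (inner f) , e , subst (λ s → P (sigR k R) ≤ M s) (sym tail) h)

-- A semistandard tableau is a set-valued one in which every E is empty, so a single analysis of the
-- operators serves both sides of the isomorphism.
toD : ∀ {n} → List (URow n) → List (DRow n)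
toD = map (λ (R , _) → ∅ , R)

toD-sig : ∀ {n} k (U : List (URow n)) → sigD k (toD U) ≡ sigU k U
toD-sig k [] = refl
toD-sig {n} k ((R , p) ∷ U) = cong (_∙ sigR k R) (trans (cong (sigD k (toD U) ∙_) (sigE-∅ n k)) (trans (∙-identityʳ _) (toD-sig k U)))

toD-F : ∀ {n} k {U U₁ : List (URow n)} → FU k U U₁ → FD k (toD U) (toD U₁)
toD-F {n} k {(R , p) ∷ U} {(R₁ , p₁) ∷ U₁} (refl , inj₁ (f , e , h)) =
  inj₁ (f , cong (λ V → toD V , ∅) e , subst (λ s → M s < P (sigR k R)) (sym tail) h)
  where tail = trans (cong (sigD k (toD U) ∙_) (sigE-∅ n k)) (trans (∙-identityʳ _) (toD-sig k U))
toD-F {n} k {(R , p) ∷ U} {(R₁ , p₁) ∷ U₁} (refl , inj₂ (f , e , h)) =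
  inj₂ (inj₂ (toD-F k f , refl , subst (λ s → P s ≤ M (sigD k (toD U))) (sym (sigE-∅ n k)) z≤n) , e , subst (λ s → P (sigR k R) ≤ M s) (sym tail) h)
  where tail = trans (cong (sigD k (toD U) ∙_) (sigE-∅ n k)) (trans (∙-identityʳ _) (toD-sig k U))

-- The operators on rows and columns

FR-det : ∀ {n k} {R R₁ R₂ : Vec ℕ n} → FR k R R₁ → FR k R R₂ → R₁ ≡ R₂
FR-det here      here      = refl
FR-det (there f) (there g) = cong (_ ∷_) (FR-det f g)

FR-codet : ∀ {n k} {R R₁ R₂ : Vec ℕ n} → FR k R₁ R → FR k R₂ R → R₁ ≡ R₂
FR-codet here      here      = refl
FR-codet (there f) (there g) = cong (_ ∷_) (FR-codet f g)

FE-det : ∀ {n k} {E E₁ E₂ : Subset n} → FE k E E₁ → FE k E E₂ → E₁ ≡ E₂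
FE-det here      here      = refl
FE-det (there f) (there g) = cong (_ ∷_) (FE-det f g)

FE-codet : ∀ {n k} {E E₁ E₂ : Subset n} → FE k E₁ E → FE k E₂ E → E₁ ≡ E₂
FE-codet here      here      = refl
FE-codet (there f) (there g) = cong (_ ∷_) (FE-codet f g)

FR-moves : ∀ {n k} {R R₁ : Vec ℕ n} → FR k R R₁ → Moves (sigR k R) (sigR k R₁)
FR-moves here      = refl , refl
FR-moves (there f) = FR-moves f

FE-moves : ∀ {n k} {E E₁ : Subset n} → FE k E E₁ → Moves (sigE k E) (sigE k E₁)
FE-moves here      = refl , refl
FE-moves (there f) = FE-moves f

FD-moves : ∀ {n} k (D D₁ : List (DRow n)) → FD k D D₁ → Moves (sigD k D) (sigD k D₁)
FD-moves k ((E , R) ∷ D) ((E₁ , R₁) ∷ D₁) =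
  Ten-moves {a = sigD k D ∙ sigE k E} {a′ = sigD k D₁ ∙ sigE k E₁} {b = sigR k R}
    (Ten-moves {a = sigD k D} {b = sigE k E} (FD-moves k D D₁) (cong (sigD k)) FE-moves (cong (sigE k)))
    (cong (λ (D , E) → sigD k D ∙ sigE k E)) FR-moves (cong (sigR k))

Ten-det : ∀ {X Y : Set} {x x₁ x₂ : X} {y y₁ y₂ : Y} {A₁ A₂ B₁ B₂ : Set} a b
  → (A₁ → A₂ → x₁ ≡ x₂) → (B₁ → B₂ → y₁ ≡ y₂)
  → Ten A₁ (x ≡ x₁) a B₁ (y ≡ y₁) b → Ten A₂ (x ≡ x₂) a B₂ (y ≡ y₂) b → (x₁ , y₁) ≡ (x₂ , y₂)
Ten-det a b fa fb (inj₁ (f , refl , _)) (inj₁ (g , refl , _)) = cong (_ ,_) (fb f g)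
Ten-det a b fa fb (inj₂ (f , refl , _)) (inj₂ (g , refl , _)) = cong (_, _) (fa f g)
Ten-det a b fa fb (inj₁ (_ , _ , h))    (inj₂ (_ , _ , l))    = ⊥-elim (<⇒≱ h l)
Ten-det a b fa fb (inj₂ (_ , _ , l))    (inj₁ (_ , _ , h))    = ⊥-elim (<⇒≱ h l)

-- Preimages that act in different factors exclude each other: by `Moves`, the right factor can have
-- acted only if M x ≤ P y, and the left factor only if P y < M x, for the signatures of the common
-- target.
Ten-codet : ∀ {X Y : Set} {x x₁ x₂ : X} {y y₁ y₂ : Y} {A₁ A₂ B₁ B₂ : Set} (sX : X → Sig) (sY : Y → Sig)
  → (A₁ → Moves (sX x₁) (sX x)) → (A₂ → Moves (sX x₂) (sX x)) → (B₁ → Moves (sY y₁) (sY y)) → (B₂ → Moves (sY y₂) (sY y))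
  → (A₁ → A₂ → x₁ ≡ x₂) → (B₁ → B₂ → y₁ ≡ y₂)
  → Ten A₁ (x₁ ≡ x) (sX x₁) B₁ (y₁ ≡ y) (sY y₁) → Ten A₂ (x₂ ≡ x) (sX x₂) B₂ (y₂ ≡ y) (sY y₂) → (x₁ , y₁) ≡ (x₂ , y₂)
Ten-codet sX sY a₁ a₂ b₁ b₂ fa fb (inj₁ (f , refl , _)) (inj₁ (g , refl , _)) = cong (_ ,_) (fb f g)
Ten-codet sX sY a₁ a₂ b₁ b₂ fa fb (inj₂ (f , refl , _)) (inj₂ (g , refl , _)) = cong (_, _) (fa f g)
Ten-codet sX sY a₁ a₂ b₁ b₂ fa fb (inj₁ (f , refl , h)) (inj₂ (g , refl , l)) with b₁ f | a₂ g
... | p , _ | _ , m = ⊥-elim (lin 4 (λ pb₁ pb ma ma₂ → pb₁ := # 1 :+ pb :⇒ ma := # 1 :+ ma₂ :⇒ ma :< pb₁ :⇒ pb :≤ ma₂ :⇒ :⊥) _ _ _ _ p m h l)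
Ten-codet sX sY a₁ a₂ b₁ b₂ fa fb (inj₂ (f , refl , l)) (inj₁ (g , refl , h)) with b₂ g | a₁ f
... | p , _ | _ , m = ⊥-elim (lin 4 (λ pb₁ pb ma ma₂ → pb₁ := # 1 :+ pb :⇒ ma := # 1 :+ ma₂ :⇒ ma :< pb₁ :⇒ pb :≤ ma₂ :⇒ :⊥) _ _ _ _ p m h l)

FD-det : ∀ {n} k (D D₁ D₂ : List (DRow n)) → FD k D D₁ → FD k D D₂ → D₁ ≡ D₂
FD-det k ((E , R) ∷ D) ((E₁ , R₁) ∷ D₁) ((E₂ , R₂) ∷ D₂) f g =
  cong (λ ((D , E) , R) → (E , R) ∷ D)
    (Ten-det (sigD k D ∙ sigE k E) (sigR k R) (Ten-det (sigD k D) (sigE k E) (FD-det k D D₁ D₂) FE-det) FR-det f g)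

FD-codet : ∀ {n} k (D D₁ D₂ : List (DRow n)) → FD k D₁ D → FD k D₂ D → D₁ ≡ D₂
FD-codet {n} k ((E , R) ∷ D) ((E₁ , R₁) ∷ D₁) ((E₂ , R₂) ∷ D₂) f g =
  cong (λ ((D , E) , R) → (E , R) ∷ D)
    (Ten-codet sigDE (sigR k) (moves D₁ E₁) (moves D₂ E₂) FR-moves FR-moves
      (Ten-codet (sigD k) (sigE k) (FD-moves k D₁ D) (FD-moves k D₂ D) FE-moves FE-moves (FD-codet k D D₁ D₂) FE-codet)
      FR-codet f g)
  where
  sigDE : List (DRow n) × Subset n → Sig
  sigDE (D , E) = sigD k D ∙ sigE k E
  moves : ∀ D₀ E₀ → Ten (FD k D₀ D) (D₀ ≡ D) (sigD k D₀) (FE k E₀ E) (E₀ ≡ E) (sigE k E₀) → Moves (sigDE (D₀ , E₀)) (sigDE (D , E))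
  moves D₀ E₀ = Ten-moves {a = sigD k D₀} {b = sigE k E₀} (FD-moves k D₀ D) (cong (sigD k)) FE-moves (cong (sigE k))

-- The operators preserve the validity of rows

cum-suc : ∀ {n} (R : Vec ℕ n) j → cum R (suc j) ≡ cum R j + R ‼ j
cum-suc []      zero    = refl
cum-suc []      (suc j) = refl
cum-suc (x ∷ R) zero    = +-identityʳ x
cum-suc (x ∷ R) (suc j) = trans (cong (x +_) (cum-suc R j)) (sym (+-assoc x _ _))

cum-mono₁ : ∀ {n} (R : Vec ℕ n) j → cum R j ≤ cum R (suc j)
cum-mono₁ R j = subst (cum R j ≤_) (sym (cum-suc R j)) (m≤m+n _ _)

FR-cum : ∀ {n k} {R R₁ : Vec ℕ n} → FR k R R₁ → cum R (suc k) ≡ suc (cum R₁ (suc k))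
FR-cum here              = refl
FR-cum (there {x = x} f) = trans (cong (x +_) (FR-cum f)) (+-suc x _)

FR-cum≢ : ∀ {n k} {R R₁ : Vec ℕ n} → FR k R R₁ → ∀ j → j ≢ suc k → cum R j ≡ cum R₁ j
FR-cum≢ f                 zero    _  = refl
FR-cum≢ here              (suc zero)    ne = ⊥-elim (ne refl)
FR-cum≢ (here {x = x} {y} {R}) (suc (suc j)) _ = sym (+-suc x _)
FR-cum≢ (there {x = x} f) (suc j) ne = cong (x +_) (FR-cum≢ f j (λ e → ne (cong suc e)))

FR-sum : ∀ {n k} {R R₁ : Vec ℕ n} → FR k R R₁ → sum R ≡ sum R₁
FR-sum (here {x = x})    = sym (+-suc x _)
FR-sum (there {x = x} f) = cong (x +_) (FR-sum f)

FE-mem : ∀ {n k} {E E₁ : Subset n} → FE k E E₁ →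
  mem E k ≡ true × mem E (suc k) ≡ false × mem E₁ k ≡ false × mem E₁ (suc k) ≡ true
FE-mem here      = refl , refl , refl , refl
FE-mem (there f) = FE-mem f

FE-mem≢ : ∀ {n k} {E E₁ : Subset n} → FE k E E₁ → ∀ j → j ≢ k → j ≢ suc k → mem E j ≡ mem E₁ j
FE-mem≢ here      zero          a b = ⊥-elim (a refl)
FE-mem≢ here      (suc zero)    a b = ⊥-elim (b refl)
FE-mem≢ here      (suc (suc j)) a b = refl
FE-mem≢ (there f) zero          a b = refl
FE-mem≢ (there f) (suc j)       a b = FE-mem≢ f j (λ e → a (cong suc e)) (λ e → b (cong suc e))

M-E : ∀ e f m → m + bit f ≤ (bit f ∸ bit e) + (m ∸ (bit e ∸ bit f)) + bit e
M-E true  true  m = ≤-refl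
M-E true  false zero = z≤n
M-E true  false (suc m) = ≤-reflexive (lin 1 (λ m → # 1 :+ m :+ # 0 := m :+ # 1) m)
M-E false true  m = ≤-reflexive (lin 1 (λ m → m :+ # 1 := # 1 :+ m :+ # 0) m)
M-E false false m = ≤-refl

P-E≤ : ∀ e f m r → bit e ∸ bit f ≤ m → r ≤ (bit f ∸ bit e) + (m ∸ (bit e ∸ bit f)) → r + bit e ≤ m + bit f
P-E≤ true  true  m r _ h = +-monoˡ-≤ 1 h
P-E≤ true  false (suc m) r _ h = lin 2 (λ r m → r :≤ m :⇒ r :+ # 1 :≤ # 1 :+ m :+ # 0) r m h
P-E≤ false true  m r _ h = lin 2 (λ r m → r :≤ # 1 :+ m :⇒ r :+ # 0 :≤ m :+ # 1) r m h
P-E≤ false false m r _ h = +-monoˡ-≤ 0 h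

topD-M : ∀ {n} k (D : List (DRow n)) → topD D ‼ suc k ≤ M (sigD k D)
topD-M {n} k [] = ≤-reflexive (zeros‼ n (suc k))
topD-M k ((E , R) ∷ D) = m≤m+n _ _

-- Only the partial sum at k + 1 drops, by one. Since f acts in R, the letters k of R outnumber the
-- - left over by D and E; by `topD-M` and `M-E` this makes room for the letters k + 1 of the next
-- row and of E with one unit to spare.
rowF-compat : ∀ {n} k {R R₁ : Vec ℕ n} (E : Subset n) D → FR k R R₁ → M (sigD k D ∙ sigE k E) < P (sigR k R)
            → Compat E R (topD D) → Compat E R₁ (topD D)
rowF-compat k {R} {R₁} E D f h c j with j ≟ suc k
... | no  ne   = subst (cum (topD D) (suc j) + bit (mem E j) ≤_) (FR-cum≢ f j ne) (c j)
... | yes refl =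
  lin 11 (λ c₂ y c₂′ e f′ ck ck′ ck₁ r md mde → c₂ :+ e :≤ ck :⇒ c₂′ := c₂ :+ y :⇒ ck′ := ck :+ r :⇒ ck′ := # 1 :+ ck₁ :⇒ y :≤ md
            :⇒ md :+ f′ :≤ mde :+ e :⇒ mde :< r :⇒ c₂′ :+ f′ :≤ ck₁)
    (cum (topD D) (suc k)) (topD D ‼ suc k) _ (bit (mem E k)) (bit (mem E (suc k))) (cum R k) _ _ (R ‼ k) (M (sigD k D)) _
    (c k) (cum-suc (topD D) (suc k)) (cum-suc R k) (FR-cum f) (topD-M k D) (M-E (mem E k) (mem E (suc k)) (M (sigD k D))) h

FR-cum≥ : ∀ {n k} {R R₁ : Vec ℕ n} → FR k R R₁ → ∀ j → cum R₁ j ≤ cum R j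
FR-cum≥ {k = k} f j with j ≟ suc k
... | no  ne   = ≤-reflexive (sym (FR-cum≢ f j ne))
... | yes refl = subst (_ ≤_) (sym (FR-cum f)) (n≤1+n _)

-- E offers a single +, so f acts there only if the rows below leave no -. Then the next row has no
-- k + 1, and the bound at k carries over to k + 1.
colF-compat : ∀ {n} k (R : Vec ℕ n) {E E₁ : Subset n} D → FE k E E₁ → M (sigD k D) < P (sigE k E)
            → Compat E R (topD D) → Compat E₁ R (topD D)
colF-compat k R {E} {E₁} D f h c j with j ≟ k | j ≟ suc k
... | yes refl | _ rewrite proj₁ (proj₂ (proj₂ (FE-mem f))) = ≤-trans (+-monoʳ-≤ _ z≤n) (c j)
... | no a | yes refl =
  lin 9 (λ c₂ c₂′ y m p ck ck′ b b′ → c₂ :+ b :≤ ck :⇒ c₂′ := c₂ :+ y :⇒ y :≤ m :⇒ m :< p :⇒ p := # 1 :⇒ ck :≤ ck′ :⇒ b := # 1 :⇒ b′ := # 1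
           :⇒ c₂′ :+ b′ :≤ ck′)
    _ _ _ _ _ _ _ (bit (mem E k)) (bit (mem E₁ (suc k))) (c k) (cum-suc (topD D) (suc k)) (topD-M k D) h (P-E f) (cum-mono₁ R k)
    (cong bit (proj₁ (FE-mem f))) (cong bit (proj₂ (proj₂ (proj₂ (FE-mem f)))))
... | no a | no b =
  subst (λ z → cum (topD D) (suc j) + bit z ≤ cum R j) (FE-mem≢ f j a b) (c j)

-- As f passes over R although no - remains before it, R has no k. Its partial sums at k and k + 1
-- agree, and the bound moves back from k + 1 to k.
colF-compat⁻¹ : ∀ {n} k (R : Vec ℕ n) {E E₁ : Subset n} D → FE k E E₁ → M (sigD k D) < P (sigE k E)
              → P (sigR k R) ≤ M (sigD k D ∙ sigE k E) → Compat E₁ R (topD D) → Compat E R (topD D)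
colF-compat⁻¹ k R {E} {E₁} D f h l c j with j ≟ k | j ≟ suc k
... | no a | yes refl rewrite proj₁ (proj₂ (FE-mem f)) = ≤-trans (+-monoʳ-≤ _ z≤n) (c j)
... | no a | no b = subst (λ z → cum (topD D) (suc j) + bit z ≤ cum R j) (sym (FE-mem≢ f j a b)) (c j)
... | yes refl | _ =
  lin 9 (λ c₂ c₂′ ck ck′ r m p b b′ → c₂′ :+ b′ :≤ ck′ :⇒ c₂ :≤ c₂′ :⇒ ck′ := ck :+ r :⇒ r :≤ m :⇒ m :≤ # 0 :⇒ b := # 1 :⇒ b′ := # 1
           :⇒ c₂ :+ b :≤ ck)
    (cum (topD D) (suc k)) _ (cum R k) _ (R ‼ k) (M (sigD k D ∙ sigE k E)) 0 (bit (mem E k)) (bit (mem E₁ (suc k)))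
    (c (suc k)) (cum-mono₁ (topD D) (suc k)) (cum-suc R k) l idle (cong bit (proj₁ (FE-mem f))) (cong bit (proj₂ (proj₂ (proj₂ (FE-mem f)))))
  where
  idle : M (sigD k D ∙ sigE k E) ≤ 0
  idle = quiet (mem E k) (mem E (suc k)) (proj₁ (FE-mem f)) (proj₁ (proj₂ (FE-mem f))) (subst (M (sigD k D) <_) (P-E f) h)
    where
    quiet : ∀ e f {m} → e ≡ true → f ≡ false → m < 1 → (bit f ∸ bit e) + (m ∸ (bit e ∸ bit f)) ≤ 0
    quiet true false refl refl l = ≤-trans (m∸n≤m _ 1) (≤-pred l)

-- That f passes over E and R means that together they have at most as many letters k as E and the
-- next row have letters k + 1. Taking both counts off the bound at k + 1 gives the bound at k.
belowF-compat⁻¹ : ∀ {n} k (R R₂ R₃ : Vec ℕ n) (E : Subset n) m → FR k R₂ R₃ → m ≡ R₂ ‼ suc k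
                → P (sigE k E) ≤ m → P (sigR k R) ≤ M (sigE k E) + (m ∸ P (sigE k E)) → Compat E R R₃ → Compat E R R₂
belowF-compat⁻¹ k R R₂ R₃ E m f refl lE lR c j with j ≟ k
... | no  ne   = subst (λ z → z + bit (mem E j) ≤ cum R j) (sym (FR-cum≢ f (suc j) (λ e → ne (suc-injective e)))) (c j)
... | yes refl =
  lin 8 (λ c₂ y c₂′ e f′ ck ck′ r → c₂′ :+ f′ :≤ ck′ :⇒ c₂′ := c₂ :+ y :⇒ ck′ := ck :+ r :⇒ r :+ e :≤ y :+ f′ :⇒ c₂ :+ e :≤ ck)
    (cum R₂ (suc k)) (R₂ ‼ suc k) (cum R₃ (suc (suc k))) (bit (mem E k)) (bit (mem E (suc k))) (cum R k) _ (R ‼ k)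
    (c (suc k)) (trans (sym (FR-cum≢ f (suc (suc k)) (λ ()))) (cum-suc R₂ (suc k)))
    (cum-suc R k) (P-E≤ (mem E k) (mem E (suc k)) (R₂ ‼ suc k) (R ‼ k) lE lR)

-- If f acts in the R of the first row, the + of that R cancel every - before it, so the - that
-- remain are its own letters k + 1.
topD-F : ∀ {n} k (D D₁ : List (DRow n)) → FD k D D₁
       → topD D ≡ topD D₁ ⊎ (FR k (topD D) (topD D₁) × M (sigD k D) ≡ topD D ‼ suc k)
topD-F k ((E , R) ∷ D) ((E₁ , R₁) ∷ D₁) (inj₁ (f , refl , h)) =
  inj₂ (f , trans (cong (R ‼ suc k +_) (m≤n⇒m∸n≡0 (<⇒≤ h))) (+-identityʳ _))
topD-F k ((E , R) ∷ D) ((E₁ , R₁) ∷ D₁) (inj₂ (f , e , h)) = inj₁ e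

mapCompat : ∀ {n} {E E₁ : Subset n} {R R₁ R₂ R₃ : Vec ℕ n} → (Compat E R R₂ → Compat E₁ R₁ R₃) → CompatFrom 0 0 E R R₂ → CompatFrom 0 0 E₁ R₁ R₃
mapCompat {E = E} {E₁} {R} {R₁} {R₂} {R₃} f h = Compat⇒Cpt E₁ R₁ R₃ (f (CompatFrom⇒Compat E R R₂ h))

FD-valid : ∀ {n} k la (D D₁ : List (DRow n)) → FD k D D₁ → DValid la D → DValid la D₁
FD-valid k la ((E , R) ∷ D) ((E₁ , R₁) ∷ D₁) (inj₁ (f , refl , h)) (len , ne , cp , ok) =
  trans len (FR-sum f) , subst (1 ≤_) (FR-sum f) ne , mapCompat (rowF-compat k E D f h) cp , ok
FD-valid k la ((E , R) ∷ D) ((E₁ , R₁) ∷ D₁) (inj₂ (inj₁ (f , refl , h) , refl , _)) (len , ne , cp , ok) =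
  len , ne , mapCompat (colF-compat k R D f h) cp , ok
FD-valid k la ((E , R) ∷ D) ((E₁ , R₁) ∷ D₁) (inj₂ (inj₂ (f , refl , _) , refl , _)) (len , ne , cp , ok) =
  len , ne , mapCompat {E = E} {E} {R} {R} below cp , FD-valid k (tl la) D D₁ f ok
  where
  below : Compat E R (topD D) → Compat E R (topD D₁)
  below c with topD-F k D D₁ f
  ... | inj₁ e       = subst (Compat E R) e c
  ... | inj₂ (g , _) = λ j → ≤-trans (+-monoˡ-≤ _ (FR-cum≥ g (suc j))) (c j)

FD-valid⁻¹ : ∀ {n} k la (D D₁ : List (DRow n)) → FD k D D₁ → DValid la D₁ → DValid la D
FD-valid⁻¹ k la ((E , R) ∷ D) ((E₁ , R₁) ∷ D₁) (inj₁ (f , refl , h)) (len , ne , cp , ok) =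
  trans len (sym (FR-sum f)) , subst (1 ≤_) (sym (FR-sum f)) ne
  , mapCompat {E = E} {E} {R₁} {R} {topD D} (λ c j → ≤-trans (c j) (FR-cum≥ f j)) cp , ok
FD-valid⁻¹ k la ((E , R) ∷ D) ((E₁ , R₁) ∷ D₁) (inj₂ (inj₁ (f , refl , h) , refl , l)) (len , ne , cp , ok) =
  len , ne , mapCompat (colF-compat⁻¹ k R D f h l) cp , ok
FD-valid⁻¹ k la ((E , R) ∷ D) ((E₁ , R₁) ∷ D₁) (inj₂ (inj₂ (f , refl , lE) , refl , lR)) (len , ne , cp , ok) =
  len , ne , mapCompat {E = E} {E} {R} {R} below cp , FD-valid⁻¹ k (tl la) D D₁ f ok
  where
  below : Compat E R (topD D₁) → Compat E R (topD D)
  below c with topD-F k D D₁ f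
  ... | inj₁ e       = subst (Compat E R) (sym e) c
  ... | inj₂ (g , e) = belowF-compat⁻¹ k R (topD D) (topD D₁) E (M (sigD k D)) g e lE lR c

-- Set-valued rows as pairs of vectors

T⇒≡ : ∀ {b} → T b → b ≡ true
T⇒≡ {true} _ = refl

≡⇒T : ∀ {b} → b ≡ true → T b
≡⇒T refl = tt

bool-ext : ∀ {a b} → (a ≡ true → b ≡ true) → (b ≡ true → a ≡ true) → a ≡ b
bool-ext {true}  {true}  f g = refl
bool-ext {true}  {false} f g = sym (f refl)
bool-ext {false} {true}  f g = g refl
bool-ext {false} {false} f g = refl

¬true⇒false : ∀ {b} → b ≢ true → b ≡ false
¬true⇒false {true}  h = ⊥-elim (h refl)
¬true⇒false {false} h = refl

∧-true : ∀ {a b} → a ∧ b ≡ true → a ≡ true × b ≡ true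
∧-true {true} {true} _ = refl , refl

true-∧ : ∀ {a b} → a ≡ true → b ≡ true → a ∧ b ≡ true
true-∧ refl refl = refl

∨-true : ∀ {a b} → a ∨ b ≡ true → a ≡ true ⊎ b ≡ true
∨-true {true}  _ = inj₁ refl
∨-true {false} h = inj₂ h

true-∨ʳ : ∀ a {b} → b ≡ true → a ∨ b ≡ true
true-∨ʳ true  _ = refl
true-∨ʳ false h = h

has-mem : ∀ {n} (S : Subset n) k → has S (suc k) ≡ mem S k
has-mem []      k       = refl
has-mem (b ∷ S) zero    = refl
has-mem (b ∷ S) (suc k) = has-mem S k

mem-ext : ∀ {n} (S S′ : Subset n) → (∀ k → mem S k ≡ mem S′ k) → S ≡ S′
mem-ext []      []       h = refl
mem-ext (b ∷ S) (b′ ∷ S′) h = cong₂ _∷_ (h 0) (mem-ext S S′ (λ k → h (suc k)))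

‼-ext : ∀ {n} (R R′ : Vec ℕ n) → (∀ k → R ‼ k ≡ R′ ‼ k) → R ≡ R′
‼-ext []      []        h = refl
‼-ext (b ∷ S) (b′ ∷ S′) h = cong₂ _∷_ (h 0) (‼-ext S S′ (λ k → h (suc k)))

cum-ext : ∀ {n} (R R′ : Vec ℕ n) → (∀ k → cum R k ≡ cum R′ k) → R ≡ R′
cum-ext R R′ h = ‼-ext R R′ (λ k → +-cancelˡ-≡ (cum R k) _ _
  (trans (sym (cum-suc R k)) (trans (h (suc k)) (trans (cum-suc R′ k) (cong (_+ R′ ‼ k) (sym (h k)))))))

cum-mono : ∀ {n} (R : Vec ℕ n) {j k} → j ≤ k → cum R j ≤ cum R k
cum-mono R {k = zero}  z≤n = z≤n
cum-mono R {j} {suc k} l with m≤n⇒m<n∨m≡n l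
... | inj₁ (s≤s l′) = ≤-trans (cum-mono R l′) (cum-mono₁ R k)
... | inj₂ refl     = ≤-refl

cum-all : ∀ {n} (R : Vec ℕ n) → cum R n ≡ sum R
cum-all []      = refl
cum-all (x ∷ R) = cong (x +_) (cum-all R)

cum≤sum : ∀ {n} (R : Vec ℕ n) k → cum R k ≤ sum R
cum≤sum R       zero    = z≤n
cum≤sum []      (suc k) = z≤n
cum≤sum (x ∷ R) (suc k) = +-monoʳ-≤ x (cum≤sum R k)

at-ext : ∀ {A : Set} (xs ys : List A) → (∀ c → at xs c ≡ at ys c) → xs ≡ ys
at-ext []       []       h = refl
at-ext []       (y ∷ ys) h with h 0
... | ()
at-ext (x ∷ xs) []       h with h 0
... | ()
at-ext (x ∷ xs) (y ∷ ys) h = cong₂ _∷_ (just-injective (h 0)) (at-ext xs ys (λ c → h (suc c)))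

at-map : ∀ {A B : Set} (f : A → B) xs c → at (map f xs) c ≡ Maybe.map f (at xs c)
at-map f []       c       = refl
at-map f (x ∷ xs) zero    = refl
at-map f (x ∷ xs) (suc c) = at-map f xs c

at-applyUpTo : ∀ {A : Set} (f : ℕ → A) m c → c < m → at (applyUpTo f m) c ≡ just (f c)
at-applyUpTo f (suc m) zero    l       = refl
at-applyUpTo f (suc m) (suc c) (s≤s l) = at-applyUpTo (λ x → f (suc x)) m c l

at-≥ : ∀ {A : Set} (xs : List A) c → length xs ≤ c → at xs c ≡ nothing
at-≥ []       c       l       = refl
at-≥ (x ∷ xs) (suc c) (s≤s l) = at-≥ xs c l

-- The letter k occupies the columns [ cum R k − e , cum R (k + 1) ) of its
-- row, where e = 1 if k also occurs as a non-minimal entry.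
In : ∀ {n} → Subset n → Vec ℕ n → ℕ → ℕ → Set
In E R k c = cum R k ≤ c + bit (mem E k) × c < cum R (suc k)

box : ∀ {n} → ℕ → ℕ → Subset n → Vec ℕ n → Subset n
box b c []      []      = []
box b c (e ∷ E) (r ∷ R) = (b ≤ᵇ c + bit e) ∧ (c <ᵇ b + r) ∷ box (b + r) c E R

box⇒ : ∀ {n} b c (E : Subset n) R k → mem (box b c E R) k ≡ true → b + cum R k ≤ c + bit (mem E k) × c < b + cum R (suc k)
box⇒ b c []      []      k    ()
box⇒ b c (e ∷ E) (r ∷ R) zero h with ∧-true {b ≤ᵇ c + bit e} h
... | x , y = subst (_≤ c + bit e) (sym (+-identityʳ b)) (≤ᵇ⇒≤ _ _ (≡⇒T x))
            , subst (λ z → c < b + z) (sym (+-identityʳ r)) (<ᵇ⇒< _ _ (≡⇒T y))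
box⇒ b c (e ∷ E) (r ∷ R) (suc k) h with box⇒ (b + r) c E R k h
... | x , y = subst (_≤ c + bit (mem E k)) (+-assoc b r _) x , subst (c <_) (+-assoc b r _) y

⇒box : ∀ {n} b c (E : Subset n) R k → b + cum R k ≤ c + bit (mem E k) → c < b + cum R (suc k) → mem (box b c E R) k ≡ true
⇒box b c [] [] zero    x y = ⊥-elim (lin 2 (λ b c → b :+ # 0 :≤ c :+ # 0 :⇒ c :< b :+ # 0 :⇒ :⊥) b c x y)
⇒box b c [] [] (suc k) x y = ⊥-elim (lin 2 (λ b c → b :+ # 0 :≤ c :+ # 0 :⇒ c :< b :+ # 0 :⇒ :⊥) b c x y)
⇒box b c (e ∷ E) (r ∷ R) zero x y =
  true-∧ (T⇒≡ (≤⇒≤ᵇ (subst (_≤ c + bit e) (+-identityʳ b) x))) (T⇒≡ (<⇒<ᵇ (subst (λ z → c < b + z) (+-identityʳ r) y)))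
⇒box b c (e ∷ E) (r ∷ R) (suc k) x y =
  ⇒box (b + r) c E R k (subst (_≤ c + bit (mem E k)) (sym (+-assoc b r _)) x) (subst (c <_) (sym (+-assoc b r _)) y)

mem-box : ∀ {n} c (E : Subset n) R k → mem (box 0 c E R) k ≡ true → In E R k c
mem-box c E R k = box⇒ 0 c E R k

box-mem : ∀ {n} c (E : Subset n) R k → In E R k c → mem (box 0 c E R) k ≡ true
box-mem c E R k (x , y) = ⇒box 0 c E R k x y

box-nmem : ∀ {n} c (E : Subset n) R k → ¬ In E R k c → mem (box 0 c E R) k ≡ false
box-nmem c E R k h = ¬true⇒false (λ e → h (mem-box c E R k e))

decRow : ∀ {n} → DRow n → List (Subset n)
decRow (E , R) = applyUpTo (λ c → box 0 c E R) (sum R)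

dec : ∀ {n} → List (DRow n) → Tableau n
dec = map decRow

at-decRow : ∀ {n} (E : Subset n) R c {S} → at (decRow (E , R)) c ≡ just S → c < sum R × S ≡ box 0 c E R
at-decRow E R c h = l , just-injective (trans (sym h) (at-applyUpTo _ (sum R) c l))
  where
  l : c < sum R
  l = subst (c <_) (length-applyUpTo _ (sum R)) (at-< (decRow (E , R)) c h)

low : ∀ {n} → Subset n → ℕ → Bool
low []      k       = false
low (b ∷ S) zero    = false
low (b ∷ S) (suc k) = b ∨ low S k

low⇒ : ∀ {n} (S : Subset n) k → low S k ≡ true → ∃ λ x → x < k × mem S x ≡ true
low⇒ (b ∷ S) (suc k) h with ∨-true {b} h
... | inj₁ e = 0 , s≤s z≤n , e
... | inj₂ e with low⇒ S k e
...   | x , l , m = suc x , s≤s l , m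

⇒low : ∀ {n} (S : Subset n) k x → x < k → mem S x ≡ true → low S k ≡ true
⇒low (b ∷ S) (suc k) zero    l       m rewrite m = refl
⇒low (b ∷ S) (suc k) (suc x) (s≤s l) m = true-∨ʳ b (⇒low S k x l m)

low-≥ : ∀ {n} (S : Subset n) k → n ≤ k → low S k ≡ low S n
low-≥ []      k       l       = refl
low-≥ (b ∷ S) (suc k) (s≤s l) = cong (b ∨_) (low-≥ S k l)

low-0 : ∀ {n} (S : Subset n) → low S 0 ≡ false
low-0 []      = refl
low-0 (b ∷ S) = refl

mem-≥ : ∀ {n} (S : Subset n) k → n ≤ k → mem S k ≡ false
mem-≥ []      k       l       = refl
mem-≥ (b ∷ S) (suc k) (s≤s l) = mem-≥ S k l

mem-< : ∀ {n} (S : Subset n) k → mem S k ≡ true → k < n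
mem-< (b ∷ S) zero    h = s≤s z≤n
mem-< (b ∷ S) (suc k) h = s≤s (mem-< S k h)

cnt : ∀ {n} → List (Subset n) → ℕ → ℕ
cnt []        k = 0
cnt (S ∷ row) k = bit (low S k) + cnt row k

marked : ∀ {n} → List (Subset n) → ℕ → Bool
marked []        k = false
marked (S ∷ row) k = (mem S k ∧ low S k) ∨ marked row k

marked⇒ : ∀ {n} (row : List (Subset n)) k → marked row k ≡ true →
          ∃ λ c → ∃ λ S → at row c ≡ just S × mem S k ≡ true × low S k ≡ true
marked⇒ (S ∷ row) k h with ∨-true {mem S k ∧ low S k} h
... | inj₁ e = 0 , S , refl , ∧-true e
... | inj₂ e with marked⇒ row k e
...   | c , S′ , a , m = suc c , S′ , a , m

⇒marked : ∀ {n} (row : List (Subset n)) k c S → at row c ≡ just S → mem S k ≡ true → low S k ≡ true → marked row k ≡ true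
⇒marked (S ∷ row) k zero    .S refl m l rewrite m | l = refl
⇒marked (S ∷ row) k (suc c) S′ a    m l = true-∨ʳ (mem S k ∧ low S k) (⇒marked row k c S′ a m l)

-- No minimum is computed: `cnt row k`, the number of boxes with an entry below k, is the partial
-- sum of R, and R consists of its differences.
encRow : ∀ {n} → List (Subset n) → DRow n
encRow row = tabulate (λ j → marked row (toℕ j)) , tabulate (λ j → cnt row (suc (toℕ j)) ∸ cnt row (toℕ j))

enc : ∀ {n} → Tableau n → List (DRow n)
enc = map encRow

mem-tabulate : ∀ {n} (f : ℕ → Bool) → (∀ k → n ≤ k → f k ≡ false) → ∀ k → mem (tabulate {n = n} (λ j → f (toℕ j))) k ≡ f k
mem-tabulate {zero}  f h k       = sym (h k z≤n)
mem-tabulate {suc n} f h zero    = refl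
mem-tabulate {suc n} f h (suc k) = mem-tabulate {n} (λ x → f (suc x)) (λ k l → h (suc k) (s≤s l)) k

cum-tabulate : ∀ {n} (f : ℕ → ℕ) → (∀ k → f k ≤ f (suc k)) → (∀ k → n ≤ k → f k ≡ f n)
             → ∀ k → f 0 + cum (tabulate {n = n} (λ j → f (suc (toℕ j)) ∸ f (toℕ j))) k ≡ f k
cum-tabulate         f mono const zero    = +-identityʳ _
cum-tabulate {zero}  f mono const (suc k) = trans (+-identityʳ _) (sym (const (suc k) z≤n))
cum-tabulate {suc n} f mono const (suc k) = begin
  f 0 + ((f 1 ∸ f 0) + cum (tabulate {n = n} g) k) ≡⟨ sym (+-assoc (f 0) _ _) ⟩
  (f 0 + (f 1 ∸ f 0)) + cum (tabulate {n = n} g) k ≡⟨ cong (_+ cum (tabulate {n = n} g) k) (m+[n∸m]≡n (mono 0)) ⟩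
  f 1 + cum (tabulate {n = n} g) k                 ≡⟨ cum-tabulate {n} (λ x → f (suc x)) (λ k → mono (suc k)) (λ k l → const (suc k) (s≤s l)) k ⟩
  f (suc k)                                        ∎
  where
  open ≡-Reasoning
  g : Fin n → ℕ
  g j = f (suc (suc (toℕ j))) ∸ f (suc (toℕ j))

bit-mono : ∀ {a b} → (a ≡ true → b ≡ true) → bit a ≤ bit b
bit-mono {true}  h rewrite h refl = ≤-refl
bit-mono {false} h = z≤n

cnt-mono : ∀ {n} (row : List (Subset n)) k → cnt row k ≤ cnt row (suc k)
cnt-mono []        k = z≤n
cnt-mono (S ∷ row) k = +-mono-≤ (bit-mono step) (cnt-mono row k)
  where
  step : low S k ≡ true → low S (suc k) ≡ true
  step h with low⇒ S k h
  ... | x , l , m = ⇒low S (suc k) x (m≤n⇒m≤1+n l) m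

cnt-≥ : ∀ {n} (row : List (Subset n)) k → n ≤ k → cnt row k ≡ cnt row n
cnt-≥ []        k l = refl
cnt-≥ (S ∷ row) k l = cong₂ _+_ (cong bit (low-≥ S k l)) (cnt-≥ row k l)

cnt-0 : ∀ {n} (row : List (Subset n)) → cnt row 0 ≡ 0
cnt-0 []        = refl
cnt-0 (S ∷ row) rewrite low-0 S = cnt-0 row

marked-≥ : ∀ {n} (row : List (Subset n)) k → n ≤ k → marked row k ≡ false
marked-≥ []        k l = refl
marked-≥ (S ∷ row) k l rewrite mem-≥ S k l = marked-≥ row k l

mem-encRow : ∀ {n} (row : List (Subset n)) k → mem (proj₁ (encRow row)) k ≡ marked row k
mem-encRow row = mem-tabulate (marked row) (marked-≥ row)

cum-encRow : ∀ {n} (row : List (Subset n)) k → cum (proj₂ (encRow row)) k ≡ cnt row k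
cum-encRow {n} row k = trans (cong (_+ cum (proj₂ (encRow row)) k) (sym (cnt-0 row)))
                             (cum-tabulate {n} (cnt row) (cnt-mono row) (cnt-≥ row) k)

record RowValid {n} (row : List (Subset n)) : Set where
  constructor rowValid
  field
    full : ∀ c S → at row c ≡ just S → ∃ λ x → mem S x ≡ true
    weak : ∀ c c′ S S′ x y → c < c′ → at row c ≡ just S → at row c′ ≡ just S′ → mem S x ≡ true → mem S′ y ≡ true → x ≤ y

rowValid-tail : ∀ {n} {S : Subset n} {row} → RowValid (S ∷ row) → RowValid row
rowValid-tail (rowValid f w) = rowValid (λ c → f (suc c)) (λ c c′ S S′ x y l → w (suc c) (suc c′) S S′ x y (s≤s l))

cnt-length : ∀ {n} (row : List (Subset n)) → RowValid row → cnt row n ≡ length row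
cnt-length []        v = refl
cnt-length {n} (S ∷ row) v with RowValid.full v 0 S refl
... | x , m rewrite ⇒low S n x (mem-< S x m) m = cong suc (cnt-length row (rowValid-tail v))

-- The boxes with an entry below k form an initial segment of the row.
cnt⇒low : ∀ {n} (row : List (Subset n)) k → RowValid row → ∀ c S → at row c ≡ just S → c < cnt row k → low S k ≡ true
cnt⇒low (S ∷ row) k v zero .S refl l with low S k in eq
... | true  = refl
... | false = ⊥-elim (<⇒≱ l (≤-reflexive (none row (λ c S′ a → ¬true⇒false (λ h → absurd c S′ a h)))))
  where
  none : ∀ row → (∀ c S′ → at row c ≡ just S′ → low S′ k ≡ false) → cnt row k ≡ 0
  none []         h = refl
  none (S′ ∷ row) h rewrite h 0 S′ refl = none row (λ c → h (suc c))
  absurd : ∀ c S′ → at row c ≡ just S′ → low S′ k ≢ true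
  absurd c S′ a h with low⇒ S′ k h | RowValid.full v 0 S refl
  ... | x , l , m | y , m′ with trans (sym eq) (⇒low S k y (≤-trans (s≤s (RowValid.weak v 0 (suc c) S S′ y x (s≤s z≤n) refl a m′ m)) l) m′)
  ...   | ()
cnt⇒low (S ∷ row) k v (suc c) S′ a l with low S k
... | true  = cnt⇒low row k (rowValid-tail v) c S′ a (≤-pred l)
... | false = cnt⇒low row k (rowValid-tail v) c S′ a (<-trans (n<1+n c) l)

low⇒cnt : ∀ {n} (row : List (Subset n)) k → RowValid row → ∀ c S → at row c ≡ just S → low S k ≡ true → c < cnt row k
low⇒cnt (S ∷ row) k v zero .S refl h rewrite h = s≤s z≤n
low⇒cnt (S ∷ row) k v (suc c) S′ a h with low⇒ S′ k h | RowValid.full v 0 S refl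
... | x , l , m | y , m′
  rewrite ⇒low S k y (≤-trans (s≤s (RowValid.weak v 0 (suc c) S S′ y x (s≤s z≤n) refl a m′ m)) l) m′ =
  s≤s (low⇒cnt row k (rowValid-tail v) c S′ a h)

sum-encRow : ∀ {n} (row : List (Subset n)) → RowValid row → sum (proj₂ (encRow row)) ≡ length row
sum-encRow {n} row v = trans (sym (cum-all (proj₂ (encRow row)))) (trans (cum-encRow row n) (cnt-length row v))

module _ {n} (row : List (Subset n)) (v : RowValid row) where
  private
    E = proj₁ (encRow row)
    R = proj₂ (encRow row)

  -- A box in the range has an entry x ≤ k. If x < k, the lower bound can hold only because k is
  -- marked in some box c′. Here c′ < c would break the weak order, and c < c′ would put c below the
  -- lower bound; so c′ is c.
  In⇒mem : ∀ c S k → at row c ≡ just S → In E R k c → mem S k ≡ true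
  In⇒mem c S k a (lo , hi) rewrite mem-encRow row k | cum-encRow row k | cum-encRow row (suc k)
    with low⇒ S (suc k) (cnt⇒low row (suc k) v c S a hi)
  ... | x , s≤s l , m with m≤n⇒m<n∨m≡n l
  ...   | inj₂ refl = m
  ...   | inj₁ x<k with marked row k in eq
  ...     | false = ⊥-elim (<⇒≱ (low⇒cnt row k v c S a (⇒low S k x x<k m)) (subst (cnt row k ≤_) (+-identityʳ c) lo))
  ...     | true with marked⇒ row k eq
  ...       | c′ , S′ , a′ , m′ , l′ with <-cmp c′ c
  ...         | tri< c′<c _ _ = ⊥-elim (<⇒≱ x<k (RowValid.weak v c′ c S′ S k x c′<c a′ a m′ m))
  ...         | tri≈ _ refl _ with trans (sym a) a′
  ...           | refl = m′
  In⇒mem c S k a (lo , hi) | x , s≤s l , m | inj₁ x<k | true | c′ , S′ , a′ , m′ , l′ | tri> _ _ c<c′ =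
    ⊥-elim (<⇒≱ (low⇒cnt row k v c′ S′ a′ l′) (≤-trans lo (≤-trans (≤-reflexive (+-comm c 1)) c<c′)))

  mem⇒In : ∀ c S k → at row c ≡ just S → mem S k ≡ true → In E R k c
  mem⇒In c S k a m rewrite mem-encRow row k | cum-encRow row k | cum-encRow row (suc k) =
    lower , low⇒cnt row (suc k) v c S a (⇒low S (suc k) k ≤-refl m)
    where
    lower : cnt row k ≤ c + bit (marked row k)
    lower with low S k in eq
    ... | false = ≤-trans (≮⇒≥ (λ l → true≢false (trans (sym (cnt⇒low row k v c S a l)) eq))) (m≤m+n c _)
      where
      true≢false : true ≢ false
      true≢false ()
    ... | true rewrite ⇒marked row k c S a m eq = subst (cnt row k ≤_) (+-comm 1 c) (≮⇒≥ next)
      where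
      next : suc c < cnt row k → ⊥
      next l with <-at row (suc c) (≤-trans l (≤-trans (≤-reflexive (sym (cum-encRow row k))) (≤-trans (cum≤sum R k) (≤-reflexive (sum-encRow row v)))))
      ... | S′ , a′ with low⇒ S′ k (cnt⇒low row k v (suc c) S′ a′ l)
      ...   | x , x<k , m′ = <⇒≱ x<k (RowValid.weak v c (suc c) S S′ k x ≤-refl a a′ m m′)

  decRow-encRow : decRow (encRow row) ≡ row
  decRow-encRow = at-ext _ _ go
    where
    go : ∀ c → at (decRow (encRow row)) c ≡ at row c
    go c with c <? length row
    ... | no  c≥ = trans (at-≥ (decRow (encRow row)) c (subst (_≤ c) (sym (trans (length-applyUpTo (λ c → box 0 c E R) (sum R)) (sum-encRow row v))) (≮⇒≥ c≥)))
                         (sym (at-≥ row c (≮⇒≥ c≥)))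
    ... | yes c< with <-at row c c<
    ...   | S , a = trans (at-applyUpTo _ (sum R) c (subst (c <_) (sym (sum-encRow row v)) c<))
                          (trans (cong just (mem-ext _ S (λ k → bool-ext (λ h → In⇒mem c S k a (mem-box c E R k h))
                                                                         (λ h → box-mem c E R k (mem⇒In c S k a h))))) (sym a))

cum-find : ∀ {n} (R : Vec ℕ n) k c → c < cum R k → ∃ λ x → x < k × cum R x ≤ c × c < cum R (suc x)
cum-find R (suc k) c l with c <? cum R k
... | yes l′ with cum-find R k c l′
...   | x , a , b = x , m≤n⇒m≤1+n a , b
cum-find R (suc k) c l | no l′ = k , ≤-refl , ≮⇒≥ l′ , l

box-low : ∀ {n} c (E : Subset n) R k → c < cum R k → low (box 0 c E R) k ≡ true
box-low c E R k l with cum-find R k c l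
... | x , a , b , d = ⇒low (box 0 c E R) k x a (box-mem c E R x (≤-trans b (m≤m+n c _) , d))

low-box : ∀ {n} c (E : Subset n) R k → low (box 0 c E R) k ≡ true → c < cum R k
low-box c E R k h with low⇒ (box 0 c E R) k h
... | x , l , m = ≤-trans (proj₂ (mem-box c E R x m)) (cum-mono R l)

cnt-initial : ∀ {n} k t m (f : ℕ → Subset n) → t ≤ m → (∀ c → c < t → low (f c) k ≡ true) → (∀ c → low (f c) k ≡ true → c < t)
            → cnt (applyUpTo f m) k ≡ t
cnt-initial k zero    zero    f l a b = refl
cnt-initial k zero    (suc m) f l a b rewrite ¬true⇒false (λ h → <⇒≱ (b 0 h) z≤n) =
  cnt-initial k zero m (λ x → f (suc x)) z≤n (λ c ()) (λ c h → ⊥-elim (<⇒≱ (b (suc c) h) z≤n))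
cnt-initial k (suc t) (suc m) f (s≤s l) a b rewrite a 0 (s≤s z≤n) =
  cong suc (cnt-initial k t m (λ x → f (suc x)) l (λ c l → a (suc c) (s≤s l)) (λ c h → ≤-pred (b (suc c) h)))

cnt-decRow : ∀ {n} (E : Subset n) R k → cnt (decRow (E , R)) k ≡ cum R k
cnt-decRow E R k = cnt-initial k (cum R k) (sum R) _ (cum≤sum R k) (λ c → box-low c E R k) (λ c → low-box c E R k)

-- The hypothesis is what makes (E , R) come from a row: a letter of E needs a box with a smaller
-- minimum to sit in.
encRow-decRow : ∀ {n} (E : Subset n) R → (∀ k → bit (mem E k) ≤ cum R k) → encRow (decRow (E , R)) ≡ (E , R)
encRow-decRow E R ok = cong₂ _,_ (mem-ext _ E (λ k → trans (mem-encRow (decRow (E , R)) k) (bool-ext (to k) (from k))))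
                                 (cum-ext _ R (λ k → trans (cum-encRow (decRow (E , R)) k) (cnt-decRow E R k)))
  where
  to : ∀ k → marked (decRow (E , R)) k ≡ true → mem E k ≡ true
  to k h with marked⇒ (decRow (E , R)) k h
  ... | c , S , a , m , l with at-decRow E R c a
  ...   | _ , refl with mem E k | mem-box c E R k m | low-box c E R k l
  ...     | true  | _        | _  = refl
  ...     | false | lo , _ | l′ = ⊥-elim (<⇒≱ l′ (subst (cum R k ≤_) (+-identityʳ c) lo))
  from : ∀ k → mem E k ≡ true → marked (decRow (E , R)) k ≡ true
  from k h with cum R k in eq | ok k
  from k h | zero  | o rewrite h = ⊥-elim (<⇒≱ o z≤n)
  from k h | suc c | _ = ⇒marked (decRow (E , R)) k c (box 0 c E R)
    (at-applyUpTo _ (sum R) c (≤-trans (≤-reflexive (sym eq)) (cum≤sum R k)))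
    (box-mem c E R k (subst (λ b → cum R k ≤ c + bit b) (sym h) (≤-reflexive (trans eq (+-comm 1 c)))
                     , ≤-trans (≤-reflexive (sym eq)) (cum-mono₁ R k)))
    (box-low c E R k (≤-reflexive (sym eq)))

-- Set-valued tableaux

at-modifyAt : ∀ {A : Set} (xs : List A) c g → at (modifyAt xs c g) c ≡ Maybe.map g (at xs c)
at-modifyAt []       c       g = refl
at-modifyAt (x ∷ xs) zero    g = refl
at-modifyAt (x ∷ xs) (suc c) g = at-modifyAt xs c g

at-modifyAt≢ : ∀ {A : Set} (xs : List A) c g c′ → c ≢ c′ → at (modifyAt xs c g) c′ ≡ at xs c′
at-modifyAt≢ []       c       g c′       ne = refl
at-modifyAt≢ (x ∷ xs) zero    g zero     ne = ⊥-elim (ne refl)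
at-modifyAt≢ (x ∷ xs) zero    g (suc c′) ne = refl
at-modifyAt≢ (x ∷ xs) (suc c) g zero     ne = refl
at-modifyAt≢ (x ∷ xs) (suc c) g (suc c′) ne = at-modifyAt≢ xs c g c′ (λ e → ne (cong suc e))

length-modifyAt : ∀ {A : Set} (xs : List A) c g → length (modifyAt xs c g) ≡ length xs
length-modifyAt []       c       g = refl
length-modifyAt (x ∷ xs) zero    g = refl
length-modifyAt (x ∷ xs) (suc c) g = cong suc (length-modifyAt xs c g)

entry-modify2 : ∀ {A : Set} (T : List (List A)) r c g → entry (modify2 T r c g) r c ≡ Maybe.map g (entry T r c)
entry-modify2 []        r       c g = refl
entry-modify2 (row ∷ T) zero    c g = at-modifyAt row c g
entry-modify2 (row ∷ T) (suc r) c g = entry-modify2 T r c g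

entry-modify2≢ : ∀ {A : Set} (T : List (List A)) r c g r′ c′ → ¬ (r ≡ r′ × c ≡ c′) → entry (modify2 T r c g) r′ c′ ≡ entry T r′ c′
entry-modify2≢ []        r       c g r′       c′ ne = refl
entry-modify2≢ (row ∷ T) zero    c g zero     c′ ne = at-modifyAt≢ row c g c′ (λ e → ne (refl , e))
entry-modify2≢ (row ∷ T) zero    c g (suc r′) c′ ne = refl
entry-modify2≢ (row ∷ T) (suc r) c g zero     c′ ne = refl
entry-modify2≢ (row ∷ T) (suc r) c g (suc r′) c′ ne = entry-modify2≢ T r c g r′ c′ (λ (a , b) → ne (cong suc a , b))

shape-modify2 : ∀ {A : Set} (T : List (List A)) r c g → shape (modify2 T r c g) ≡ shape T
shape-modify2 []        r       c g = refl
shape-modify2 (row ∷ T) zero    c g = cong (_∷ shape T) (length-modifyAt row c g)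
shape-modify2 (row ∷ T) (suc r) c g = cong (length row ∷_) (shape-modify2 T r c g)

at-length : ∀ {A B : Set} (xs : List A) (ys : List B) c {y} → length xs ≡ length ys → at ys c ≡ just y → ∃ λ x → at xs c ≡ just x
at-length xs ys c e a = <-at xs c (subst (c <_) (sym e) (at-< ys c a))

entry-shape : ∀ {A B : Set} (C : List (List A)) (T : List (List B)) r c {y} → shape C ≡ shape T → entry T r c ≡ just y
            → ∃ λ x → entry C r c ≡ just x
entry-shape (xs ∷ C) (ys ∷ T) zero    c e a = at-length xs ys c (proj₁ (∷-injective e)) a
entry-shape (xs ∷ C) (ys ∷ T) (suc r) c e a = entry-shape C T r c (proj₂ (∷-injective e)) a

∈⇒mem : ∀ {n} {S : Subset n} {j} → j ∈ S → mem S (toℕ j) ≡ true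
∈⇒mem here      = refl
∈⇒mem (there h) = ∈⇒mem h

mem⇒∈ : ∀ {n} (S : Subset n) k → mem S k ≡ true → ∃ λ j → toℕ j ≡ k × j ∈ S
mem⇒∈ (true ∷ S) zero    refl = zero , refl , here
mem⇒∈ (b ∷ S)    (suc k) h with mem⇒∈ S k h
... | j , e , m = suc j , cong suc e , there m

choice-override : ∀ {n} {C T} r c (x : Fin n) {S} → IsChoice C T → entry T r c ≡ just S → x ∈ S → IsChoice (modify2 C r c (const x)) T
choice-override {C = C} {T} r c x {S} (sh , ch) e m = trans (shape-modify2 C r c (const x)) sh , go
  where
  go : ∀ r′ c′ j S′ → entry (modify2 C r c (const x)) r′ c′ ≡ just j → entry T r′ c′ ≡ just S′ → j ∈ S′
  go r′ c′ j S′ h k with r ≟ r′ | c ≟ c′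
  ... | no ne | _ = ch r′ c′ j S′ (trans (sym (entry-modify2≢ C r c (const x) r′ c′ (λ (a , _) → ne a))) h) k
  ... | yes _ | no ne = ch r′ c′ j S′ (trans (sym (entry-modify2≢ C r c (const x) r′ c′ (λ (_ , a) → ne a))) h) k
  ... | yes refl | yes refl with trans (sym k) e
  ...   | refl with entry C r c | trans (sym (entry-modify2 C r c (const x))) h
  ...     | just _ | refl = m

override-at : ∀ {n} {C T} r c (x : Fin n) {S} → IsChoice C T → entry T r c ≡ just S → entry (modify2 C r c (const x)) r c ≡ just x
override-at {C = C} {T} r c x (sh , _) e with entry-shape C T r c sh e
... | y , e′ = trans (entry-modify2 C r c (const x)) (cong (Maybe.map (const x)) e′)

pick : ∀ {n} → Fin n → Subset n → Fin n
pick d S with nonempty? S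
... | yes (j , _) = j
... | no  _       = d

pick-∈ : ∀ {n} (d : Fin n) S → (∃ λ j → j ∈ S) → pick d S ∈ S
pick-∈ d S ne with nonempty? S
... | yes (_ , m) = m
... | no  h       = ⊥-elim (h ne)

rowAt-map : ∀ {A B : Set} (f : A → B) (T : List (List A)) r → rowAt (map (map f) T) r ≡ map f (rowAt T r)
rowAt-map f []        r       = refl
rowAt-map f (row ∷ T) zero    = refl
rowAt-map f (row ∷ T) (suc r) = rowAt-map f T r

pick-choice : ∀ {n} (d : Fin n) (T : Tableau n) → NonemptyBoxes T → IsChoice (map (map (pick d)) T) T
pick-choice d T ne = trans (sym (map-∘ T)) (map-cong (length-map (pick d)) T) , go
  where
  go : ∀ r c j S → entry (map (map (pick d)) T) r c ≡ just j → entry T r c ≡ just S → j ∈ S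
  go r c j S h k with trans (sym (cong (Maybe.map (pick d)) k)) (trans (sym (at-map (pick d) (rowAt T r) c))
                        (trans (cong (λ row → at row c) (sym (rowAt-map (pick d) T r))) h))
  ... | refl = pick-∈ d S (ne r c S k)

-- A choice through two prescribed boxes turns the conditions on choices
-- into conditions on pairs of entries.
two-choice : ∀ {n} (T : Tableau n) → NonemptyBoxes T → ∀ r c r′ c′ (x y : Fin n) {S S′} → ¬ (r′ ≡ r × c′ ≡ c)
           → entry T r c ≡ just S → entry T r′ c′ ≡ just S′ → x ∈ S → y ∈ S′
           → ∃ λ C → IsChoice C T × entry C r c ≡ just x × entry C r′ c′ ≡ just y
two-choice T ne r c r′ c′ x y d e e′ m m′ =
  _ , choice-override r′ c′ y ch₁ e′ m′
  , trans (entry-modify2≢ (modify2 (map (map (pick x)) T) r c (const x)) r′ c′ (const y) r c d) (override-at r c x ch₀ e)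
  , override-at r′ c′ y ch₁ e′
  where
  ch₀ = pick-choice x T ne
  ch₁ = choice-override r c x ch₀ e m

ColStrict : ∀ {n} → Tableau n → Set
ColStrict T = ∀ r c S S′ x y → entry T r c ≡ just S → entry T (suc r) c ≡ just S′ → mem S x ≡ true → mem S′ y ≡ true → x < y

svt-col : ∀ {n la} (T : Tableau n) → IsSVT la T → ColStrict T
svt-col T (sh , ne , ss) r c S S′ x y e e′ m m′ with mem⇒∈ S x m | mem⇒∈ S′ y m′
... | i , refl , mi | j , refl , mj with two-choice T ne r c (suc r) c i j (λ (a , _) → 1+n≢n a) e e′ mi mj
...   | C , ch , a , b = proj₂ (ss C ch) r c i j a b

svt-row : ∀ {n la} (T : Tableau n) → IsSVT la T → ∀ r c S S′ x y → entry T r c ≡ just S → entry T r (suc c) ≡ just S′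
        → mem S x ≡ true → mem S′ y ≡ true → x ≤ y
svt-row T (sh , ne , ss) r c S S′ x y e e′ m m′ with mem⇒∈ S x m | mem⇒∈ S′ y m′
... | i , refl , mi | j , refl , mj with two-choice T ne r c r (suc c) i j (λ (_ , a) → 1+n≢n a) e e′ mi mj
...   | C , ch , a , b = proj₁ (ss C ch) r c i j a b

svt-rowValid : ∀ {n la} (T : Tableau n) → IsSVT la T → ∀ r → RowValid (rowAt T r)
svt-rowValid {n} T v@(sh , ne , ss) r = rowValid full weak
  where
  full : ∀ c S → at (rowAt T r) c ≡ just S → ∃ λ x → mem S x ≡ true
  full c S a with ne r c S a
  ... | j , m = toℕ j , ∈⇒mem m
  weak : ∀ c c′ S S′ x y → c < c′ → at (rowAt T r) c ≡ just S → at (rowAt T r) c′ ≡ just S′ → mem S x ≡ true → mem S′ y ≡ true → x ≤ y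
  weak c (suc c′) S S′ x y (s≤s l) a a′ m m′ with m≤n⇒m<n∨m≡n l
  ... | inj₂ refl = svt-row T v r c S S′ x y a a′ m m′
  ... | inj₁ c<c′ with <-at (rowAt T r) c′ (<-trans (n<1+n c′) (at-< (rowAt T r) (suc c′) a′))
  ...   | S″ , a″ with full c′ S″ a″
  ...     | z , m″ = ≤-trans (weak c c′ S S″ x z c<c′ a a″ m m″) (svt-row T v r c′ S″ S′ z y a″ a′ m″ m′)

-- One column decides each case. If k is unmarked, a violation would put a letter at most k of the
-- lower row into the column `cnt row k`, under a box without letters below k. If k is marked in
-- column c, everything under it exceeds k, so the lower count stops at c.
rows-compat : ∀ {n} (row row₂ : List (Subset n)) R₂ → RowValid row → RowValid row₂ → length row₂ ≤ length row
  → (∀ c S S′ x y → at row c ≡ just S → at row₂ c ≡ just S′ → mem S x ≡ true → mem S′ y ≡ true → x < y)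
  → (∀ k → cum R₂ k ≡ cnt row₂ k) → Compat (proj₁ (encRow row)) (proj₂ (encRow row)) R₂
rows-compat {n} row row₂ R₂ v v₂ len col eqR k rewrite mem-encRow row k | cum-encRow row k | eqR (suc k) with marked row k in eq
... | false = subst (_≤ cnt row k) (sym (+-identityʳ _)) (≮⇒≥ short)
  where
  short : ¬ (cnt row k < cnt row₂ (suc k))
  short l with <-at row₂ (cnt row k) (≤-trans l (subst (_≤ length row₂) (eqR (suc k)) (≤-trans (cum≤sum R₂ (suc k)) (≤-reflexive (trans (sym (cum-all R₂)) (trans (eqR n) (cnt-length row₂ v₂)))))))
  ... | S′ , a′ with <-at row (cnt row k) (≤-trans (at-< row₂ _ a′) len)
  ...   | S , a with RowValid.full v _ S a | low⇒ S′ (suc k) (cnt⇒low row₂ (suc k) v₂ _ S′ a′ l)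
  ...     | x , m | y , s≤s y≤k , m′ =
    <-irrefl refl (low⇒cnt row k v _ S a (⇒low S k x (≤-trans (col _ S S′ x y a a′ m m′) y≤k) m))
... | true with marked⇒ row k eq
...   | c , S , a , m , l = subst (_≤ cnt row k) (+-comm 1 _) (≤-trans (s≤s (≮⇒≥ below)) (low⇒cnt row k v c S a l))
  where
  below : ¬ (c < cnt row₂ (suc k))
  below l′ with <-at row₂ c (≤-trans l′ (subst (_≤ length row₂) (eqR (suc k)) (≤-trans (cum≤sum R₂ (suc k)) (≤-reflexive (trans (sym (cum-all R₂)) (trans (eqR n) (cnt-length row₂ v₂)))))))
  ... | S′ , a′ with low⇒ S′ (suc k) (cnt⇒low row₂ (suc k) v₂ c S′ a′ l′)
  ...   | y , s≤s y≤k , m′ = <⇒≱ (col c S S′ k y a a′ m m′) y≤k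

cum-zeros : ∀ n k → cum (zeros {n}) k ≡ 0
cum-zeros n       zero    = refl
cum-zeros zero    (suc k) = refl
cum-zeros (suc n) (suc k) = cum-zeros n k

enc-valid : ∀ {n} (T : Tableau n) → (∀ r → RowValid (rowAt T r)) → ColStrict T → Parts (shape T) → DValid (shape T) (enc T)
enc-valid [] v col ps = refl
enc-valid {n} (row ∷ []) v col (pos , dc , ps) =
  sym (sum-encRow row (v 0)) , subst (1 ≤_) (sym (sum-encRow row (v 0))) pos ,
  Compat⇒Cpt _ _ _ (rows-compat row [] zeros (v 0) (v 1) z≤n (λ c S S′ x y _ ()) (cum-zeros n)) , refl
enc-valid (row ∷ row₂ ∷ T) v col (pos , dc , ps) =
  sym (sum-encRow row (v 0)) , subst (1 ≤_) (sym (sum-encRow row (v 0))) pos ,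
  Compat⇒Cpt _ _ _ (rows-compat row row₂ (proj₂ (encRow row₂)) (v 0) (v 1) dc (λ c → col 0 c) (cum-encRow row₂)) ,
  enc-valid (row₂ ∷ T) (λ r → v (suc r)) (λ r → col (suc r)) ps

parts : ∀ {la} → IsPartition la → Parts la
parts {[]}          (_ , _)           = tt
parts {x ∷ []}      (p ∷ ps , _)      = p , z≤n , tt
parts {x ∷ y ∷ la}  (p ∷ ps , l ∷ ls) = p , l , parts (ps , ls)

partition : ∀ la → Parts la → IsPartition la
partition []           _            = [] , []
partition (x ∷ [])     (p , _ , _)  = p ∷ [] , [-]
partition (x ∷ y ∷ la) (p , l , ps) with partition (y ∷ la) ps
... | as , ls = p ∷ as , l ∷ ls

svt-enc : ∀ {n la} (T : Tableau n) → IsPartition la → IsSVT la T → DValid la (enc T)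
svt-enc T p v@(refl , _) = enc-valid T (svt-rowValid T v) (svt-col T v) (parts p)

dec-enc : ∀ {n} (T : Tableau n) → (∀ r → RowValid (rowAt T r)) → dec (enc T) ≡ T
dec-enc []        v = refl
dec-enc (row ∷ T) v = cong₂ _∷_ (decRow-encRow row (v 0)) (dec-enc T (λ r → v (suc r)))

compat-bit : ∀ {n} (E : Subset n) R R₂ → Compat E R R₂ → ∀ k → bit (mem E k) ≤ cum R k
compat-bit E R R₂ c k = m+n≤o⇒n≤o _ (c k)

enc-dec : ∀ {n la} (D : List (DRow n)) → DValid la D → enc (dec D) ≡ D
enc-dec []            ok              = refl
enc-dec ((E , R) ∷ D) (_ , _ , c , ok) =
  cong₂ _∷_ (encRow-decRow E R (compat-bit E R (topD D) (CompatFrom⇒Compat E R (topD D) c))) (enc-dec D ok)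

entry-dec : ∀ {n} (D : List (DRow n)) r c {S} → entry (dec D) r c ≡ just S
          → ∃ λ E → ∃ λ R → at D r ≡ just (E , R) × c < sum R × S ≡ box 0 c E R
entry-dec ((E , R) ∷ D) zero    c e with at-decRow E R c e
... | l , eq = E , R , refl , l , eq
entry-dec (_ ∷ D) (suc r) c e = entry-dec D r c e

compat-at : ∀ {n la} (D : List (DRow n)) r {E R E₂ R₂} → DValid la D → at D r ≡ just (E , R) → at D (suc r) ≡ just (E₂ , R₂) → Compat E R R₂
compat-at ((E , R) ∷ (E₂ , R₂) ∷ D) zero    (_ , _ , c , _)  refl refl = CompatFrom⇒Compat E R R₂ c
compat-at (_ ∷ D)                   (suc r) (_ , _ , _ , ok) a    b    = compat-at D r ok a b

shape-dec : ∀ {n la} (D : List (DRow n)) → Parts la → DValid la D → shape (dec D) ≡ la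
shape-dec []            ps ok = sym ok
shape-dec {la = []}     ((E , R) ∷ D) ps (len , ne , _) = ⊥-elim (<-irrefl len ne)
shape-dec {la = l ∷ la} ((E , R) ∷ D) (_ , _ , ps) (len , _ , _ , ok) =
  cong₂ _∷_ (trans (length-applyUpTo _ (sum R)) (sym len)) (shape-dec D ps ok)

dec-svt : ∀ {n la} (D : List (DRow n)) → Parts la → DValid la D → IsSVT la (dec D)
dec-svt {n} {la} D ps ok = shape-dec D ps ok , nonempty , λ C ch → rows C ch , cols C ch
  where
  nonempty : NonemptyBoxes (dec D)
  nonempty r c S e with entry-dec D r c e
  ... | E , R , _ , l , refl with low⇒ (box 0 c E R) n (box-low c E R n (subst (c <_) (sym (cum-all R)) l))
  ...   | x , _ , m with mem⇒∈ (box 0 c E R) x m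
  ...     | j , _ , mj = j , mj
  chosen : ∀ C → IsChoice C (dec D) → ∀ r c a → entry C r c ≡ just a
         → ∃ λ E → ∃ λ R → at D r ≡ just (E , R) × In E R (toℕ a) c
  chosen C (sh , ch) r c a e with entry-shape (dec D) C r c (sym sh) e
  ... | S , eS with entry-dec D r c eS
  ...   | E , R , d , _ , refl = E , R , d , mem-box c E R (toℕ a) (∈⇒mem (ch r c a S e eS))
  rows : ∀ C → IsChoice C (dec D) → ∀ r c a b → entry C r c ≡ just a → entry C r (suc c) ≡ just b → a Fin.≤ b
  rows C ch r c a b ea eb with chosen C ch r c a ea | chosen C ch r (suc c) b eb
  ... | E , R , d , lo , _ | E′ , R′ , d′ , _ , hi with trans (sym d) d′
  ...   | refl = ≮⇒≥ (λ b<a → <⇒≱ (≤-trans hi (cum-mono R b<a)) (≤-trans lo (≤-trans (+-monoʳ-≤ c (bit≤1 (mem E (toℕ a)))) (≤-reflexive (+-comm c 1)))))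
  cols : ∀ C → IsChoice C (dec D) → ∀ r c a b → entry C r c ≡ just a → entry C (suc r) c ≡ just b → a Fin.< b
  cols C ch r c a b ea eb with chosen C ch r c a ea | chosen C ch (suc r) c b eb
  ... | E , R , d , lo , _ | E₂ , R₂ , d₂ , _ , hi =
    ≰⇒> (λ b≤a → <⇒≱ (≤-trans hi (cum-mono R₂ (s≤s b≤a))) (+-cancelʳ-≤ (bit (mem E (toℕ a))) _ _ (≤-trans (compat-at D r ok d d₂ (toℕ a)) lo)))

card-box< : ∀ {n} b c (R : Vec ℕ n) → c < b → ∣ box b c ∅ R ∣ ≡ 0
card-box< b c []      l = refl
card-box< b c (r ∷ R) l rewrite ¬true⇒false (λ h → <⇒≱ l (subst (b ≤_) (+-identityʳ c) (≤ᵇ⇒≤ b (c + 0) (≡⇒T h)))) =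
  card-box< (b + r) c R (≤-trans l (m≤m+n b r))

card-box : ∀ {n} b c (R : Vec ℕ n) → b ≤ c → c < b + sum R → ∣ box b c ∅ R ∣ ≡ 1
card-box b c []      l l′ = ⊥-elim (<⇒≱ l′ (subst (_≤ c) (sym (+-identityʳ b)) l))
card-box b c (r ∷ R) l l′ rewrite T⇒≡ (≤⇒≤ᵇ (subst (b ≤_) (sym (+-identityʳ c)) l)) with c <ᵇ b + r in eq
... | true  = cong suc (card-box< (b + r) c R (<ᵇ⇒< c (b + r) (≡⇒T eq)))
... | false = card-box (b + r) c R (≮⇒≥ (λ h → false≢true (trans (sym eq) (T⇒≡ (<⇒<ᵇ h))))) (subst (c <_) (sym (+-assoc b r _)) l′)
  where
  false≢true : false ≢ true
  false≢true ()

at-toD : ∀ {n} (U : List (URow n)) r {E R} → at (toD U) r ≡ just (E , R) → E ≡ ∅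
at-toD (_ ∷ U) zero    refl = refl
at-toD (_ ∷ U) (suc r) e    = at-toD U r e

dec-ssyt : ∀ {n mu} (U : List (URow n)) → Parts mu → DValid mu (toD U) → IsSSYT mu (dec (toD U))
dec-ssyt U ps ok = dec-svt (toD U) ps ok , single
  where
  single : ∀ r c S → entry (dec (toD U)) r c ≡ just S → ∣ S ∣ ≡ 1
  single r c S e with entry-dec (toD U) r c e
  ... | E , R , d , l , refl with at-toD U r d
  ...   | refl = card-box 0 c R z≤n l

card-mem : ∀ {n} (S : Subset n) k → mem S k ≡ true → 1 ≤ ∣ S ∣
card-mem (true ∷ S)  k       m = s≤s z≤n
card-mem (false ∷ S) (suc k) m = card-mem S k m

card-mem-low : ∀ {n} (S : Subset n) k → mem S k ≡ true → low S k ≡ true → 2 ≤ ∣ S ∣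
card-mem-low (true ∷ S)  (suc k) m l = s≤s (card-mem S k m)
card-mem-low (false ∷ S) (suc k) m l = card-mem-low S k m l

single-enc : ∀ {n} (row : List (Subset n)) → (∀ c S → at row c ≡ just S → ∣ S ∣ ≡ 1) → proj₁ (encRow row) ≡ ∅
single-enc {n} row h = mem-ext _ _ (λ k → trans (mem-encRow row k) (trans (¬true⇒false (none k)) (sym (mem-∅ n k))))
  where
  none : ∀ k → marked row k ≢ true
  none k e with marked⇒ row k e
  ... | c , S , a , m , l = <⇒≱ (card-mem-low S k m l) (≤-reflexive (h c S a))

count-interval : ∀ m lo d (g : ℕ → Bool) → lo + d ≤ m → (∀ c → g c ≡ true → lo ≤ c × c < lo + d)
  → (∀ c → lo ≤ c → c < lo + d → g c ≡ true) → sumL (applyUpTo (λ c → bit (g c)) m) ≡ d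
count-interval zero    zero     zero    g l a b = refl
count-interval (suc m) zero     zero    g l a b rewrite ¬true⇒false {g 0} (λ h → <⇒≱ (proj₂ (a 0 h)) z≤n) =
  count-interval m 0 0 (λ c → g (suc c)) z≤n (λ c h → ⊥-elim (<⇒≱ (proj₂ (a (suc c) h)) z≤n)) (λ c _ ())
count-interval (suc m) zero     (suc d) g (s≤s l) a b rewrite b 0 z≤n (s≤s z≤n) =
  cong suc (count-interval m 0 d (λ c → g (suc c)) l (λ c h → z≤n , ≤-pred (proj₂ (a (suc c) h))) (λ c _ h → b (suc c) z≤n (s≤s h)))
count-interval (suc m) (suc lo) d       g (s≤s l) a b rewrite ¬true⇒false {g 0} (λ h → <⇒≱ (s≤s z≤n) (proj₁ (a 0 h))) =
  count-interval m lo d (λ c → g (suc c)) l (λ c h → ≤-pred (proj₁ (a (suc c) h)) , ≤-pred (proj₂ (a (suc c) h)))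
    (λ c h k → b (suc c) (s≤s h) (s≤s k))

map-applyUpTo : ∀ {A B : Set} (h : A → B) f m → map h (applyUpTo f m) ≡ applyUpTo (λ c → h (f c)) m
map-applyUpTo h f zero    = refl
map-applyUpTo h f (suc m) = cong (h (f 0) ∷_) (map-applyUpTo h (λ c → f (suc c)) m)

lookup-mem : ∀ {n} (S : Subset n) j → lookup S j ≡ mem S (toℕ j)
lookup-mem (b ∷ S) zero    = refl
lookup-mem (b ∷ S) (suc j) = lookup-mem S j

row-weight : ∀ {n} (E : Subset n) R k → (∀ k → bit (mem E k) ≤ cum R k)
  → sumL (applyUpTo (λ c → bit (mem (box 0 c E R) k)) (sum R)) ≡ R ‼ k + bit (mem E k)
row-weight E R k ok = count-interval (sum R) (cum R k ∸ e) (R ‼ k + e) _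
  (≤-trans (≤-reflexive hi) (cum≤sum R (suc k)))
  (λ c h → let (x , y) = mem-box c E R k h in
    lin 4 (λ lo e ck c → lo :+ e := ck :⇒ ck :≤ c :+ e :⇒ lo :≤ c) _ e (cum R k) c lo+e x , subst (c <_) (sym hi) y)
  (λ c x y → box-mem c E R k (lin 4 (λ lo e ck c → lo :+ e := ck :⇒ lo :≤ c :⇒ ck :≤ c :+ e) _ e (cum R k) c lo+e x , subst (c <_) hi y))
  where
  e = bit (mem E k)
  lo+e : cum R k ∸ e + e ≡ cum R k
  lo+e = m∸n+n≡m (ok k)
  hi : cum R k ∸ e + (R ‼ k + e) ≡ cum R (suc k)
  hi = lin 5 (λ lo e ck r ck′ → lo :+ e := ck :⇒ ck′ := ck :+ r :⇒ lo :+ (r :+ e) := ck′) _ e (cum R k) (R ‼ k) _ lo+e (cum-suc R k)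

if-bit : ∀ b → (if b then 1 else 0) ≡ bit b
if-bit true  = refl
if-bit false = refl

wt-dec : ∀ {n la} (D : List (DRow n)) → DValid la D → wt (dec D) ≡ tabulate (λ j → weightD D (toℕ j))
wt-dec {n} D ok = Vec.tabulate-cong (λ j → go j D ok)
  where
  row : ∀ j (E : Subset n) R → (∀ k → bit (mem E k) ≤ cum R k)
      → sumL (map (λ S → if lookup S j then 1 else 0) (decRow (E , R))) ≡ R ‼ toℕ j + bit (mem E (toℕ j))
  row j E R b = trans (cong sumL (trans (map-cong (λ S → trans (if-bit (lookup S j)) (cong bit (lookup-mem S j))) (decRow (E , R)))
                                        (map-applyUpTo (λ S → bit (mem S (toℕ j))) (λ c → box 0 c E R) (sum R))))
                      (row-weight E R (toℕ j) b)
  go : ∀ {la} j (D : List (DRow n)) → DValid la D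
     → sumL (map (λ row → sumL (map (λ S → if lookup S j then 1 else 0) row)) (dec D)) ≡ weightD D (toℕ j)
  go j []            ok               = refl
  go j ((E , R) ∷ D) (_ , _ , c , ok) = cong₂ _+_ (row j E R (compat-bit E R (topD D) (CompatFrom⇒Compat E R (topD D) c))) (go j D ok)

weightD-toD : ∀ {n} (U : List (URow n)) k → weightD (toD U) k ≡ weightU U k
weightD-toD []            k = refl
weightD-toD {n} ((R , _) ∷ U) k rewrite mem-∅ n k | +-identityʳ (R ‼ k) = cong (R ‼ k +_) (weightD-toD U k)

-- Sign words

s⁺ s⁻ : Sig
s⁺ = 1 , 0
s⁻ = 0 , 1

sigSign : Sign → Sig
sigSign plus  = s⁺
sigSign minus = s⁻

Word : Set
Word = List (ℕ × Sign)

sigW : Word → Sig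
sigW []            = ε
sigW ((_ , s) ∷ w) = sigSign s ∙ sigW w

sigW-++ : ∀ u v → sigW (u ++ v) ≡ sigW u ∙ sigW v
sigW-++ []            v = sym (∙-identityˡ _)
sigW-++ ((_ , s) ∷ u) v = trans (cong (sigSign s ∙_) (sigW-++ u v)) (sym (∙-assoc (sigSign s) (sigW u) (sigW v)))

cancel : ∀ s → s⁻ ∙ (s⁺ ∙ s) ≡ s
cancel s = trans (sym (∙-assoc s⁻ s⁺ s)) (∙-identityˡ s)

-- An occurrence in a word, remembered by the signatures of what stands before and after it. Unlike
-- positions, these do not change when a pair - + elsewhere is deleted.
record SplitAs (w : Word) (y : ℕ × Sign) (a b : Sig) : Set where
  constructor splitAs
  field
    pre suf : Word
    eq      : w ≡ pre ++ y ∷ suf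
    sig-pre : sigW pre ≡ a
    sig-suf : sigW suf ≡ b

consSplit : ∀ {w y a b} x → SplitAs w y a b → SplitAs (x ∷ w) y (sigSign (proj₂ x) ∙ a) b
consSplit x (splitAs u v refl refl refl) = splitAs (x ∷ u) v refl refl refl

deleteFirst-sig : ∀ w {w′} → deleteFirst w ≡ just w′ → sigW w ≡ sigW w′
deleteFirst-sig ((c , minus) ∷ (d , plus) ∷ w)  refl = cancel (sigW w)
deleteFirst-sig ((c , minus) ∷ (d , minus) ∷ w) e with deleteFirst ((d , minus) ∷ w) in eq | e
... | just w′ | refl = cong (s⁻ ∙_) (deleteFirst-sig ((d , minus) ∷ w) eq)
deleteFirst-sig ((c , plus) ∷ w) e with deleteFirst w in eq | e
... | just w′ | refl = cong (s⁺ ∙_) (deleteFirst-sig w eq)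

deleteFirst-split : ∀ w {w′ y a b} → deleteFirst w ≡ just w′ → SplitAs w′ y a b → SplitAs w y a b
deleteFirst-cons : ∀ x w {w′ y a b} → deleteFirst w ≡ just w′ → SplitAs (x ∷ w′) y a b → SplitAs (x ∷ w) y a b
deleteFirst-cons x w e (splitAs []       v refl refl refl) = splitAs [] w refl refl (deleteFirst-sig w e)
deleteFirst-cons x w e (splitAs (_ ∷ u) v refl refl refl)  = consSplit x (deleteFirst-split w e (splitAs u v refl refl refl))
deleteFirst-split ((c , minus) ∷ (d , plus) ∷ w) {y = y} {a} {b} refl s =
  subst (λ z → SplitAs ((c , minus) ∷ (d , plus) ∷ w) y z b) (cancel a) (consSplit (c , minus) (consSplit (d , plus) s))
deleteFirst-split ((c , minus) ∷ (d , minus) ∷ w) e s with deleteFirst ((d , minus) ∷ w) in eq | e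
... | just w′ | refl = deleteFirst-cons _ _ eq s
deleteFirst-split ((c , plus) ∷ w) e s with deleteFirst w in eq | e
... | just w′ | refl = deleteFirst-cons _ _ eq s

lastPlus-nothing : ∀ w → lastPlus w ≡ nothing → P (sigW w) ≡ 0
lastPlus-nothing [] e = refl
lastPlus-nothing ((c , plus) ∷ w) e with lastPlus w
lastPlus-nothing ((c , plus) ∷ w) () | nothing
lastPlus-nothing ((c , plus) ∷ w) () | just _
lastPlus-nothing ((c , minus) ∷ w) e = trans (cong (_∸ 1) (lastPlus-nothing w e)) refl

firstMinus-nothing : ∀ w → firstMinus w ≡ nothing → M (sigW w) ≡ 0
firstMinus-nothing [] e = refl
firstMinus-nothing ((c , plus) ∷ w) e rewrite 0∸n≡0 (P (sigW w)) = trans (+-identityʳ _) (firstMinus-nothing w e)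

reduced-minus : ∀ c w → deleteFirst ((c , minus) ∷ w) ≡ nothing → lastPlus w ≡ nothing
reduced-minus c []                e = refl
reduced-minus c ((d , minus) ∷ w) e with deleteFirst ((d , minus) ∷ w) in eq | e
... | nothing | _ = reduced-minus d w eq

reduced-tail : ∀ c w → deleteFirst ((c , plus) ∷ w) ≡ nothing → deleteFirst w ≡ nothing
reduced-tail c w e with deleteFirst w | e
... | nothing | _ = refl

-- One condition serves both signs. For a +, the first equation says that it survives and the second
-- that it is the last to do so; for a -, the second says that it survives and the first that none
-- survives before it.
Uncancelled : Word → Sign → ℕ → Set
Uncancelled w s c = ∃ λ a → ∃ λ b → SplitAs w (c , s) a b × M a ≡ 0 × P b ≡ 0

consPlus : ∀ {w s c} d → Uncancelled w s c → Uncancelled ((d , plus) ∷ w) s c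
consPlus d (a , b , s , m , p) = s⁺ ∙ a , b , consSplit (d , plus) s , trans (cong (M a +_) (0∸n≡0 (P a))) (trans (+-identityʳ _) m) , p

reduced-lastPlus : ∀ w c → deleteFirst w ≡ nothing → lastPlus w ≡ just c → Uncancelled w plus c
reduced-lastPlus ((d , minus) ∷ w) c e h with trans (sym h) (reduced-minus d w e)
... | ()
reduced-lastPlus ((d , plus) ∷ w) c e h with lastPlus w in eq
reduced-lastPlus ((d , plus) ∷ w) c e refl | nothing = _ , _ , splitAs [] w refl refl refl , refl , lastPlus-nothing w eq
reduced-lastPlus ((d , plus) ∷ w) c e refl | just _  = consPlus d (reduced-lastPlus w c (reduced-tail d w e) eq)

reduced-firstMinus : ∀ w c → deleteFirst w ≡ nothing → firstMinus w ≡ just c → Uncancelled w minus c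
reduced-firstMinus ((d , minus) ∷ w) c e refl = _ , _ , splitAs [] w refl refl refl , refl , lastPlus-nothing w (reduced-minus d w e)
reduced-firstMinus ((d , plus) ∷ w)  c e h    = consPlus d (reduced-firstMinus w c (reduced-tail d w e) h)

deleteFirst-length : ∀ w {w′} → deleteFirst w ≡ just w′ → length w′ < length w
deleteFirst-length ((c , minus) ∷ (d , plus) ∷ w)  refl = n≤1+n _
deleteFirst-length ((c , minus) ∷ (d , minus) ∷ w) e with deleteFirst ((d , minus) ∷ w) in eq | e
... | just w′ | refl = s≤s (deleteFirst-length ((d , minus) ∷ w) eq)
deleteFirst-length ((c , plus) ∷ w) e with deleteFirst w in eq | e
... | just w′ | refl = s≤s (deleteFirst-length w eq)

record Reduction (w w′ : Word) : Set where
  field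
    normal : deleteFirst w′ ≡ nothing
    sig    : sigW w ≡ sigW w′
    split  : ∀ {y a b} → SplitAs w′ y a b → SplitAs w y a b

reduceWith-spec : ∀ m w → length w ≤ m → Reduction w (reduceWith m w)
reduceWith-spec zero    [] l = record { normal = refl ; sig = refl ; split = λ s → s }
reduceWith-spec (suc m) w  l with deleteFirst w in eq
... | nothing = record { normal = eq ; sig = refl ; split = λ s → s }
... | just w′ with reduceWith-spec m w′ (≤-pred (≤-trans (deleteFirst-length w eq) l))
...   | r = record { normal = Reduction.normal r
                   ; sig    = trans (deleteFirst-sig w eq) (Reduction.sig r)
                   ; split  = λ s → deleteFirst-split w eq (Reduction.split r s) }

module _ (w : Word) where
  private
    r = reduceWith-spec (length w) w ≤-refl

  lastPlus-just : ∀ c → lastPlus (reduce w) ≡ just c → Uncancelled w plus c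
  lastPlus-just c e with reduced-lastPlus (reduce w) c (Reduction.normal r) e
  ... | a , b , s , m , p = a , b , Reduction.split r s , m , p

  firstMinus-just : ∀ c → firstMinus (reduce w) ≡ just c → Uncancelled w minus c
  firstMinus-just c e with reduced-firstMinus (reduce w) c (Reduction.normal r) e
  ... | a , b , s , m , p = a , b , Reduction.split r s , m , p

  lastPlus-none : lastPlus (reduce w) ≡ nothing → P (sigW w) ≡ 0
  lastPlus-none e = trans (cong P (Reduction.sig r)) (lastPlus-nothing (reduce w) e)

  firstMinus-none : firstMinus (reduce w) ≡ nothing → M (sigW w) ≡ 0
  firstMinus-none e = trans (cong M (Reduction.sig r)) (firstMinus-nothing (reduce w) e)

-- Products of signatures over ranges of columns

prod : (ℕ → Sig) → ℕ → ℕ → Sig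
prod f lo zero    = ε
prod f lo (suc m) = f lo ∙ prod f (suc lo) m

Pr : (ℕ → Sig) → ℕ → ℕ → Sig
Pr f lo hi = prod f lo (hi ∸ lo)

prod-+ : ∀ f lo m k → prod f lo (m + k) ≡ prod f lo m ∙ prod f (lo + m) k
prod-+ f lo zero    k rewrite +-identityʳ lo = sym (∙-identityˡ _)
prod-+ f lo (suc m) k rewrite +-suc lo m =
  trans (cong (f lo ∙_) (prod-+ f (suc lo) m k)) (sym (∙-assoc (f lo) (prod f (suc lo) m) (prod f (suc (lo + m)) k)))

Pr-split : ∀ f {lo mid hi} → lo ≤ mid → mid ≤ hi → Pr f lo hi ≡ Pr f lo mid ∙ Pr f mid hi
Pr-split f {lo} {mid} {hi} l l′ = trans (cong (prod f lo) eq) (trans (prod-+ f lo (mid ∸ lo) (hi ∸ mid)) (cong (λ z → Pr f lo mid ∙ prod f z (hi ∸ mid)) (m+[n∸m]≡n l)))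
  where
  eq : hi ∸ lo ≡ (mid ∸ lo) + (hi ∸ mid)
  eq = +-cancelʳ-≡ lo _ _ (trans (m∸n+n≡m (≤-trans l l′))
    (lin 5 (λ hi lo mid x y → x :+ lo := mid :⇒ y :+ mid := hi :⇒ hi := x :+ y :+ lo) hi lo mid (mid ∸ lo) (hi ∸ mid) (m∸n+n≡m l) (m∸n+n≡m l′)))

Pr-one : ∀ f lo → Pr f lo (suc lo) ≡ f lo
Pr-one f lo rewrite m+n∸n≡m 1 lo = ∙-identityʳ (f lo)

Pr-head : ∀ f {lo hi} → lo < hi → Pr f lo hi ≡ f lo ∙ Pr f (suc lo) hi
Pr-head f {lo} {hi} l = trans (Pr-split f (n≤1+n lo) l) (cong (_∙ Pr f (suc lo) hi) (Pr-one f lo))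

prod-cong : ∀ f g lo m → (∀ c → lo ≤ c → c < lo + m → f c ≡ g c) → prod f lo m ≡ prod g lo m
prod-cong f g lo zero    h = refl
prod-cong f g lo (suc m) h = cong₂ _∙_ (h lo ≤-refl (m<m+n lo (s≤s z≤n)))
  (prod-cong f g (suc lo) m (λ c l l′ → h c (≤-trans (n≤1+n lo) l) (subst (c <_) (sym (+-suc lo m)) l′)))

Pr-cong : ∀ f g lo hi → (∀ c → lo ≤ c → c < hi → f c ≡ g c) → Pr f lo hi ≡ Pr g lo hi
Pr-cong f g lo hi h with ≤-total lo hi
... | inj₁ l = prod-cong f g lo (hi ∸ lo) (λ c a b → h c a (subst (c <_) (m+[n∸m]≡n l) b))
... | inj₂ l rewrite m≤n⇒m∸n≡0 l = refl

prod-ε : ∀ lo m → prod (λ _ → ε) lo m ≡ ε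
prod-ε lo zero    = refl
prod-ε lo (suc m) = trans (∙-identityˡ _) (prod-ε (suc lo) m)

prod-plus : ∀ lo m → prod (λ _ → s⁺) lo m ≡ (m , 0)
prod-plus lo zero    = refl
prod-plus lo (suc m) rewrite prod-plus (suc lo) m = cong (suc m ,_) (0∸n≡0 m)

prod-minus : ∀ lo m → prod (λ _ → s⁻) lo m ≡ (0 , m)
prod-minus lo zero    = refl
prod-minus lo (suc m) rewrite prod-minus (suc lo) m = cong (0 ,_) (+-comm m 1)

Pr-ε : ∀ f lo hi → (∀ c → lo ≤ c → c < hi → f c ≡ ε) → Pr f lo hi ≡ ε
Pr-ε f lo hi h = trans (Pr-cong f (λ _ → ε) lo hi h) (prod-ε lo (hi ∸ lo))

Pr-plus : ∀ f lo hi → (∀ c → lo ≤ c → c < hi → f c ≡ s⁺) → Pr f lo hi ≡ (hi ∸ lo , 0)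
Pr-plus f lo hi h = trans (Pr-cong f (λ _ → s⁺) lo hi h) (prod-plus lo (hi ∸ lo))

Pr-minus : ∀ f lo hi → (∀ c → lo ≤ c → c < hi → f c ≡ s⁻) → Pr f lo hi ≡ (0 , hi ∸ lo)
Pr-minus f lo hi h = trans (Pr-cong f (λ _ → s⁻) lo hi h) (prod-minus lo (hi ∸ lo))

sig2 : Bool → Bool → Sig
sig2 true  false = s⁺
sig2 false true  = s⁻
sig2 _     _     = ε

signAt : ℕ → Bool → Bool → Word
signAt c a b = if a ∧ not b then (c , plus) ∷ [] else if b ∧ not a then (c , minus) ∷ [] else []

sigW-signAt : ∀ c a b → sigW (signAt c a b) ≡ sig2 a b
sigW-signAt c true  true  = refl
sigW-signAt c true  false = refl
sigW-signAt c false true  = refl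
sigW-signAt c false false = refl

signAt-cases : ∀ c a b → signAt c a b ≡ [] ⊎ ∃ λ s → signAt c a b ≡ (c , s) ∷ [] × sig2 a b ≡ sigSign s
signAt-cases c true  true  = inj₁ refl
signAt-cases c true  false = inj₂ (plus , refl , refl)
signAt-cases c false true  = inj₂ (minus , refl , refl)
signAt-cases c false false = inj₁ refl

split-head : ∀ {X : Set} {x y : X} {w} u {v} → x ∷ w ≡ u ++ y ∷ v →
  (u ≡ [] × x ≡ y × w ≡ v) ⊎ ∃ λ u′ → u ≡ x ∷ u′ × w ≡ u′ ++ y ∷ v
split-head []      refl = inj₁ (refl , refl , refl)
split-head (_ ∷ u) refl = inj₂ (u , refl , refl)

module Columns (A B : ℕ → Bool) where

  f : ℕ → Sig
  f c = sig2 (A c) (B c)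

  word : ℕ → ℕ → Word
  word lo zero    = []
  word lo (suc m) = signAt lo (A lo) (B lo) ++ word (suc lo) m

  word-concatMap : ∀ g m lo → (∀ x → g x ≡ lo + x) → concatMap (λ c → signAt c (A c) (B c)) (applyUpTo g m) ≡ word lo m
  word-concatMap g zero    lo h = refl
  word-concatMap g (suc m) lo h rewrite trans (h 0) (+-identityʳ lo) =
    cong (signAt lo (A lo) (B lo) ++_) (word-concatMap (λ x → g (suc x)) m (suc lo) (λ x → trans (h (suc x)) (+-suc lo x)))

  sig-word : ∀ lo m → sigW (word lo m) ≡ prod f lo m
  sig-word lo zero    = refl
  sig-word lo (suc m) = trans (sigW-++ (signAt lo (A lo) (B lo)) (word (suc lo) m)) (cong₂ _∙_ (sigW-signAt lo (A lo) (B lo)) (sig-word (suc lo) m))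

  split-word : ∀ lo m {c s a b} → SplitAs (word lo m) (c , s) a b → ∃ λ d → ∃ λ e →
    c ≡ lo + d × m ≡ d + suc e × f c ≡ sigSign s × prod f lo d ≡ a × prod f (suc c) e ≡ b
  split-word lo zero    (splitAs [] v () _ _)
  split-word lo zero    (splitAs (_ ∷ u) v () _ _)
  split-word lo (suc m) {c} {s} (splitAs u v eq p q) with signAt-cases lo (A lo) (B lo)
  ... | inj₁ e rewrite e with split-word (suc lo) m (splitAs u v eq p q)
  ...   | d , e′ , refl , refl , g , h , k = suc d , e′ , sym (+-suc lo d) , refl , g , trans (cong (_∙ prod f (suc lo) d) (trans (sym (sigW-signAt lo (A lo) (B lo))) (cong sigW e))) (trans (∙-identityˡ _) h) , k
  split-word lo (suc m) {c} {s} (splitAs u v eq p q) | inj₂ (t , e , e″) rewrite e with split-head u eq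
  ... | inj₁ (refl , refl , eq′) = 0 , m , sym (+-identityʳ lo) , refl , e″ , p , trans (trans (sym (sig-word (suc lo) m)) (cong sigW eq′)) q
  ... | inj₂ (u′ , refl , eq′) with split-word (suc lo) m (splitAs u′ v eq′ refl q)
  ...   | d , e′ , refl , refl , g , h , k = suc d , e′ , sym (+-suc lo d) , refl , g , trans (cong₂ _∙_ e″ h) p , k

  uncancelled : ∀ N {s c} → Uncancelled (word 0 N) s c → c < N × f c ≡ sigSign s × M (Pr f 0 c) ≡ 0 × P (Pr f (suc c) N) ≡ 0
  uncancelled N {s} {c} (a , b , sp , m , p) with split-word 0 N sp
  ... | d , e , refl , refl , g , refl , refl =
    m<m+n c (s≤s z≤n) , g , m , trans (cong (λ z → P (prod f (suc c) z)) (trans (cong (_∸ suc c) (+-suc c e)) (m+n∸m≡n (suc c) e))) p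

-- Changing one entry of a row

mem-put : ∀ {n} (S : Subset n) j v → j < n → mem (put S (suc j) v) j ≡ v
mem-put (b ∷ S) zero    v l       = refl
mem-put (b ∷ S) (suc j) v (s≤s l) = mem-put S j v l

mem-put≢ : ∀ {n} (S : Subset n) j v j′ → j′ ≢ j → mem (put S (suc j) v) j′ ≡ mem S j′
mem-put≢ []      j       v j′       ne = refl
mem-put≢ (b ∷ S) zero    v zero     ne = ⊥-elim (ne refl)
mem-put≢ (b ∷ S) zero    v (suc j′) ne = refl
mem-put≢ (b ∷ S) (suc j) v zero     ne = refl
mem-put≢ (b ∷ S) (suc j) v (suc j′) ne = mem-put≢ S j v j′ (λ e → ne (cong suc e))

applyUpTo-cong : ∀ {A : Set} (g g′ : ℕ → A) m → (∀ c → g c ≡ g′ c) → applyUpTo g m ≡ applyUpTo g′ m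
applyUpTo-cong g g′ zero    h = refl
applyUpTo-cong g g′ (suc m) h = cong₂ _∷_ (h 0) (applyUpTo-cong (λ c → g (suc c)) (λ c → g′ (suc c)) m (λ c → h (suc c)))

modifyAt-applyUpTo : ∀ {A : Set} (g g′ : ℕ → A) h m x → (∀ c → c ≢ x → g c ≡ g′ c) → h (g x) ≡ g′ x
                   → modifyAt (applyUpTo g m) x h ≡ applyUpTo g′ m
modifyAt-applyUpTo g g′ h zero    x       off on = refl
modifyAt-applyUpTo g g′ h (suc m) zero    off on = cong₂ _∷_ on (applyUpTo-cong _ _ m (λ c → off (suc c) (λ ())))
modifyAt-applyUpTo g g′ h (suc m) (suc x) off on = cong₂ _∷_ (off 0 (λ ()))
  (modifyAt-applyUpTo (λ c → g (suc c)) (λ c → g′ (suc c)) h m x (λ c ne → off (suc c) (λ e → ne (suc-injective e))) on)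

-- The rows g and g′ differ in the letter j₁ at the column x₁, where its
-- new status is v₁, and in j₂ at x₂, where it is v₂.
record Delta {n} (g g′ : ℕ → Subset n) (j₁ x₁ : ℕ) (v₁ : Bool) (j₂ x₂ : ℕ) (v₂ : Bool) : Set where
  field
    at₁   : mem (g′ x₁) j₁ ≡ v₁
    at₂   : mem (g′ x₂) j₂ ≡ v₂
    off₁  : ∀ c → c ≢ x₁ → mem (g c) j₁ ≡ mem (g′ c) j₁
    off₂  : ∀ c → c ≢ x₂ → mem (g c) j₂ ≡ mem (g′ c) j₂
    other : ∀ c j → j ≢ j₁ → j ≢ j₂ → mem (g c) j ≡ mem (g′ c) j

module _ {n} {g g′ : ℕ → Subset n} {j₁ x₁ v₁ j₂ x₂ v₂} (δ : Delta g g′ j₁ x₁ v₁ j₂ x₂ v₂)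
         (j₁<n : j₁ < n) (j₂<n : j₂ < n) (j₁≢j₂ : j₁ ≢ j₂) where
  open Delta δ

  agree : ∀ c → c ≢ x₁ → c ≢ x₂ → g c ≡ g′ c
  agree c a b = mem-ext (g c) (g′ c) go
    where
    go : ∀ j → mem (g c) j ≡ mem (g′ c) j
    go j with j ≟ j₁ | j ≟ j₂
    ... | yes refl | _        = off₁ c a
    ... | no _     | yes refl = off₂ c b
    ... | no ne₁   | no ne₂   = other c j ne₁ ne₂

  delta-one : ∀ m → x₁ ≡ x₂ → modifyAt (applyUpTo g m) x₁ (λ S → put (put S (suc j₁) v₁) (suc j₂) v₂) ≡ applyUpTo g′ m
  delta-one m refl = modifyAt-applyUpTo g g′ _ m x₁ (λ c ne → agree c ne ne) (mem-ext _ (g′ x₁) go)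
    where
    go : ∀ j → mem (put (put (g x₁) (suc j₁) v₁) (suc j₂) v₂) j ≡ mem (g′ x₁) j
    go j with j ≟ j₂ | j ≟ j₁
    ... | yes refl | _        = trans (mem-put (put (g x₁) (suc j₁) v₁) j₂ v₂ j₂<n) (sym at₂)
    ... | no ne₂   | yes refl = trans (mem-put≢ (put (g x₁) (suc j₁) v₁) j₂ v₂ j₁ ne₂) (trans (mem-put (g x₁) j₁ v₁ j₁<n) (sym at₁))
    ... | no ne₂   | no ne₁   = trans (mem-put≢ (put (g x₁) (suc j₁) v₁) j₂ v₂ j ne₂) (trans (mem-put≢ (g x₁) j₁ v₁ j ne₁) (other x₁ j ne₁ ne₂))

  delta-two : ∀ m → x₁ ≢ x₂ → modifyAt (modifyAt (applyUpTo g m) x₁ (λ S → put S (suc j₁) v₁)) x₂ (λ S → put S (suc j₂) v₂) ≡ applyUpTo g′ m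
  delta-two m ne = trans (cong (λ row → modifyAt row x₂ (λ S → put S (suc j₂) v₂)) first) second
    where
    mid : ℕ → Subset n
    mid c with c ≟ x₁
    ... | yes _ = put (g c) (suc j₁) v₁
    ... | no _  = g c
    mid-x₁ : mid x₁ ≡ put (g x₁) (suc j₁) v₁
    mid-x₁ with x₁ ≟ x₁
    ... | yes _ = refl
    ... | no h  = ⊥-elim (h refl)
    mid-≢ : ∀ c → c ≢ x₁ → mid c ≡ g c
    mid-≢ c h with c ≟ x₁
    ... | yes e = ⊥-elim (h e)
    ... | no _  = refl
    first : modifyAt (applyUpTo g m) x₁ (λ S → put S (suc j₁) v₁) ≡ applyUpTo mid m
    first = modifyAt-applyUpTo g mid _ m x₁ (λ c h → sym (mid-≢ c h)) (sym mid-x₁)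
    second : modifyAt (applyUpTo mid m) x₂ (λ S → put S (suc j₂) v₂) ≡ applyUpTo g′ m
    second = modifyAt-applyUpTo mid g′ _ m x₂ off (trans (cong (λ S → put S (suc j₂) v₂) (mid-≢ x₂ (λ e → ne (sym e)))) (mem-ext _ (g′ x₂) on))
      where
      on : ∀ j → mem (put (g x₂) (suc j₂) v₂) j ≡ mem (g′ x₂) j
      on j with j ≟ j₂ | j ≟ j₁
      ... | yes refl | _        = trans (mem-put (g x₂) j₂ v₂ j₂<n) (sym at₂)
      ... | no ne₂   | yes refl = trans (mem-put≢ (g x₂) j₂ v₂ j₁ ne₂) (off₁ x₂ (λ e → ne (sym e)))
      ... | no ne₂   | no ne₁   = trans (mem-put≢ (g x₂) j₂ v₂ j ne₂) (other x₂ j ne₁ ne₂)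
      off : ∀ c → c ≢ x₂ → mid c ≡ g′ c
      off c h with c ≟ x₁
      ... | no h₁ = agree c h₁ h
      ... | yes refl = mem-ext _ (g′ c) at-x₁
        where
        at-x₁ : ∀ j → mem (put (g c) (suc j₁) v₁) j ≡ mem (g′ c) j
        at-x₁ j with j ≟ j₁ | j ≟ j₂
        ... | yes refl | _        = trans (mem-put (g c) j₁ v₁ j₁<n) (sym at₁)
        ... | no ne₁   | yes refl = trans (mem-put≢ (g c) j₁ v₁ j₂ ne₁) (off₂ c h)
        ... | no ne₁   | no ne₂   = trans (mem-put≢ (g c) j₁ v₁ j ne₁) (other c j ne₁ ne₂)

rowBox : ∀ {n} → Subset n → Vec ℕ n → ℕ → Subset n
rowBox E R c = box 0 c E R

box-≡ : ∀ {n} c (E E₁ : Subset n) (R R₁ : Vec ℕ n) k → (In E R k c → In E₁ R₁ k c) → (In E₁ R₁ k c → In E R k c)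
      → mem (rowBox E R c) k ≡ mem (rowBox E₁ R₁ c) k
box-≡ c E E₁ R R₁ k f g = bool-ext (λ h → box-mem c E₁ R₁ k (f (mem-box c E R k h))) (λ h → box-mem c E R k (g (mem-box c E₁ R₁ k h)))

module _ {n k} (E : Subset n) {R R₁ : Vec ℕ n} (f : FR k R R₁) (y : ℕ)
         (y-eq : y + bit (mem E (suc k)) ≡ cum R₁ (suc k)) where
  private
    b = cum R₁ (suc k)
    cum-k : cum R k ≡ cum R₁ k
    cum-k = FR-cum≢ f k (λ e → 1+n≢n (sym e))
    cum-k₂ : cum R (suc (suc k)) ≡ cum R₁ (suc (suc k))
    cum-k₂ = FR-cum≢ f (suc (suc k)) (λ ())

    before-k : mem (rowBox E R b) k ≡ true
    before-k = box-mem b E R k (≤-trans (≤-reflexive cum-k) (≤-trans (cum-mono₁ R₁ k) (m≤m+n b _)) , ≤-reflexive (sym (FR-cum f)))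
    after-k : mem (rowBox E R₁ b) k ≡ false
    after-k = box-nmem b E R₁ k (λ (_ , l) → <-irrefl refl l)
    before-k′ : mem (rowBox E R y) (suc k) ≡ false
    before-k′ = box-nmem y E R (suc k) (λ (l , _) → <-irrefl refl (≤-trans (≤-reflexive (sym (FR-cum f))) (≤-trans l (≤-reflexive y-eq))))
    after-k′ : mem (rowBox E R₁ y) (suc k) ≡ true
    after-k′ = box-mem y E R₁ (suc k) (≤-reflexive (sym y-eq)
      , ≤-trans (s≤s (≤-trans (m≤m+n y _) (≤-reflexive y-eq))) (≤-trans (≤-reflexive (sym (FR-cum f))) (≤-trans (cum-mono₁ R (suc k)) (≤-reflexive cum-k₂))))
    off-k : ∀ c → c ≢ b → mem (rowBox E R c) k ≡ mem (rowBox E R₁ c) k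
    off-k c ne = box-≡ c E E R R₁ k
      (λ (l , u) → subst (_≤ _) cum-k l , ≤∧≢⇒< (≤-pred (≤-trans u (≤-reflexive (FR-cum f)))) ne)
      (λ (l , u) → subst (_≤ _) (sym cum-k) l , ≤-trans u (≤-trans (n≤1+n b) (≤-reflexive (sym (FR-cum f)))))
    off-k′ : ∀ c → c ≢ y → mem (rowBox E R c) (suc k) ≡ mem (rowBox E R₁ c) (suc k)
    off-k′ c ne = box-≡ c E E R R₁ (suc k)
      (λ (l , u) → ≤-trans (n≤1+n b) (≤-trans (≤-reflexive (sym (FR-cum f))) l) , subst (c <_) cum-k₂ u)
      (λ (l , u) → ≤-trans (≤-reflexive (FR-cum f)) (≤∧≢⇒< l (λ e → ne (+-cancelʳ-≡ (bit (mem E (suc k))) c y (trans (sym e) (sym y-eq))))) , subst (c <_) (sym cum-k₂) u)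
    rest : ∀ c j → j ≢ k → j ≢ suc k → mem (rowBox E R c) j ≡ mem (rowBox E R₁ c) j
    rest c j ne ne′ = box-≡ c E E R R₁ j (λ (l , u) → subst (_≤ _) lo l , subst (c <_) hi u)
                                         (λ (l , u) → subst (_≤ _) (sym lo) l , subst (c <_) (sym hi) u)
      where
      lo = FR-cum≢ f j ne′
      hi = FR-cum≢ f (suc j) (λ e → ne (suc-injective e))

  -- The last k of the row leaves column b, and the range of k + 1 gains column y. If k + 1 is in E,
  -- that range starts one column before b, so two boxes change as in the second clause of the
  -- operators; otherwise y is b.
  FR-delta : Delta (rowBox E R) (rowBox E R₁) k b false (suc k) y true
  FR-delta = record { at₁ = after-k ; at₂ = after-k′ ; off₁ = off-k ; off₂ = off-k′ ; other = rest }

  FR-delta⁻¹ : Delta (rowBox E R₁) (rowBox E R) (suc k) y false k b true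
  FR-delta⁻¹ = record { at₁ = before-k′ ; at₂ = before-k ; off₁ = λ c ne → sym (off-k′ c ne) ; off₂ = λ c ne → sym (off-k c ne)
                      ; other = λ c j a b → sym (rest c j b a) }

module _ {n k} {E E₁ : Subset n} (R : Vec ℕ n) (f : FE k E E₁) (b : ℕ) (b-eq : suc b ≡ cum R (suc k)) (none : R ‼ k ≡ 0)
         (pos : suc b ≤ cum R (suc (suc k))) where
  private
    cum-k : cum R k ≡ suc b
    cum-k = trans (sym (+-identityʳ _)) (trans (cong (cum R k +_) (sym none)) (trans (sym (cum-suc R k)) (sym b-eq)))
    e₀ = proj₁ (FE-mem f)
    e₁ = proj₁ (proj₂ (FE-mem f))
    e₂ = proj₁ (proj₂ (proj₂ (FE-mem f)))
    e₃ = proj₂ (proj₂ (proj₂ (FE-mem f)))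

    before-k : mem (rowBox E R b) k ≡ true
    before-k = box-mem b E R k (subst (λ z → cum R k ≤ b + bit z) (sym e₀) (≤-reflexive (trans cum-k (+-comm 1 b))) , ≤-reflexive b-eq)
    after-k′ : mem (rowBox E₁ R b) (suc k) ≡ true
    after-k′ = box-mem b E₁ R (suc k) (subst (λ z → cum R (suc k) ≤ b + bit z) (sym e₃) (≤-reflexive (trans (sym b-eq) (+-comm 1 b))) , pos)
    no-k : ∀ (E : Subset n) c → mem E k ≡ false → ¬ In E R k c
    no-k E c h (l , u) = <⇒≱ u (≤-trans (≤-reflexive (trans (sym b-eq) (sym cum-k))) (≤-trans l (≤-reflexive (trans (cong (λ z → c + bit z) h) (+-identityʳ c)))))
    only-k : ∀ c → c ≢ b → mem (rowBox E R c) k ≡ false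
    only-k c ne = box-nmem c E R k (λ (l , u) → ne (≤-antisym (≤-pred (≤-trans u (≤-reflexive (sym b-eq))))
      (≤-pred (≤-trans (≤-reflexive (sym cum-k)) (≤-trans l (≤-reflexive (trans (cong (λ z → c + bit z) e₀) (+-comm c 1))))))))
    off-k : ∀ c → c ≢ b → mem (rowBox E R c) k ≡ mem (rowBox E₁ R c) k
    off-k c ne = trans (only-k c ne) (sym (box-nmem c E₁ R k (no-k E₁ c e₂)))
    off-k′ : ∀ c → c ≢ b → mem (rowBox E R c) (suc k) ≡ mem (rowBox E₁ R c) (suc k)
    off-k′ c ne = box-≡ c E E₁ R R (suc k)
      (λ (l , u) → ≤-trans l (+-monoʳ-≤ c (≤-trans (≤-reflexive (cong bit e₁)) z≤n)) , u)
      (λ (l , u) → subst (λ z → cum R (suc k) ≤ c + bit z) (sym e₁)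
        (subst (_≤ c + 0) b-eq (subst (suc b ≤_) (sym (+-identityʳ c)) (≤∧≢⇒< (≤-pred (≤-trans (≤-reflexive b-eq) (≤-trans l (≤-reflexive (trans (cong (λ z → c + bit z) e₃) (+-comm c 1)))))) (λ e → ne (sym e))))) , u)
    rest : ∀ c j → j ≢ k → j ≢ suc k → mem (rowBox E R c) j ≡ mem (rowBox E₁ R c) j
    rest c j ne ne′ = box-≡ c E E₁ R R j (λ (l , u) → subst (λ z → cum R j ≤ c + bit z) (FE-mem≢ f j ne ne′) l , u)
                                         (λ (l , u) → subst (λ z → cum R j ≤ c + bit z) (sym (FE-mem≢ f j ne ne′)) l , u)

  -- Without minima k, the last box with a minimum below k is also the last one with a minimum below
  -- k + 1, so the non-minimal letter changes within its box b.
  FE-delta : Delta (rowBox E R) (rowBox E₁ R) k b false (suc k) b true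
  FE-delta = record { at₁ = box-nmem b E₁ R k (no-k E₁ b e₂) ; at₂ = after-k′ ; off₁ = off-k ; off₂ = off-k′ ; other = rest }

  FE-delta⁻¹ : Delta (rowBox E₁ R) (rowBox E R) (suc k) b false k b true
  FE-delta⁻¹ = record
    { at₁ = box-nmem b E R (suc k) (λ (l , _) → <⇒≱ (≤-reflexive b-eq) (≤-trans l (≤-reflexive (trans (cong (λ z → b + bit z) e₁) (+-identityʳ b)))))
    ; at₂ = before-k ; off₁ = λ c ne → sym (off-k′ c ne) ; off₂ = λ c ne → sym (off-k c ne) ; other = λ c j a b → sym (rest c j b a) }

FR-exists : ∀ {n} k (R : Vec ℕ n) → suc k < n → 1 ≤ R ‼ k → ∃ λ R₁ → FR k R R₁
FR-exists zero    (suc x ∷ y ∷ R) l       h = _ , here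
FR-exists zero    (x ∷ [])        (s≤s ()) h
FR-exists (suc k) (x ∷ R)         (s≤s l) h with FR-exists k R l h
... | R₁ , f = _ , there f

FR-exists⁻¹ : ∀ {n} k (R : Vec ℕ n) → suc k < n → 1 ≤ R ‼ suc k → ∃ λ R₀ → FR k R₀ R
FR-exists⁻¹ zero    (x ∷ suc y ∷ R) l       h = _ , here
FR-exists⁻¹ zero    (x ∷ [])        (s≤s ()) h
FR-exists⁻¹ (suc k) (x ∷ R)         (s≤s l) h with FR-exists⁻¹ k R l h
... | R₁ , f = _ , there f

FE-exists : ∀ {n} k (E : Subset n) → suc k < n → mem E k ≡ true → mem E (suc k) ≡ false → ∃ λ E₁ → FE k E E₁
FE-exists zero    (true ∷ false ∷ E) l       h h′ = _ , here
FE-exists zero    (x ∷ [])        (s≤s ()) h h′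
FE-exists (suc k) (x ∷ E)            (s≤s l) h h′ with FE-exists k E l h h′
... | E₁ , f = _ , there f

FE-exists⁻¹ : ∀ {n} k (E : Subset n) → suc k < n → mem E k ≡ false → mem E (suc k) ≡ true → ∃ λ E₀ → FE k E₀ E
FE-exists⁻¹ zero    (false ∷ true ∷ E) l       h h′ = _ , here
FE-exists⁻¹ zero    (x ∷ [])        (s≤s ()) h h′
FE-exists⁻¹ (suc k) (x ∷ E)            (s≤s l) h h′ with FE-exists⁻¹ k E l h h′
... | E₁ , f = _ , there f

-- Column signs of one row

sig2-plus : ∀ a b → sig2 a b ≡ s⁺ → a ≡ true × b ≡ false
sig2-plus true  false e = refl , refl
sig2-plus true  true  ()
sig2-plus false true  ()
sig2-plus false false ()

sig2-minus : ∀ a b → sig2 a b ≡ s⁻ → a ≡ false × b ≡ true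
sig2-minus false true  e = refl , refl
sig2-minus true  true  ()
sig2-minus true  false ()
sig2-minus false false ()

colMem : ∀ {n} → List (DRow n) → ℕ → ℕ → Bool
colMem []            c j = false
colMem ((E , R) ∷ D) c j = mem (rowBox E R c) j ∨ colMem D c j

look : ∀ {n} (E : Subset n) R c j → maybe′ (λ S → has S (suc j)) false (at (decRow (E , R)) c) ≡ mem (rowBox E R c) j
look E R c j with c <? sum R
... | yes l rewrite at-applyUpTo (rowBox E R) (sum R) c l = has-mem (rowBox E R c) j
... | no  l rewrite at-≥ (decRow (E , R)) c (≤-trans (≤-reflexive (length-applyUpTo (rowBox E R) (sum R))) (≮⇒≥ l)) =
  sym (box-nmem c E R j (λ (_ , u) → l (≤-trans u (cum≤sum R (suc j)))))

colHas-dec : ∀ {n} (D : List (DRow n)) c j → colHas (dec D) c (suc j) ≡ colMem D c j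
colHas-dec []            c j = refl
colHas-dec ((E , R) ∷ D) c j = cong₂ _∨_ (look E R c j) (colHas-dec D c j)

colMem-hi : ∀ {n la} (D : List (DRow n)) j c → DValid la D → cum (topD D) (suc j) ≤ c → colMem D c j ≡ false
colMem-hi []            j c ok                h = refl
colMem-hi ((E , R) ∷ D) j c (_ , _ , cp , ok) h
  rewrite box-nmem c E R j (λ (_ , u) → <⇒≱ u h) =
  colMem-hi D j c ok (≤-trans (m+n≤o⇒m≤o _ (CompatFrom⇒Compat E R (topD D) cp j)) (≤-trans (cum-mono₁ R j) h))

fRes : ∀ {n} → Tableau n → ℕ → ℕ → ℕ → Tableau n
fRes T r c i = if boxHas T r (suc c) i
  then modify2 (modify2 T r (suc c) (λ S → put S i false)) r c (λ S → put S (suc i) true)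
  else modify2 T r c (λ S → put (put S i false) (suc i) true)

eRes : ∀ {n} → Tableau n → ℕ → ℕ → ℕ → Tableau n
eRes T r zero    i = modify2 T r zero (λ S → put (put S (suc i) false) i true)
eRes T r (suc c) i = if boxHas T r c (suc i)
  then modify2 (modify2 T r c (λ S → put S (suc i) false)) r (suc c) (λ S → put S i true)
  else modify2 T r (suc c) (λ S → put (put S (suc i) false) i true)

fRes-∷ : ∀ {n} row (T : Tableau n) r c i → fRes (row ∷ T) (suc r) c i ≡ row ∷ fRes T r c i
fRes-∷ row T r c i with boxHas T r (suc c) i
... | true  = refl
... | false = refl

eRes-∷ : ∀ {n} row (T : Tableau n) r c i → eRes (row ∷ T) (suc r) c i ≡ row ∷ eRes T r c i
eRes-∷ row T r zero    i = refl
eRes-∷ row T r (suc c) i with boxHas T r c (suc i)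
... | true  = refl
... | false = refl

-- `lo` and `hi` are the minimum and maximum of a and K, and k₀ is K ∸ a. When a is the first column
-- of k in a row and K the end of the letters k + 1 in the next row, the columns from `lo` to K are
-- those with k on top of k + 1.
record Meet (a K : ℕ) : Set where
  field
    lo k₀ hi : ℕ
    lo≤a  : lo ≤ a
    lo≤K  : lo ≤ K
    lo+k₀ : lo + k₀ ≡ K
    a+k₀  : a + k₀ ≡ hi
    K≤hi  : K ≤ hi
    hi-is : hi ≡ a ⊎ hi ≡ K
    above : ∀ c → lo ≤ c → c < K → a ≤ c
    below : ∀ c → K ≤ c → c < hi → c < a

meet : ∀ a K → Meet a K
meet a K with ≤-total a K
... | inj₁ a≤K = record { lo = a ; k₀ = K ∸ a ; hi = K ; lo≤a = ≤-refl ; lo≤K = a≤K ; lo+k₀ = m+[n∸m]≡n a≤K ; a+k₀ = m+[n∸m]≡n a≤K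
                        ; K≤hi = ≤-refl ; hi-is = inj₂ refl ; above = λ c h _ → h ; below = λ c h l → ⊥-elim (<⇒≱ l h) }
... | inj₂ K≤a = record { lo = K ; k₀ = 0 ; hi = a ; lo≤a = K≤a ; lo≤K = ≤-refl ; lo+k₀ = +-identityʳ K ; a+k₀ = +-identityʳ a
                        ; K≤hi = K≤a ; hi-is = inj₁ refl ; above = λ c h l → ⊥-elim (<⇒≱ l h) ; below = λ c _ l → l }

-- Of the letters k of a row, k₀ cancel against - from below, `bit f` share a column with a k + 1 of
-- the same row, and p give a +.
num-normal : ∀ e f r r′ k₀ p → bit e + r ≡ p + k₀ + bit f → (0 , k₀) ∙ ((bit e ∸ bit f , bit f ∸ bit e) ∙ (r , r′)) ≡ (p , r′)
num-normal e f r r′ k₀ p h = trans (cong ((0 , k₀) ∙_) (inner e f r h)) (cong₂ _,_ (m+n∸n≡m p k₀) (trans (cong (r′ +_) (m≤n⇒m∸n≡0 (m≤n+m k₀ p))) (+-identityʳ r′)))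
  where
  inner : ∀ e f r → bit e + r ≡ p + k₀ + bit f → (bit e ∸ bit f , bit f ∸ bit e) ∙ (r , r′) ≡ (p + k₀ , r′)
  inner true  true  r h = cong₂ _,_ (lin 3 (λ r p k₀ → # 1 :+ r := p :+ k₀ :+ # 1 :⇒ r := p :+ k₀) r p k₀ h) (trans (cong (r′ +_) (0∸n≡0 r)) (+-identityʳ r′))
  inner true  false r h = cong₂ _,_ (lin 3 (λ r p k₀ → # 1 :+ r := p :+ k₀ :+ # 0 :⇒ # 1 :+ r := p :+ k₀) r p k₀ h) (trans (cong (r′ +_) (0∸n≡0 r)) (+-identityʳ r′))
  inner false true  zero    h = ⊥-elim (lin 2 (λ p k₀ → # 0 := p :+ k₀ :+ # 1 :⇒ :⊥) p k₀ h)
  inner false true  (suc r) h = cong₂ _,_ (lin 3 (λ r p k₀ → # 1 :+ r := p :+ k₀ :+ # 1 :⇒ r := p :+ k₀) r p k₀ h) (trans (cong (r′ +_) (0∸n≡0 r)) (+-identityʳ r′))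
  inner false false r h = cong₂ _,_ (lin 3 (λ r p k₀ → r := p :+ k₀ :+ # 0 :⇒ r := p :+ k₀) r p k₀ h) (trans (cong (r′ +_) (0∸n≡0 r)) (+-identityʳ r′))

-- The last + of a row sits in R unless R has none.
act-R : ∀ e f m r → 1 ≤ r → suc m + bit f ≤ bit e + r → (bit f ∸ bit e) + (m ∸ (bit e ∸ bit f)) < r
act-R true  true  m       r       _ h = lin 2 (λ m r → # 1 :+ m :+ # 1 :≤ # 1 :+ r :⇒ m :< r) m r h
act-R true  false zero    r       l h = l
act-R true  false (suc m) r       _ h = lin 2 (λ m r → # 2 :+ m :+ # 0 :≤ # 1 :+ r :⇒ m :< r) m r h
act-R false true  m       r       _ h = lin 2 (λ m r → # 1 :+ m :+ # 1 :≤ r :⇒ # 1 :+ m :< r) m r h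
act-R false false m       r       _ h = lin 2 (λ m r → # 1 :+ m :+ # 0 :≤ r :⇒ m :< r) m r h

-- In this row k fills the columns from a up to B, and k + 1 those from B ∸ e′ up to C. In the next
-- row the letters up to k + 1, counted as minima, end before column K.
module Row {n} (k : ℕ) (E : Subset n) (R R₂ : Vec ℕ n) (cp : Compat E R R₂) where

  e e′ r r′ B C K a : ℕ
  e  = bit (mem E k)
  e′ = bit (mem E (suc k))
  r  = R ‼ k
  r′ = R ‼ suc k
  B  = cum R (suc k)
  C  = cum R (suc (suc k))
  K  = cum R₂ (suc (suc k))
  a  = cum R k ∸ e

  ρ : ℕ → Sig
  ρ c = sig2 (mem (rowBox E R c) k) (mem (rowBox E R c) (suc k))

  a+e : a + e ≡ cum R k
  a+e = m∸n+n≡m (compat-bit E R R₂ cp k)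

  a+e+r : a + e + r ≡ B
  a+e+r = trans (cong (_+ r) a+e) (sym (cum-suc R k))

  B+r′ : B + r′ ≡ C
  B+r′ = sym (cum-suc R (suc k))

  B≤C : B ≤ C
  B≤C = cum-mono₁ R (suc k)

  a≤B : a ≤ B
  a≤B = lin 4 (λ a e r B → a :+ e :+ r := B :⇒ a :≤ B) a e r B a+e+r

  K₀≤a : cum R₂ (suc k) ≤ a
  K₀≤a = lin 4 (λ K₀ a e ck → K₀ :+ e :≤ ck :⇒ a :+ e := ck :⇒ K₀ :≤ a) (cum R₂ (suc k)) a e (cum R k) (cp k) a+e

  K+e′≤B : K + e′ ≤ B
  K+e′≤B = cp (suc k)

  K≤B : K ≤ B
  K≤B = m+n≤o⇒m≤o K K+e′≤B

  in-k : ∀ c → a ≤ c → c < B → mem (rowBox E R c) k ≡ true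
  in-k c l u = box-mem c E R k (lin 4 (λ a c e ck → a :≤ c :⇒ a :+ e := ck :⇒ ck :≤ c :+ e) a c e (cum R k) l a+e , u)

  k-lo : ∀ c → c < a → mem (rowBox E R c) k ≡ false
  k-lo c l = box-nmem c E R k (λ (h , _) → lin 4 (λ a c e ck → ck :≤ c :+ e :⇒ a :+ e := ck :⇒ c :< a :⇒ :⊥) a c e (cum R k) h a+e l)

  k-hi : ∀ c → B ≤ c → mem (rowBox E R c) k ≡ false
  k-hi c l = box-nmem c E R k (λ (_ , u) → <⇒≱ u l)

  k-in : ∀ c → mem (rowBox E R c) k ≡ true → a ≤ c × c < B
  k-in c h with mem-box c E R k h
  ... | l , u = lin 4 (λ a c e ck → ck :≤ c :+ e :⇒ a :+ e := ck :⇒ a :≤ c) a c e (cum R k) l a+e , u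

  in-k′ : ∀ c → B ≤ c + e′ → c < C → mem (rowBox E R c) (suc k) ≡ true
  in-k′ c l u = box-mem c E R (suc k) (l , u)

  k′-lo : ∀ c → c + e′ < B → mem (rowBox E R c) (suc k) ≡ false
  k′-lo c l = box-nmem c E R (suc k) (λ (h , _) → <⇒≱ l h)

  k′-hi : ∀ c → C ≤ c → mem (rowBox E R c) (suc k) ≡ false
  k′-hi c l = box-nmem c E R (suc k) (λ (_ , u) → <⇒≱ u l)

  k′-in : ∀ c → mem (rowBox E R c) (suc k) ≡ true → B ≤ c + e′ × c < C
  k′-in c h = mem-box c E R (suc k) h

  open Meet (meet a K) public

  row-plus : ∀ m → hi ≤ m → m + e′ ≤ B → Pr ρ K m ≡ (m ∸ hi , 0)
  row-plus m h u = trans (Pr-split ρ K≤hi h) (trans (cong₂ _∙_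
    (Pr-ε ρ K hi (λ c x y → cong₂ sig2 (k-lo c (below c x y)) (k′-lo c (<-≤-trans (+-monoˡ-< e′ (<-≤-trans y h)) u))))
    (Pr-plus ρ hi m (λ c x y → cong₂ sig2 (in-k c (≤-trans (m+n≤o⇒m≤o a (≤-reflexive a+k₀)) x) (<-≤-trans y (m+n≤o⇒m≤o m u)))
                                          (k′-lo c (<-≤-trans (+-monoˡ-< e′ y) u)))))
    (∙-identityˡ _))

  row-both : ∀ m → hi ≤ m → m + e′ ≡ B → Pr ρ m B ≡ ε
  row-both m h u = Pr-ε ρ m B (λ c x y → cong₂ sig2 (in-k c (≤-trans (m+n≤o⇒m≤o a (≤-reflexive a+k₀)) (≤-trans h x)) y)
    (in-k′ c (≤-trans (≤-reflexive (sym u)) (+-monoˡ-≤ e′ x)) (<-≤-trans y B≤C)))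

  row-tail : ∀ N → C ≤ N → Pr ρ B N ≡ (0 , r′)
  row-tail N h = trans (Pr-split ρ B≤C h) (trans (cong₂ _∙_
    (Pr-minus ρ B C (λ c x y → cong₂ sig2 (k-hi c x) (in-k′ c (≤-trans x (m≤m+n c e′)) y)))
    (Pr-ε ρ C N (λ c x y → cong₂ sig2 (k-hi c (≤-trans B≤C x)) (k′-hi c x))))
    (trans (∙-identityʳ _) (cong (0 ,_) (trans (cong (_∸ B) (sym B+r′)) (m+n∸m≡n B r′)))))

  -- From column K on there is neither letter up to `hi`, then p columns with k alone, e′ columns
  -- with both letters, r′ columns with k + 1 alone, and nothing after C.
  row-normal : ∀ N → C ≤ N → ∀ p → p + hi + e′ ≡ B → Pr ρ K N ≡ (p , r′)
  row-normal N h p eq = begin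
    Pr ρ K N                                   ≡⟨ Pr-split ρ (≤-trans K≤hi (m≤n+m hi p)) (≤-trans p+hi≤B (≤-trans B≤C h)) ⟩
    Pr ρ K (p + hi) ∙ Pr ρ (p + hi) N          ≡⟨ cong₂ _∙_ (row-plus (p + hi) (m≤n+m hi p) (≤-reflexive eq)) (Pr-split ρ p+hi≤B (≤-trans B≤C h)) ⟩
    (p + hi ∸ hi , 0) ∙ (Pr ρ (p + hi) B ∙ Pr ρ B N) ≡⟨ cong₂ (λ x y → (x , 0) ∙ y) (m+n∸n≡m p hi) (cong₂ _∙_ (row-both (p + hi) (m≤n+m hi p) eq) (row-tail N h)) ⟩
    (p , 0) ∙ (ε ∙ (0 , r′))                   ≡⟨ cong ((p , 0) ∙_) (∙-identityˡ (0 , r′)) ⟩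
    (p , 0) ∙ (0 , r′)                         ≡⟨ cong₂ _,_ (+-identityʳ p) (+-identityʳ r′) ⟩
    (p , r′)                                   ∎
    where
    open ≡-Reasoning
    p+hi≤B : p + hi ≤ B
    p+hi≤B = m+n≤o⇒m≤o (p + hi) (≤-reflexive eq)

  -- The letter k is absent although k + 1 is a non-minimal entry.
  record Special : Set where
    field
      b     : ℕ
      b-eq  : suc b ≡ B
      a-eq  : a ≡ B
      e-0   : mem E k ≡ false
      e′-1  : mem E (suc k) ≡ true
      r-0   : r ≡ 0
      k₀-0  : k₀ ≡ 0
      K≤b   : K ≤ b

  special : mem E (suc k) ≡ true → B ≤ a → Special
  special h l = record
    { b = B ∸ 1 ; b-eq = m+[n∸m]≡n {1} 1≤B ; a-eq = ≤-antisym a≤B l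
    ; e-0 = noE (mem E k) (lin 4 (λ a e r B → a :+ e :+ r := B :⇒ B :≤ a :⇒ e :≤ # 0) a e r B a+e+r l)
    ; e′-1 = h ; r-0 = n≤0⇒n≡0 (lin 4 (λ a e r B → a :+ e :+ r := B :⇒ B :≤ a :⇒ r :≤ # 0) a e r B a+e+r l)
    ; k₀-0 = zero-k₀ hi-is ; K≤b = ≤-pred (≤-trans K<B (≤-reflexive (sym (m+[n∸m]≡n {1} 1≤B)))) }
    where
    K<B : K < B
    K<B = ≤-trans (≤-reflexive (trans (+-comm 1 K) (cong (λ z → K + bit z) (sym h)))) K+e′≤B
    1≤B : 1 ≤ B
    1≤B = ≤-trans (s≤s z≤n) K<B
    noE : ∀ b → bit b ≤ 0 → b ≡ false
    noE false _ = refl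
    zero-k₀ : hi ≡ a ⊎ hi ≡ K → k₀ ≡ 0
    zero-k₀ (inj₁ x) = +-cancelˡ-≡ a k₀ 0 (trans a+k₀ (trans x (sym (+-identityʳ a))))
    zero-k₀ (inj₂ x) = ⊥-elim (<⇒≱ (<-≤-trans K<B l) (≤-trans (m+n≤o⇒m≤o a (≤-reflexive a+k₀)) (≤-reflexive x)))

  k₀-sum : ∀ p → p + hi + e′ ≡ B → e + r ≡ p + k₀ + e′
  k₀-sum p eq = lin 8 (λ a e r B p hi e′ k₀ → a :+ e :+ r := B :⇒ p :+ hi :+ e′ := B :⇒ a :+ k₀ := hi :⇒ e :+ r := p :+ k₀ :+ e′)
                  a e r B p hi e′ k₀ a+e+r eq a+k₀

  -- A non-minimal k + 1 sits in column B ∸ 1. It is harmless if k is there as well, and that fails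
  -- only when the row has no k at all.
  normal? : (∃ λ p → p + hi + e′ ≡ B) ⊎ Special
  normal? with mem E (suc k) in eq
  ... | false = inj₁ (B ∸ hi , trans (+-identityʳ _) (m∸n+n≡m (hi≤B hi-is)))
    where
    hi≤B : hi ≡ a ⊎ hi ≡ K → hi ≤ B
    hi≤B (inj₁ x) = ≤-trans (≤-reflexive x) a≤B
    hi≤B (inj₂ x) = ≤-trans (≤-reflexive x) K≤B
  ... | true with a <? B
  ...   | no  h = inj₂ (special eq (≮⇒≥ h))
  ...   | yes h = inj₁ (B ∸ suc hi , trans (+-assoc _ hi 1) (trans (cong (B ∸ suc hi +_) (+-comm hi 1)) (m∸n+n≡m (hi<B hi-is))))
    where
    hi<B : hi ≡ a ⊎ hi ≡ K → hi < B
    hi<B (inj₁ x) = ≤-trans (s≤s (≤-reflexive x)) h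
    hi<B (inj₂ x) = ≤-trans (s≤s (≤-reflexive x)) (≤-trans (≤-reflexive (trans (+-comm 1 K) (cong (λ z → K + bit z) (sym eq)))) K+e′≤B)

  row-special : ∀ N → C ≤ N → (s : Special) → Pr ρ K N ≡ (0 , suc r′)
  row-special N h s = trans (Pr-split ρ K≤b (≤-trans b≤B (≤-trans B≤C h))) (trans (cong₂ _∙_
      (Pr-ε ρ K b (λ c x y → cong₂ sig2 (no-k c) (k′-lo c (subst (_≤ B) (cong suc (trans (+-comm 1 c) (cong (λ z → c + bit z) (sym e′-1)))) (≤-trans (s≤s y) (≤-reflexive b-eq))))))
      (trans (Pr-split ρ b≤B (≤-trans B≤C h)) (cong₂ _∙_ (trans (cong (Pr ρ b) (sym b-eq)) (trans (Pr-one ρ b) (cong₂ sig2 (no-k b) (in-k′ b (≤-reflexive (trans (sym b-eq) (trans (+-comm 1 b) (cong (λ z → b + bit z) (sym e′-1))))) (≤-trans (≤-reflexive b-eq) B≤C))))) (row-tail N h))))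
      (cong₂ _,_ refl (trans (+-identityʳ _) (+-comm r′ 1))))
    where
    open Special s
    b≤B : b ≤ B
    b≤B = ≤-trans (n≤1+n b) (≤-reflexive b-eq)
    no-k : ∀ c → mem (rowBox E R c) k ≡ false
    no-k c with c <? B
    ... | yes l = k-lo c (<-≤-trans l (≤-reflexive (sym a-eq)))
    ... | no  l = k-hi c (≮⇒≥ l)

  -- The factor (0 , k₀) stands for the - that the rows below show in the columns from `lo` to K. As
  -- column signs these vanish, because a k stands on top of each k + 1; in the reading word the
  -- same - cancel k₀ of the + of this row.
  row-sig : ∀ N → C ≤ N → (0 , k₀) ∙ (sigE k E ∙ sigR k R) ≡ Pr ρ K N
  row-sig N h with normal?
  ... | inj₁ (p , eq) = trans (num-normal (mem E k) (mem E (suc k)) r r′ k₀ p (k₀-sum p eq)) (sym (row-normal N h p eq))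
  ... | inj₂ s = trans (cong₂ (λ x y → (0 , x) ∙ (y ∙ sigR k R)) k₀-0 (cong₂ (λ x y → bit x ∸ bit y , bit y ∸ bit x) e-0 e′-1))
                       (trans (cong (λ z → (0 , 0) ∙ ((0 , 1) ∙ (z , r′))) r-0) (trans count (sym (row-special N h s))))
    where
    open Special s
    count : (0 , 0) ∙ ((0 , 1) ∙ (0 , r′)) ≡ (0 , suc r′)
    count = cong (0 ,_) (trans (+-identityʳ _) (+-comm r′ 1))

-- Column signs of a tableau

colSig : ∀ {n} → ℕ → List (DRow n) → ℕ → Sig
colSig k D c = sig2 (colMem D c k) (colMem D c (suc k))

M-∙ : ∀ s t → M t ≤ M (s ∙ t)
M-∙ s t = m≤m+n (M t) _

M-right : ∀ s t → M (s ∙ t) ≡ 0 → M t ≡ 0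
M-right s t h = n≤0⇒n≡0 (≤-trans (M-∙ s t) (≤-reflexive h))

P-left : ∀ s t → P (s ∙ t) ≡ 0 → P s ≡ 0
P-left s t h = m+n≡0⇒m≡0 (P s) h

P-right : ∀ s t → P (s ∙ t) ≡ 0 → P t ≤ M s
P-right s t h = m∸n≡0⇒m≤n (m+n≡0⇒n≡0 (P s) h)

FPlus FMinus : ∀ {n} → ℕ → List (DRow n) → ℕ → Set
FPlus  k D c = ∃ λ D′ → ∃ λ r → findRow (dec D) c (suc k) ≡ just r × fRes (dec D) r c (suc k) ≡ dec D′ × FD k D D′
FMinus k D c = ∃ λ D′ → ∃ λ r → findRow (dec D) c (suc (suc k)) ≡ just r × eRes (dec D) r c (suc k) ≡ dec D′ × FD k D′ D

FSign : Sign → ∀ {n} → ℕ → List (DRow n) → ℕ → Set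
FSign plus  = FPlus
FSign minus = FMinus

sum-C : ∀ {n} (R : Vec ℕ n) k {N} → sum R ≤ N → cum R k ≤ N
sum-C R k h = ≤-trans (cum≤sum R k) h

-- The columns split at lo and K: left of lo the row (E , R) has neither
-- letter; between lo and K it has a k on top of a k + 1, and the two signs
-- cancel; from K on the rows below have neither letter.
module Step {n k} (k<n : suc k < n) {la} (E : Subset n) (R : Vec ℕ n) (D : List (DRow n)) (ok : DValid la D)
            (cp : Compat E R (topD D)) (N : ℕ) (R≤N : sum R ≤ N) where

  open Row k E R (topD D) cp

  private
    D⁺ : List (DRow n)
    D⁺ = (E , R) ∷ D
    C≤N : C ≤ N
    C≤N = sum-C R (suc (suc k)) R≤N
    K≤N : K ≤ N
    K≤N = ≤-trans K≤B (≤-trans B≤C C≤N)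

  low-part : ∀ c → c < lo → colSig k D⁺ c ≡ colSig k D c
  low-part c h rewrite k-lo c (<-≤-trans h lo≤a) | k′-lo c (<-≤-trans (+-monoˡ-< e′ (<-≤-trans h lo≤K)) K+e′≤B) = refl

  colMem-k : ∀ c → a ≤ c → colMem D c k ≡ false
  colMem-k c h = colMem-hi D k c ok (≤-trans K₀≤a h)

  second-row : ∀ (D : List (DRow n)) c → cum (topD D) (suc k) ≤ c → c < cum (topD D) (suc (suc k)) → colMem D c (suc k) ≡ true
  second-row []              c l u = ⊥-elim (<⇒≱ u (≤-trans (≤-reflexive (cum-zeros n (suc (suc k)))) z≤n))
  second-row ((E₂ , R₂) ∷ D) c l u rewrite box-mem c E₂ R₂ (suc k) (≤-trans l (m≤m+n c _) , u) = refl

  colMem-k′ : ∀ c → lo ≤ c → c < K → colMem D c (suc k) ≡ true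
  colMem-k′ c l u = second-row D c (≤-trans K₀≤a (above c l u)) u

  mid-part : ∀ c → lo ≤ c → c < K → colSig k D⁺ c ≡ ε
  mid-part c l u rewrite in-k c (above c l u) (<-≤-trans u K≤B) | colMem-k′ c l u with mem (rowBox E R c) (suc k)
  ... | true  = refl
  ... | false = refl

  D-mid : ∀ c → lo ≤ c → c < K → colSig k D c ≡ s⁻
  D-mid c l u rewrite colMem-k c (above c l u) | colMem-k′ c l u = refl

  D-high-k : ∀ c → K ≤ c → colMem D c k ≡ false × colMem D c (suc k) ≡ false
  D-high-k c h = colMem-hi D k c ok (≤-trans (cum-mono₁ (topD D) (suc k)) h) , colMem-hi D (suc k) c ok h

  D-high : ∀ c → K ≤ c → colSig k D c ≡ ε
  D-high c h rewrite proj₁ (D-high-k c h) | proj₂ (D-high-k c h) = refl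

  high-part : ∀ c → K ≤ c → colSig k D⁺ c ≡ ρ c
  high-part c h rewrite proj₁ (D-high-k c h) | proj₂ (D-high-k c h)
    with mem (rowBox E R c) k | mem (rowBox E R c) (suc k)
  ... | true  | true  = refl
  ... | true  | false = refl
  ... | false | true  = refl
  ... | false | false = refl

  K∸lo : K ∸ lo ≡ k₀
  K∸lo = trans (cong (_∸ lo) (sym lo+k₀)) (m+n∸m≡n lo k₀)

  D-tail : ∀ c → c ≤ lo → Pr (colSig k D) c N ≡ Pr (colSig k D) c lo ∙ (0 , k₀)
  D-tail c h = trans (Pr-split (colSig k D) h (≤-trans lo≤K K≤N)) (cong (Pr (colSig k D) c lo ∙_)
    (trans (Pr-split (colSig k D) lo≤K K≤N) (trans (cong₂ _∙_ (Pr-minus (colSig k D) lo K D-mid) (Pr-ε (colSig k D) K N (λ c x _ → D-high c x)))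
      (trans (∙-identityʳ _) (cong (0 ,_) K∸lo)))))

  tail : ∀ c m → c ≤ lo → K ≤ m → Pr (colSig k D⁺) c m ≡ Pr (colSig k D) c lo ∙ Pr ρ K m
  tail c m h l = trans (Pr-split (colSig k D⁺) h (≤-trans lo≤K l)) (cong₂ _∙_
    (Pr-cong (colSig k D⁺) (colSig k D) c lo (λ c _ u → low-part c u))
    (trans (Pr-split (colSig k D⁺) lo≤K l) (trans (cong₂ _∙_ (Pr-ε (colSig k D⁺) lo K mid-part) (Pr-cong (colSig k D⁺) ρ K m (λ c x _ → high-part c x)))
      (∙-identityˡ _))))

  x : Sig
  x = Pr (colSig k D) 0 lo

  sig-step : Pr (colSig k D) 0 N ≡ sigD k D → Pr (colSig k D⁺) 0 N ≡ sigD k D⁺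
  sig-step ih = begin
    Pr (colSig k D⁺) 0 N                    ≡⟨ tail 0 N z≤n K≤N ⟩
    x ∙ Pr ρ K N                        ≡⟨ cong (x ∙_) (sym (row-sig N C≤N)) ⟩
    x ∙ ((0 , k₀) ∙ (sigE k E ∙ sigR k R))  ≡⟨ sym (∙-assoc x (0 , k₀) (sigE k E ∙ sigR k R)) ⟩
    x ∙ (0 , k₀) ∙ (sigE k E ∙ sigR k R)    ≡⟨ cong (_∙ (sigE k E ∙ sigR k R)) (trans (sym (D-tail 0 z≤n)) ih) ⟩
    sigD k D ∙ (sigE k E ∙ sigR k R)          ≡⟨ sym (∙-assoc (sigD k D) (sigE k E) (sigR k R)) ⟩
    sigD k D ∙ sigE k E ∙ sigR k R            ∎
    where open ≡-Reasoning

  module _ (ih : Pr (colSig k D) 0 N ≡ sigD k D) where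

    M-D : M (sigD k D) ≡ k₀ + M x
    M-D = cong M (trans (sym ih) (D-tail 0 z≤n))

    -- An acting column left of lo belongs to the lower rows.
    lower : ∀ c → c < lo → P (Pr (colSig k D⁺) (suc c) N) ≡ 0
          → P (Pr (colSig k D) (suc c) N) ≡ 0 × P (sigE k E ∙ sigR k R) + M (colSig k D c) ≤ M (sigD k D)
    lower c h p = trans (cong P (D-tail (suc c) h)) (trans (cong (P w +_) (0∸n≡0 (M w))) (trans (+-identityʳ _) Pw)) ,
      lin 6 (λ ps f md k₀ py mw → ps :≤ k₀ :+ py :⇒ py :≤ mw :⇒ k₀ :+ (mw :+ f) :≤ md :⇒ ps :+ f :≤ md)
        (P (sigE k E ∙ sigR k R)) (M (colSig k D c)) (M (sigD k D)) k₀ (P (Pr ρ K N)) (M w)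
        (≤-trans (m≤n+m∸n _ k₀) (≤-reflexive (cong (λ s → k₀ + P s) (row-sig N C≤N)))) (P-right w (Pr ρ K N) p′) big
      where
      w = Pr (colSig k D) (suc c) lo
      p′ : P (w ∙ Pr ρ K N) ≡ 0
      p′ = trans (cong P (sym (tail (suc c) N h K≤N))) p
      Pw : P w ≡ 0
      Pw = P-left w (Pr ρ K N) p′
      big : k₀ + (M w + M (colSig k D c)) ≤ M (sigD k D)
      big = ≤-trans (+-monoʳ-≤ k₀ (≤-trans (≤-reflexive (cong (λ z → M w + (M (colSig k D c) ∸ z)) (sym Pw)))
              (≤-trans (M-∙ (Pr (colSig k D) 0 c) (colSig k D c ∙ w))
                (≤-reflexive (cong M (trans (cong (Pr (colSig k D) 0 c ∙_) (sym (Pr-head (colSig k D) h))) (sym (Pr-split (colSig k D) z≤n (<⇒≤ h)))))))))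
              (≤-reflexive (sym M-D))

    lower-prefix : ∀ c → c < lo → Pr (colSig k D⁺) 0 c ≡ Pr (colSig k D) 0 c
    lower-prefix c h = Pr-cong (colSig k D⁺) (colSig k D) 0 c (λ d _ u → low-part d (<-trans u h))

    not-here : ∀ c → c < lo → ∀ j → j ≡ k ⊎ j ≡ suc k → maybe′ (λ S → has S (suc j)) false (at (decRow (E , R)) c) ≡ false
    not-here c h j (inj₁ refl) = trans (look E R c k) (k-lo c (<-≤-trans h lo≤a))
    not-here c h j (inj₂ refl) = trans (look E R c (suc k)) (k′-lo c (<-≤-trans (+-monoˡ-< e′ (<-≤-trans h lo≤K)) K+e′≤B))

    lower-plus : ∀ c → c < lo → P (sigE k E ∙ sigR k R) + M (colSig k D c) ≤ M (sigD k D) → FPlus k D c → FPlus k D⁺ c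
    lower-plus c h cond (D′ , r , fr , res , f) = (E , R) ∷ D′ , suc r , find , trans (fRes-∷ (decRow (E , R)) (dec D) r c (suc k)) (cong (decRow (E , R) ∷_) res)
      , Ten-assocˡ (sigD k D) (sigE k E) (sigR k R) (inj₂ (f , refl , m+n≤o⇒m≤o _ cond))
      where
      find : findRow (dec D⁺) c (suc k) ≡ just (suc r)
      find rewrite not-here c h k (inj₁ refl) | fr = refl

    lower-minus : ∀ c → c < lo → colSig k D c ≡ s⁻ → P (sigE k E ∙ sigR k R) + M (colSig k D c) ≤ M (sigD k D) → FMinus k D c → FMinus k D⁺ c
    lower-minus c h s cond (D′ , r , fr , res , f) = (E , R) ∷ D′ , suc r , find , trans (eRes-∷ (decRow (E , R)) (dec D) r c (suc k)) (cong (decRow (E , R) ∷_) res)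
      , Ten-assocˡ (sigD k D′) (sigE k E) (sigR k R) (inj₂ (f , refl
          , lin 4 (λ p f m m′ → p :+ f :≤ m :⇒ f := # 1 :⇒ m := # 1 :+ m′ :⇒ p :≤ m′) (P (sigE k E ∙ sigR k R)) (M (colSig k D c)) (M (sigD k D)) (M (sigD k D′)) cond (cong M s) (proj₂ (FD-moves k D′ D f))))
      where
      find : findRow (dec D⁺) c (suc (suc k)) ≡ just (suc r)
      find rewrite not-here c h (suc k) (inj₂ refl) | fr = refl

    prefix-K : ∀ c → K ≤ c → M (Pr (colSig k D⁺) 0 c) ≡ 0 → M (x ∙ Pr ρ K c) ≡ 0
    prefix-K c h m = trans (cong M (sym (tail 0 c z≤n h))) m

    Mx-bound : ∀ c y → Pr ρ K c ≡ (y , 0) → M (x ∙ Pr ρ K c) ≡ 0 → M x ≤ y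
    Mx-bound c y eq m = m∸n≡0⇒m≤n (trans (cong (λ s → M (x ∙ s)) (sym eq)) m)

    cond-R : ∀ s → 1 ≤ s → suc (M x) + k₀ + e′ ≤ e + s → M (sigD k D ∙ sigE k E) < s
    cond-R s l h = subst (λ m → (e′ ∸ e) + (m ∸ (e ∸ e′)) < s) (sym M-D)
      (act-R (mem E k) (mem E (suc k)) (k₀ + M x) s l
        (lin 5 (λ mx k₀ e′ e s → # 1 :+ mx :+ k₀ :+ e′ :≤ e :+ s :⇒ # 1 :+ (k₀ :+ mx) :+ e′ :≤ e :+ s) (M x) k₀ e′ e s h))

    found : ∀ c j → mem (rowBox E R c) j ≡ true → findRow (dec D⁺) c (suc j) ≡ just 0
    found c j h rewrite look E R c j | h = refl

    same-length : ∀ {E₁ : Subset n} {R₁ : Vec ℕ n} → sum R ≡ sum R₁ → applyUpTo (rowBox E₁ R₁) (sum R) ≡ decRow (E₁ , R₁)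
    same-length {E₁} {R₁} e = cong (applyUpTo (rowBox E₁ R₁)) e

    k≢ : k ≢ suc k
    k≢ e = 1+n≢n (sym e)

    fRes-one : ∀ c (E₁ : Subset n) R₁ → sum R ≡ sum R₁ → mem (rowBox E R (suc c)) k ≡ false
             → Delta (rowBox E R) (rowBox E₁ R₁) k c false (suc k) c true → fRes (dec D⁺) 0 c (suc k) ≡ dec ((E₁ , R₁) ∷ D)
    fRes-one c E₁ R₁ es off δ rewrite look E R (suc c) k | off =
      cong (_∷ dec D) (trans (delta-one δ (<-trans (n<1+n k) k<n) k<n k≢ (sum R) refl) (same-length es))

    fRes-two : ∀ c (E₁ : Subset n) R₁ → sum R ≡ sum R₁ → mem (rowBox E R (suc c)) k ≡ true
             → Delta (rowBox E R) (rowBox E₁ R₁) k (suc c) false (suc k) c true → fRes (dec D⁺) 0 c (suc k) ≡ dec ((E₁ , R₁) ∷ D)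
    fRes-two c E₁ R₁ es on δ rewrite look E R (suc c) k | on =
      cong (_∷ dec D) (trans (delta-two δ (<-trans (n<1+n k) k<n) k<n k≢ (sum R) 1+n≢n) (same-length es))

    eRes-one : ∀ c (E₁ : Subset n) R₁ → sum R ≡ sum R₁ → (∀ d → c ≡ suc d → mem (rowBox E R d) (suc k) ≡ false)
             → Delta (rowBox E R) (rowBox E₁ R₁) (suc k) c false k c true → eRes (dec D⁺) 0 c (suc k) ≡ dec ((E₁ , R₁) ∷ D)
    eRes-one zero E₁ R₁ es off δ = cong (_∷ dec D) (trans (delta-one δ k<n (<-trans (n<1+n k) k<n) 1+n≢n (sum R) refl) (same-length es))
    eRes-one (suc c) E₁ R₁ es off δ rewrite look E R c (suc k) | off c refl =
      cong (_∷ dec D) (trans (delta-one δ k<n (<-trans (n<1+n k) k<n) 1+n≢n (sum R) refl) (same-length es))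

    eRes-two : ∀ c (E₁ : Subset n) R₁ → sum R ≡ sum R₁ → mem (rowBox E R c) (suc k) ≡ true
             → Delta (rowBox E R) (rowBox E₁ R₁) (suc k) c false k (suc c) true → eRes (dec D⁺) 0 (suc c) (suc k) ≡ dec ((E₁ , R₁) ∷ D)
    eRes-two c E₁ R₁ es on δ rewrite look E R c (suc k) | on =
      cong (_∷ dec D) (trans (delta-two δ k<n (<-trans (n<1+n k) k<n) 1+n≢n (sum R) (λ e → 1+n≢n (sym e))) (same-length es))

    -- No + may follow in column c + 1, and this pins down c by `end`. No - survives before c, so
    -- the c ∸ hi columns with + before it absorb every - of x; `room` restates this as the
    -- inequality of the tensor product rule.
    row-acts-plus : ∀ c → K ≤ c → c < N → ρ c ≡ s⁺ → M (Pr (colSig k D⁺) 0 c) ≡ 0 → P (Pr (colSig k D⁺) (suc c) N) ≡ 0 → FPlus k D⁺ c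
    row-acts-plus c K≤c c<N s m p = act (1 ≤? r)
      where
      hk = proj₁ (sig2-plus _ _ s)
      a≤c = proj₁ (k-in c hk)
      c<B = proj₂ (k-in c hk)
      c+e′<B : c + e′ < B
      c+e′<B = ≰⇒> (λ h → contra (trans (sym (in-k′ c h (<-≤-trans c<B B≤C))) (proj₂ (sig2-plus _ _ s))))
        where
        contra : true ≢ false
        contra ()
      hi≤c : hi ≤ c
      hi≤c with hi-is
      ... | inj₁ q = subst (_≤ c) (sym q) a≤c
      ... | inj₂ q = subst (_≤ c) (sym q) K≤c
      last : ¬ (suc c + e′ < B)
      last h = 1≢0 (trans (sym (cong P next)) (P-left (colSig k D⁺ (suc c)) (Pr (colSig k D⁺) (suc (suc c)) N) (trans (cong P (sym (Pr-head (colSig k D⁺) sc<N))) p)))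
        where
        sc<B : suc c < B
        sc<B = ≤-trans (s≤s (m≤m+n (suc c) e′)) h
        sc<N : suc c < N
        sc<N = <-≤-trans sc<B (≤-trans B≤C C≤N)
        next : colSig k D⁺ (suc c) ≡ s⁺
        next = trans (high-part (suc c) (m≤n⇒m≤1+n K≤c)) (cong₂ sig2 (in-k (suc c) (m≤n⇒m≤1+n a≤c) sc<B) (k′-lo (suc c) h))
        1≢0 : 1 ≢ 0
        1≢0 ()
      end : suc c + e′ ≡ B
      end = ≤-antisym c+e′<B (≮⇒≥ last)
      Mx≤ : M x ≤ c ∸ hi
      Mx≤ = Mx-bound c (c ∸ hi) (row-plus c hi≤c (<⇒≤ c+e′<B)) (prefix-K c K≤c m)
      room : suc (M x) + k₀ + e′ ≤ e + r
      room = lin 11 (λ mx k₀ e′ e r a hi B c d z → mx :≤ d :⇒ d :+ hi := c :⇒ a :+ k₀ := hi :⇒ # 1 :+ c :+ e′ := B :⇒ a :+ e :+ r := B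
                  :⇒ # 1 :+ mx :+ k₀ :+ e′ :≤ e :+ r)
               (M x) k₀ e′ e r a hi B c (c ∸ hi) 0 Mx≤ (m∸n+n≡m hi≤c) a+k₀ end a+e+r
      act : _ → FPlus k D⁺ c
      act (yes 1≤r) with FR-exists k R k<n 1≤r
      ... | R₁ , f = (E , R₁) ∷ D , 0 , found c k hk , update (mem E (suc k)) refl , inj₁ (f , refl , cond-R r 1≤r room)
        where
        b-eq : c + e′ ≡ cum R₁ (suc k)
        b-eq = suc-injective (trans end (FR-cum f))
        update : ∀ b → mem E (suc k) ≡ b → fRes (dec D⁺) 0 c (suc k) ≡ dec ((E , R₁) ∷ D)
        update false q = fRes-one c E R₁ (FR-sum f) (k-hi (suc c) (≤-reflexive (trans (sym end) (trans (cong (λ z → suc c + bit z) q) (+-identityʳ _)))))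
          (subst (λ z → Delta (rowBox E R) (rowBox E R₁) k z false (suc k) c true) (trans (sym b-eq) (trans (cong (λ z → c + bit z) q) (+-identityʳ c))) (FR-delta E f c b-eq))
        update true q = fRes-two c E R₁ (FR-sum f) (in-k (suc c) (m≤n⇒m≤1+n a≤c) (≤-reflexive (trans (sym (trans (cong (λ z → suc c + bit z) q) (+-comm (suc c) 1))) end)))
          (subst (λ z → Delta (rowBox E R) (rowBox E R₁) k z false (suc k) c true) (trans (sym b-eq) (trans (cong (λ z → c + bit z) q) (+-comm c 1))) (FR-delta E f c b-eq))
      -- R has no k, so the acting letter is the non-minimal one. Then `room` leaves space neither
      -- for k + 1 in E nor for a - from below, and the letter changes within E.
      act (no ¬r) = col (mem E k) (mem E (suc k)) refl refl
        where
        r-0 : r ≡ 0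
        r-0 = n<1⇒n≡0 (≰⇒> ¬r)
        col : ∀ b b′ → mem E k ≡ b → mem E (suc k) ≡ b′ → FPlus k D⁺ c
        col false b′ q q′ = ⊥-elim (lin 6 (λ mx k₀ e′ e r z → # 1 :+ mx :+ k₀ :+ e′ :≤ e :+ r :⇒ e := # 0 :⇒ r := # 0 :⇒ :⊥) (M x) k₀ e′ e r 0 room (cong bit q) r-0)
        col true true q q′ = ⊥-elim (lin 6 (λ mx k₀ e′ e r z → # 1 :+ mx :+ k₀ :+ e′ :≤ e :+ r :⇒ e := # 1 :⇒ e′ := # 1 :⇒ r := # 0 :⇒ :⊥) (M x) k₀ e′ e r 0 room (cong bit q) (cong bit q′) r-0)
        col true false q q′ with FE-exists k E k<n q q′
        ... | E₁ , f = (E₁ , R) ∷ D , 0 , found c k hk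
          , fRes-one c E₁ R refl (k-hi (suc c) (≤-reflexive (sym sc≡B))) (FE-delta R f c sc≡B r-0 (≤-trans (≤-reflexive sc≡B) B≤C))
          , inj₂ (inj₁ (f , refl , subst₂ _<_ (sym M-0) (sym (P-E f)) (s≤s z≤n)) , refl , ≤-trans (≤-reflexive r-0) z≤n)
          where
          sc≡B : suc c ≡ B
          sc≡B = trans (sym (trans (cong (λ z → suc c + bit z) q′) (+-identityʳ _))) end
          M-0 : M (sigD k D) ≡ 0
          M-0 = trans M-D (n≤0⇒n≡0 (lin 6 (λ mx k₀ e′ e r z → # 1 :+ mx :+ k₀ :+ e′ :≤ e :+ r :⇒ e := # 1 :⇒ r := # 0 :⇒ k₀ :+ mx :≤ # 0) (M x) k₀ e′ e r 0 room (cong bit q) r-0))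

module Minus {n k} (k<n : suc k < n) {la} (E : Subset n) (R : Vec ℕ n) (D : List (DRow n)) (ok : DValid la D)
             (cp : Compat E R (topD D)) (N : ℕ) (R≤N : sum R ≤ N) (ih : Pr (colSig k D) 0 N ≡ sigD k D) where

  open Row k E R (topD D) cp
  open Step k<n E R D ok cp N R≤N

  private
    D⁺ : List (DRow n)
    D⁺ = (E , R) ∷ D

  -- The column before c, if it is not before K, cannot carry a - too. This leaves the first column
  -- B of the minima k + 1, where R changes, or column B ∸ 1 of a non-minimal k + 1 without k, where
  -- E changes.
  row-acts-minus : ∀ c → K ≤ c → ρ c ≡ s⁻ → M (Pr (colSig k D⁺) 0 c) ≡ 0 → FMinus k D⁺ c
  row-acts-minus c K≤c s m = act (B ≤? c)
    where
    hk : mem (rowBox E R c) k ≡ false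
    hk = proj₁ (sig2-minus _ _ s)
    hk′ : mem (rowBox E R c) (suc k) ≡ true
    hk′ = proj₂ (sig2-minus _ _ s)
    B≤c+e′ : B ≤ c + e′
    B≤c+e′ = proj₁ (k′-in c hk′)
    c<C : c < C
    c<C = proj₂ (k′-in c hk′)
    m′ : M (x ∙ Pr ρ K c) ≡ 0
    m′ = prefix-K ih c K≤c m
    quiet : ∀ d → K ≤ d → suc d ≡ c → ρ d ≢ s⁻
    quiet d K≤d refl sd = 1≢0 (trans (sym (cong M sd)) (M-right (Pr ρ K d) (ρ d)
      (trans (cong M (trans (cong (Pr ρ K d ∙_) (sym (Pr-one ρ d))) (sym (Pr-split ρ K≤d (n≤1+n d))))) (M-right x (Pr ρ K c) m′))))
      where
      1≢0 : 1 ≢ 0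
      1≢0 ()
    act : _ → FMinus k D⁺ c
    act (yes B≤c) = here-or normal?
      where
      c≡B : c ≡ B
      c≡B with m≤n⇒m<n∨m≡n B≤c
      ... | inj₂ q = sym q
      ... | inj₁ B<c = ⊥-elim (quiet (c ∸ 1) (≤-trans K≤B B≤d) sd
          (cong₂ sig2 (k-hi (c ∸ 1) B≤d) (in-k′ (c ∸ 1) (≤-trans B≤d (m≤m+n (c ∸ 1) e′)) (<-trans (≤-reflexive sd) c<C))))
        where
        sd : suc (c ∸ 1) ≡ c
        sd = m+[n∸m]≡n {1} (≤-trans (s≤s z≤n) B<c)
        B≤d : B ≤ c ∸ 1
        B≤d = ≤-pred (≤-trans B<c (≤-reflexive (sym sd)))
      here-or : _ → FMinus k D⁺ c
      -- In the special case column B ∸ 1 already carries a -, so the first one cannot be at B.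
      here-or (inj₂ sp) = ⊥-elim (quiet b K≤b (trans b-eq (sym c≡B))
          (cong₂ sig2 (k-lo b (≤-trans (≤-reflexive b-eq) (≤-reflexive (sym a-eq))))
            (in-k′ b (≤-reflexive (trans (sym b-eq) (trans (+-comm 1 b) (cong (λ z → b + bit z) (sym e′-1))))) (≤-trans (≤-reflexive b-eq) B≤C))))
        where open Special sp
      here-or (inj₁ (p , eq)) with FR-exists⁻¹ k R k<n
          (lin 4 (λ B C r c → c := B :⇒ B :+ r := C :⇒ c :< C :⇒ # 1 :≤ r) B C r′ c c≡B B+r′ c<C)
      ... | R₀ , f = (E , R₀) ∷ D , 0 , found ih c (suc k) hk′ , update (mem E (suc k)) refl
                   , inj₁ (f , refl , subst (M (sigD k D ∙ sigE k E) <_) (sym (proj₁ (FR-moves f))) (cond-R ih (suc r) (s≤s z≤n) room))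
        where
        p+hi≤B : p + hi ≤ B
        p+hi≤B = m+n≤o⇒m≤o (p + hi) (≤-reflexive eq)
        prefix : Pr ρ K c ≡ (p , 0)
        prefix = trans (cong (Pr ρ K) c≡B) (trans (Pr-split ρ (≤-trans K≤hi (m≤n+m hi p)) p+hi≤B)
          (trans (cong₂ _∙_ (row-plus (p + hi) (m≤n+m hi p) (≤-reflexive eq)) (row-both (p + hi) (m≤n+m hi p) eq))
            (trans (∙-identityʳ _) (cong (_, 0) (m+n∸n≡m p hi)))))
        room : suc (M x) + k₀ + e′ ≤ e + suc r
        room = lin 6 (λ mx k₀ e′ e r p → mx :≤ p :⇒ e :+ r := p :+ k₀ :+ e′ :⇒ # 1 :+ mx :+ k₀ :+ e′ :≤ e :+ (# 1 :+ r))
                 (M x) k₀ e′ e r p (Mx-bound ih c p prefix m′) (k₀-sum p eq)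
        update : ∀ b → mem E (suc k) ≡ b → eRes (dec D⁺) 0 c (suc k) ≡ dec ((E , R₀) ∷ D)
        update false q = eRes-one ih c E R₀ (sym (FR-sum f))
          (λ d ed → k′-lo d (≤-trans (≤-reflexive (trans (cong (λ z → suc d + bit z) q) (trans (+-identityʳ _) (sym ed)))) (≤-reflexive c≡B)))
          (subst₂ (λ y z → Delta (rowBox E R) (rowBox E R₀) (suc k) y false k z true)
            (trans (sym (trans (cong (λ z → p + hi + bit z) q) (+-identityʳ _))) (trans eq (sym c≡B))) (sym c≡B) (FR-delta⁻¹ E f (p + hi) eq))
        -- The non-minimal k + 1 stands in column `p + hi`, just left of c, so the two-box clause of
        -- e applies: that box loses k + 1 and column c gains k.
        update true q = subst (λ z → eRes (dec D⁺) 0 z (suc k) ≡ dec ((E , R₀) ∷ D)) (sym c≡s)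
          (eRes-two ih (p + hi) E R₀ (sym (FR-sum f)) (in-k′ (p + hi) (≤-reflexive (sym eq)) (<-≤-trans (≤-reflexive (trans (sym c≡s) c≡B)) B≤C))
            (subst (λ z → Delta (rowBox E R) (rowBox E R₀) (suc k) (p + hi) false k z true) (trans (sym c≡B) c≡s) (FR-delta⁻¹ E f (p + hi) eq)))
          where
          c≡s : c ≡ suc (p + hi)
          c≡s = trans c≡B (trans (sym eq) (trans (cong (λ z → p + hi + bit z) q) (+-comm _ 1)))
    act (no c≱B) = act-E (mem E (suc k)) refl
      where
      act-E : ∀ b → mem E (suc k) ≡ b → FMinus k D⁺ c
      act-E false q = ⊥-elim (c≱B (≤-trans B≤c+e′ (≤-reflexive (trans (cong (λ z → c + bit z) q) (+-identityʳ c)))))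
      act-E true q with special q B≤a
        where
        sc≡B : suc c ≡ B
        sc≡B = ≤-antisym (≰⇒> c≱B) (≤-trans B≤c+e′ (≤-reflexive (trans (cong (λ z → c + bit z) q) (+-comm c 1))))
        B≤a : B ≤ a
        B≤a with a ≤? c
        ... | no h = ≤-trans (≤-reflexive (sym sc≡B)) (≰⇒> h)
        ... | yes h with trans (sym hk) (in-k c h (≰⇒> c≱B))
        ...   | ()
      ... | sp with FE-exists⁻¹ k E k<n (Special.e-0 sp) q
      ...   | E₀ , f = (E₀ , R) ∷ D , 0 , found ih c (suc k) hk′
          , eRes-one ih c E₀ R refl (λ d ed → k′-lo d (≤-trans (≤-reflexive (cong suc (trans (cong (λ z → d + bit z) q) (trans (+-comm d 1) (sym ed))))) (≰⇒> c≱B)))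
              (FE-delta⁻¹ R f c sc≡B r-0 (≤-trans (≤-reflexive sc≡B) B≤C))
          , inj₂ (inj₁ (f , refl , subst₂ _<_ (sym M-0) (sym (P-E f)) (s≤s z≤n)) , refl , ≤-trans (≤-reflexive r-0) z≤n)
        where
        open Special sp
        sc≡B : suc c ≡ B
        sc≡B = ≤-antisym (≰⇒> c≱B) (≤-trans B≤c+e′ (≤-reflexive (trans (cong (λ z → c + bit z) q) (+-comm c 1))))
        prefix : Pr ρ K c ≡ ε
        prefix = Pr-ε ρ K c (λ d _ d<c → cong₂ sig2
          (k-lo d (<-≤-trans (<-trans d<c (≤-reflexive sc≡B)) (≤-reflexive (sym a-eq))))
          (k′-lo d (≤-trans (≤-reflexive (cong suc (trans (cong (λ z → d + bit z) q) (+-comm d 1)))) (≤-trans (s≤s d<c) (≤-reflexive sc≡B)))))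
        M-0 : M (sigD k D) ≡ 0
        M-0 = trans (M-D ih) (cong₂ _+_ k₀-0 (n≤0⇒n≡0 (Mx-bound ih c 0 prefix m′)))

  step-locate : (∀ s c → c < N → colSig k D c ≡ sigSign s → M (Pr (colSig k D) 0 c) ≡ 0 → P (Pr (colSig k D) (suc c) N) ≡ 0 → FSign s k D c)
              → ∀ s c → c < N → colSig k D⁺ c ≡ sigSign s → M (Pr (colSig k D⁺) 0 c) ≡ 0 → P (Pr (colSig k D⁺) (suc c) N) ≡ 0 → FSign s k D⁺ c
  step-locate rec s c c<N sg m p = go (c <? lo) (c <? K) s sg
    where
    go : Dec (c < lo) → Dec (c < K) → ∀ s → colSig k D⁺ c ≡ sigSign s → FSign s k D⁺ c
    go (yes c<lo) _ plus sg = lower-plus ih c c<lo (proj₂ (lower ih c c<lo p))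
      (rec plus c c<N (trans (sym (low-part c c<lo)) sg) (trans (cong M (sym (lower-prefix ih c c<lo))) m) (proj₁ (lower ih c c<lo p)))
    go (yes c<lo) _ minus sg = lower-minus ih c c<lo (trans (sym (low-part c c<lo)) sg) (proj₂ (lower ih c c<lo p))
      (rec minus c c<N (trans (sym (low-part c c<lo)) sg) (trans (cong M (sym (lower-prefix ih c c<lo))) m) (proj₁ (lower ih c c<lo p)))
    go (no c≮lo) (yes c<K) s sg = ⊥-elim (nonzero s (trans (sym (mid-part c (≮⇒≥ c≮lo) c<K)) sg))
      where
      nonzero : ∀ s → ε ≢ sigSign s
      nonzero plus  ()
      nonzero minus ()
    go (no _) (no c≮K) plus  sg = row-acts-plus ih c (≮⇒≥ c≮K) c<N (trans (sym (high-part c (≮⇒≥ c≮K))) sg) m p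
    go (no _) (no c≮K) minus sg = row-acts-minus c (≮⇒≥ c≮K) (trans (sym (high-part c (≮⇒≥ c≮K))) sg) m

-- N is the same for all rows: columns beyond the end of a row contribute ε, so rows of different
-- lengths share one product.
columns-sig : ∀ {n k} → suc k < n → ∀ {la} (D : List (DRow n)) → DValid la D → ∀ N → sum (topD D) ≤ N → Pr (colSig k D) 0 N ≡ sigD k D
columns-sig k<n []            ok               N h = prod-ε 0 N
columns-sig k<n {la} ((E , R) ∷ D) (_ , _ , cp , ok) N h =
  Step.sig-step k<n {tl la} E R D ok (CompatFrom⇒Compat E R (topD D) cp) N h
    (columns-sig k<n {tl la} D ok N (≤-trans (CompatFrom⇒sum E R (topD D) cp) h))

-- The hypotheses on c are those of `Uncancelled`. Going down, each row either acts itself or leaves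
-- the same hypotheses for the rows below, until the row that the definition of the operators finds
-- is reached.
locate : ∀ {n k} → suc k < n → ∀ {la} (D : List (DRow n)) → DValid la D → ∀ N → sum (topD D) ≤ N → ∀ s c → c < N
       → colSig k D c ≡ sigSign s → M (Pr (colSig k D) 0 c) ≡ 0 → P (Pr (colSig k D) (suc c) N) ≡ 0 → FSign s k D c
locate k<n [] ok N h plus  c _ () m p
locate k<n [] ok N h minus c _ () m p
locate k<n {la} ((E , R) ∷ D) (_ , _ , cp , ok) N h =
  Minus.step-locate k<n {tl la} E R D ok (CompatFrom⇒Compat E R (topD D) cp) N h (columns-sig k<n {tl la} D ok N D≤N) (locate k<n {tl la} D ok N D≤N)
  where
  D≤N = ≤-trans (CompatFrom⇒sum E R (topD D) cp) h

-- Raising and lowering operators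

signs-dec : ∀ {n} k (D : List (DRow n)) → signs (dec D) (suc k) ≡ Columns.word (λ c → colMem D c k) (λ c → colMem D c (suc k)) 0 (ncols (dec D))
signs-dec k D = trans (List.concatMap-cong (λ c → cong₂ (signAt c) (colHas-dec D c k) (colHas-dec D c (suc k))) (upTo (ncols (dec D))))
                      (Columns.word-concatMap (λ c → colMem D c k) (λ c → colMem D c (suc k)) (λ x → x) (ncols (dec D)) 0 (λ x → refl))

fOp-nothing : ∀ {n} i (T : Tableau n) → lastPlus (reduce (signs T i)) ≡ nothing → fOp i T ≡ nothing
fOp-nothing i T e rewrite e = refl

fOp-just : ∀ {n} i (T : Tableau n) c r → lastPlus (reduce (signs T i)) ≡ just c → findRow T c i ≡ just r → fOp i T ≡ just (fRes T r c i)
fOp-just i T c r e e′ rewrite e | e′ = refl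

eOp-nothing : ∀ {n} i (T : Tableau n) → firstMinus (reduce (signs T i)) ≡ nothing → eOp i T ≡ nothing
eOp-nothing i T e rewrite e = refl

eOp-just : ∀ {n} i (T : Tableau n) c r → firstMinus (reduce (signs T i)) ≡ just c → findRow T c (suc i) ≡ just r → eOp i T ≡ just (eRes T r c i)
eOp-just i T zero    r e e′ rewrite e | e′ = refl
eOp-just i T (suc c) r e e′ rewrite e | e′ = refl

ncols-dec : ∀ {n} (D : List (DRow n)) → sum (topD D) ≤ ncols (dec D)
ncols-dec {n} []      = ≤-reflexive (sum-replicate0 n)
ncols-dec ((E , R) ∷ D) = ≤-trans (≤-reflexive (sym (List.length-applyUpTo _ (sum R)))) (m≤m⊔n _ _)

module _ {n k} (k<n : suc k < n) {la} (D : List (DRow n)) (ok : DValid la D) where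
  private
    N = ncols (dec D)
    w = Columns.word (λ c → colMem D c k) (λ c → colMem D c (suc k)) 0 N
    sig-w : sigW w ≡ sigD k D
    sig-w = trans (Columns.sig-word (λ c → colMem D c k) (λ c → colMem D c (suc k)) 0 N) (columns-sig k<n D ok N (ncols-dec D))

    acting : ∀ s c → Uncancelled w s c → FSign s k D c
    acting s c h = let (a , b , d , e) = Columns.uncancelled (λ c → colMem D c k) (λ c → colMem D c (suc k)) N h
                   in locate k<n D ok N (ncols-dec D) s c a b d e

  FCase ECase : Set
  FCase = (fOp (suc k) (dec D) ≡ nothing × P (sigD k D) ≡ 0) ⊎ ∃ λ D′ → fOp (suc k) (dec D) ≡ just (dec D′) × FD k D D′
  ECase = (eOp (suc k) (dec D) ≡ nothing × M (sigD k D) ≡ 0) ⊎ ∃ λ D′ → eOp (suc k) (dec D) ≡ just (dec D′) × FD k D′ D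

  fOp-dec : FCase
  fOp-dec = go (lastPlus (reduce w)) refl
    where
    go : ∀ m → lastPlus (reduce w) ≡ m → FCase
    go nothing  e = inj₁ (fOp-nothing (suc k) (dec D) (trans (cong (λ z → lastPlus (reduce z)) (signs-dec k D)) e) , trans (cong P (sym sig-w)) (lastPlus-none w e))
    go (just c) e = let (D′ , r , find , res , f) = acting plus c (lastPlus-just w c e) in
      inj₂ (D′ , trans (fOp-just (suc k) (dec D) c r (trans (cong (λ z → lastPlus (reduce z)) (signs-dec k D)) e) find) (cong just res) , f)

  eOp-dec : ECase
  eOp-dec = go (firstMinus (reduce w)) refl
    where
    go : ∀ m → firstMinus (reduce w) ≡ m → ECase
    go nothing  e = inj₁ (eOp-nothing (suc k) (dec D) (trans (cong (λ z → firstMinus (reduce z)) (signs-dec k D)) e) , trans (cong M (sym sig-w)) (firstMinus-none w e))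
    go (just c) e = let (D′ , r , find , res , f) = acting minus c (firstMinus-just w c e) in
      inj₂ (D′ , trans (eOp-just (suc k) (dec D) c r (trans (cong (λ z → firstMinus (reduce z)) (signs-dec k D)) e) find) (cong just res) , f)

-- Flagged increasing tableaux as rows of labels

sumR : ∀ {n} → URow n → ℕ
sumR (R , _) = sum R

shapeU : ∀ {n} → List (URow n) → List ℕ
shapeU = map sumR

labels : ∀ {n} → List (URow n) → List (List ℕ)
labels = map proj₂

topD-toD : ∀ {n} (U : List (URow n)) → topD (toD U) ≡ topU U
topD-toD []      = refl
topD-toD (_ ∷ U) = refl

toD-valid : ∀ {n s la} (U : List (URow n)) → UValid s la U → DValid (shapeU U) (toD U)
toD-valid []            ok        = refl
toD-valid ((R , p) ∷ U) (ok , oks) =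
  refl , RowOK.nonempty ok , subst (CompatFrom 0 0 ∅ R) (sym (topD-toD U)) (RowOK.compat ok) , toD-valid U oks

dvalid-parts : ∀ {n la} (D : List (DRow n)) → DValid la D → Parts la
dvalid-parts [] refl = tt
dvalid-parts {la = []} ((E , R) ∷ D) (len , ne , _) = ⊥-elim (<-irrefl len ne)
dvalid-parts {la = l ∷ la} ((E , R) ∷ D) (len , ne , cp , ok) =
  ≤-trans ne (≤-reflexive (sym len)) , ≤-trans (≤-reflexive (top la D ok)) (≤-trans (CompatFrom⇒sum E R (topD D) cp) (≤-reflexive (sym len))) , dvalid-parts D ok
  where
  top : ∀ {n} la (D : List (DRow n)) → DValid la D → hd la ≡ sum (topD D)
  top {n} la [] refl = sym (sum-replicate0 n)
  top la (_ ∷ D) (len , _) = len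

part-hd : ∀ la → part la 0 ≡ hd la
part-hd []      = refl
part-hd (_ ∷ _) = refl

part-tl : ∀ la r → part la (suc r) ≡ part (tl la) r
part-tl []       r = refl
part-tl (_ ∷ la) r = refl

part-1 : ∀ la → part la 1 ≡ hd (tl la)
part-1 la = trans (part-tl la 0) (part-hd (tl la))

-- The conditions on flagged increasing tableaux, with entries addressed by
-- their position in the row of labels; row 0 is the row s of the tableau.
record Filling (s : ℕ) (la mu : List ℕ) (Q : List (List ℕ)) : Set where
  field
    len  : ∀ r → part la r + length (rowAt Q r) ≡ part mu r
    flag : ∀ r → Flagged (r + s) (rowAt Q r)
    inc  : ∀ r → Increasing (rowAt Q r)
    col  : ∀ r → ColInc (part la r) (rowAt Q r) (part la (suc r)) (rowAt Q (suc r))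

skew-at : ∀ la Q r x → skewEntry la Q r (part la r + x) ≡ at (rowAt Q r) x
skew-at la Q r x with part la r + x <ᵇ part la r in eq
... | true  = ⊥-elim (<⇒≱ (<ᵇ⇒< (part la r + x) (part la r) (≡⇒T eq)) (m≤m+n (part la r) x))
... | false = cong (at (rowAt Q r)) (m+n∸m≡n (part la r) x)

skew-just : ∀ la Q r c {a} → skewEntry la Q r c ≡ just a → ∃ λ x → part la r + x ≡ c × at (rowAt Q r) x ≡ just a
skew-just la Q r c h with c <ᵇ part la r in eq
... | false = c ∸ part la r , m+[n∸m]≡n {part la r} {c} (≮⇒≥ (λ l → false≢true (trans (sym eq) (T⇒≡ (<⇒<ᵇ l))))) , h
  where
  false≢true : false ≢ true
  false≢true ()

filling : ∀ {la mu Q} → IsFlaggedIncreasing la mu Q → Filling 0 la mu Q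
filling {la} {mu} {Q} ((_ , len) , flag , inc , col) = record
  { len  = len
  ; flag = λ r x a h → let (l , u) = flag r _ a (trans (skew-at la Q r x) h) in l , ≤-trans u (≤-reflexive (sym (+-identityʳ r)))
  ; inc  = λ r x a b h k → inc r (part la r + x) a b (trans (skew-at la Q r x) h)
             (trans (trans (cong (skewEntry la Q r) (sym (+-suc (part la r) x))) (skew-at la Q r (suc x))) k)
  ; col  = λ r x y a b e h k → col r (part la r + x) a b (trans (skew-at la Q r x) h)
             (trans (trans (cong (skewEntry la Q (suc r)) e) (skew-at la Q (suc r) y)) k) }

flaggedIncreasing : ∀ {la mu Q} → length Q ≡ length mu → Filling 0 la mu Q → IsFlaggedIncreasing la mu Q
flaggedIncreasing {la} {mu} {Q} l f = (l , Filling.len f) , flag , inc , col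
  where
  flag : ∀ r c a → skewEntry la Q r c ≡ just a → 1 ≤ a × a ≤ r
  flag r c a h with skew-just la Q r c h
  ... | x , _ , e = let (lo , hi) = Filling.flag f r x a e in lo , ≤-trans hi (≤-reflexive (+-identityʳ r))
  inc : ∀ r c a b → skewEntry la Q r c ≡ just a → skewEntry la Q r (suc c) ≡ just b → a < b
  inc r c a b h k with skew-just la Q r c h | skew-just la Q r (suc c) k
  ... | x , ex , e | y , ey , e′ with +-cancelˡ-≡ (part la r) y (suc x) (trans ey (trans (cong suc (sym ex)) (sym (+-suc (part la r) x))))
  ...   | refl = Filling.inc f r x a b e e′
  col : ∀ r c a b → skewEntry la Q r c ≡ just a → skewEntry la Q (suc r) c ≡ just b → a < b
  col r c a b h k with skew-just la Q r c h | skew-just la Q (suc r) c k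
  ... | x , ex , e | y , ey , e′ = Filling.col f r x y a b (trans ex (sym ey)) e e′

rowAt-labels : ∀ {n} (U : List (URow n)) → rowAt (labels U) 0 ≡ topL U
rowAt-labels []      = refl
rowAt-labels (_ ∷ U) = refl

uvalid-filling : ∀ {n} s la (U : List (URow n)) → UValid s la U → Filling s la (shapeU U) (labels U)
uvalid-filling s la [] refl = record { len = λ r → refl ; flag = λ r x a () ; inc = λ r x a b () ; col = λ r x y a b _ () }
uvalid-filling s la ((R , p) ∷ U) (ok , oks) = record { len = len ; flag = flag ; inc = inc ; col = col }
  where
  ih = uvalid-filling (suc s) (tl la) U oks
  Q = labels ((R , p) ∷ U)
  len : ∀ r → part la r + length (rowAt Q r) ≡ part (shapeU ((R , p) ∷ U)) r
  len zero    = trans (cong (_+ length p) (part-hd la)) (RowOK.len ok)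
  len (suc r) = trans (cong (_+ length (rowAt (labels U) r)) (part-tl la r)) (Filling.len ih r)
  flag : ∀ r → Flagged (r + s) (rowAt Q r)
  flag zero    = RowOK.flagged ok
  flag (suc r) x a h = let (l , u) = Filling.flag ih r x a h in l , ≤-trans u (≤-reflexive (+-suc r s))
  inc : ∀ r → Increasing (rowAt Q r)
  inc zero    = RowOK.incr ok
  inc (suc r) = Filling.inc ih r
  col : ∀ r → ColInc (part la r) (rowAt Q r) (part la (suc r)) (rowAt Q (suc r))
  col zero    rewrite part-hd la | part-1 la | rowAt-labels U = RowOK.colInc ok
  col (suc r) rewrite part-tl la r | part-tl la (suc r) = Filling.col ih r

filling-uvalid : ∀ {n} s la (U : List (URow n)) → Parts la → Filling s la (shapeU U) (labels U) → DValid (shapeU U) (toD U) → UValid s la U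
filling-uvalid s []       [] ps f ok = refl
filling-uvalid s (l ∷ la) [] (pos , _) f ok = ⊥-elim (<⇒≱ pos (≤-trans (m≤m+n l 0) (≤-reflexive (Filling.len f 0))))
filling-uvalid s la ((R , p) ∷ U) ps f (_ , ne , cp , ok) =
  rowOK (trans (cong (_+ length p) (sym (part-hd la))) (Filling.len f 0)) ne (pos la ps) (dcr la ps)
    (Filling.flag f 0) (Filling.inc f 0) (subst (CompatFrom 0 0 ∅ R) (topD-toD U) cp) col ,
  filling-uvalid (suc s) (tl la) U (rest la ps) record
    { len  = λ r → trans (cong (_+ length (rowAt (labels U) r)) (sym (part-tl la r))) (Filling.len f (suc r))
    ; flag = λ r x a h → let (l , u) = Filling.flag f (suc r) x a h in l , ≤-trans u (≤-reflexive (sym (+-suc r s)))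
    ; inc  = λ r → Filling.inc f (suc r)
    ; col  = λ r → subst₂ (λ i j → ColInc i (rowAt (labels U) r) j (rowAt (labels U) (suc r))) (part-tl la r) (part-tl la (suc r)) (Filling.col f (suc r)) }
    ok
  where
  pos : ∀ la → Parts la → PosHd la
  pos []      _       = tt
  pos (_ ∷ _) (l , _) = l
  dcr : ∀ la → Parts la → hd (tl la) ≤ hd la
  dcr []      _           = z≤n
  dcr (_ ∷ _) (_ , l , _) = l
  rest : ∀ la → Parts la → Parts (tl la)
  rest []      _            = tt
  rest (_ ∷ _) (_ , _ , ps) = ps
  col : ColInc (hd la) p (hd (tl la)) (topL U)
  col x y a b e h k = Filling.col f 0 x y a b (trans (cong (_+ x) (part-hd la)) (trans e (cong (_+ y) (sym (part-1 la))))) h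
    (trans (cong (λ q → at q y) (rowAt-labels U)) k)

encU : ∀ {n} → Tableau n → List (List ℕ) → List (URow n)
encU = List.zipWith (λ row p → proj₂ (encRow row) , p)

encU-labels : ∀ {n} (T : Tableau n) Q → length Q ≡ length T → labels (encU T Q) ≡ Q
encU-labels []      []      e = refl
encU-labels (_ ∷ T) (q ∷ Q) e = cong (q ∷_) (encU-labels T Q (suc-injective e))

encU-enc : ∀ {n} (T : Tableau n) Q → length Q ≡ length T → (∀ r c S → entry T r c ≡ just S → ∣ S ∣ ≡ 1) → toD (encU T Q) ≡ enc T
encU-enc []        []      e h = refl
encU-enc (row ∷ T) (q ∷ Q) e h = cong₂ _∷_ (cong (_, proj₂ (encRow row)) (sym (single-enc row (h 0)))) (encU-enc T Q (suc-injective e) (λ r → h (suc r)))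

encU-[] : ∀ {n} (T : Tableau n) → encU T [] ≡ []
encU-[] []      = refl
encU-[] (_ ∷ T) = refl

encU-toD : ∀ {n} (U : List (URow n)) T → enc T ≡ toD U → encU T (labels U) ≡ U
encU-toD []            T         e = encU-[] T
encU-toD ((R , p) ∷ U) (row ∷ T) e with List.∷-injective e
... | e₁ , e₂ = cong₂ _∷_ (cong (λ d → proj₂ d , p) e₁) (encU-toD U T e₂)

shapeU-toD : ∀ {n la} (U : List (URow n)) → DValid la (toD U) → shapeU U ≡ la
shapeU-toD []            ok = sym ok
shapeU-toD {la = []}     ((R , p) ∷ U) (len , ne , _) = ⊥-elim (<-irrefl len ne)
shapeU-toD {la = l ∷ la} ((R , p) ∷ U) (len , _ , _ , ok) = cong₂ _∷_ (sym len) (shapeU-toD U ok)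

FU-shape : ∀ {n} k (U U₁ : List (URow n)) → FU k U U₁ → shapeU U ≡ shapeU U₁ × labels U ≡ labels U₁
FU-shape k ((R , p) ∷ U) ((R₁ , p₁) ∷ U₁) (refl , inj₁ (f , refl , _)) = cong (_∷ shapeU U) (FR-sum f) , refl
FU-shape k ((R , p) ∷ U) ((R₁ , p₁) ∷ U₁) (refl , inj₂ (f , refl , _)) with FU-shape k U U₁ f
... | a , b = cong (sum R ∷_) a , cong (p ∷_) b

-- The isomorphism

module _ {n : ℕ} where

  private
    _≟ᵀ_ : DecidableEquality (Tableau n)
    _≟ᵀ_ = List.≡-dec (List.≡-dec (Vec.≡-dec Bool._≟_))

    _≟ᴿ_ : DecidableEquality (SumRaw n)
    _≟ᴿ_ = Product.≡-dec (List.≡-dec _≟_) (Product.≡-dec (List.≡-dec (List.≡-dec _≟_)) _≟ᵀ_)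

  svt-≡ : ∀ {la} (x y : SVTElt n la) → SVTElt.tab x ≡ SVTElt.tab y → x ≡ y
  svt-≡ (svt T _) (svt .T _) refl = refl

  sum-≡ : ∀ {la} (x y : SumElt n la) → raw (SumB n la) x ≡ raw (SumB n la) y → x ≡ y
  sum-≡ (sumElt mu _ _ Q _ T _) (sumElt .mu _ _ .Q _ .T _) refl = refl

  rawU : List (URow n) → SumRaw n
  rawU U = shapeU U , labels U , dec (toD U)

  uncrowdT : Tableau n → List (URow n)
  uncrowdT T = uncrowd (enc T)

  crowdT : List ℕ → Tableau n → List (List ℕ) → Tableau n
  crowdT la T Q = dec (crowd la (encU T Q))

  module _ {la} (par : IsPartition la) where

    uncrowdT-valid : ∀ {T} → IsSVT la T → UValid 0 la (uncrowdT T)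
    uncrowdT-valid {T} v = uncrowd-valid la (enc T) (parts par) (svt-enc T par v)

    module _ {T : Tableau n} (v : IsSVT la T) where
      private
        U = uncrowdT T
        okU = uncrowdT-valid v
        okD = toD-valid U okU

      to-partition : IsPartition (shapeU U)
      to-partition = partition (shapeU U) (dvalid-parts (toD U) okD)

      to-contains : Contains la (shapeU U)
      to-contains r = m+n≤o⇒m≤o _ (≤-reflexive (Filling.len (uvalid-filling 0 la U okU) r))

      to-flagged : IsFlaggedIncreasing la (shapeU U) (labels U)
      to-flagged = flaggedIncreasing (trans (List.length-map proj₂ U) (sym (List.length-map sumR U))) (uvalid-filling 0 la U okU)

      to-ssyt : IsSSYT (shapeU U) (dec (toD U))
      to-ssyt = dec-ssyt U (dvalid-parts (toD U) okD) okD

      dec-enc-svt : dec (enc T) ≡ T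
      dec-enc-svt = dec-enc T (svt-rowValid T v)

      crowdT-uncrowdT : crowdT la (dec (toD U)) (labels U) ≡ T
      crowdT-uncrowdT = trans (cong (λ V → dec (crowd la V)) (encU-toD U (dec (toD U)) (enc-dec (toD U) okD)))
        (trans (cong dec (crowd-uncrowd la (enc T) (parts par) (svt-enc T par v))) dec-enc-svt)

      wt-uncrowd : wt (dec (toD U)) ≡ wt T
      wt-uncrowd = trans (wt-dec (toD U) okD) (trans (Vec.tabulate-cong (λ j → trans (weightD-toD U (toℕ j)) (weightU-uncrowd (enc T) (toℕ j))))
        (trans (sym (wt-dec (enc T) (svt-enc T par v))) (cong wt dec-enc-svt)))

    module _ {mu : List ℕ} {Q : List (List ℕ)} {T : Tableau n} (pm : IsPartition mu) (fl : IsFlaggedIncreasing la mu Q) (ss : IsSSYT mu T) where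
      private
        U = encU T Q
        sameLength : length Q ≡ length T
        sameLength = trans (proj₁ (proj₁ fl)) (trans (cong length (sym (proj₁ (proj₁ ss)))) (List.length-map length T))
        toD≡ : toD U ≡ enc T
        toD≡ = encU-enc T Q sameLength (proj₂ ss)
        okD : DValid mu (toD U)
        okD = subst (DValid mu) (sym toD≡) (svt-enc T pm (proj₁ ss))
        shape≡ : shapeU U ≡ mu
        shape≡ = shapeU-toD U okD
        okU : UValid 0 la U
        okU = filling-uvalid 0 la U (parts par) (subst₂ (Filling 0 la) (sym shape≡) (sym (encU-labels T Q sameLength)) (filling fl))
                (subst (λ m → DValid m (toD U)) (sym shape≡) okD)

      crowdT-svt : IsSVT la (crowdT la T Q)
      crowdT-svt = dec-svt (crowd la U) (parts par) (proj₁ (crowd-valid la U (parts par) okU))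

      uncrowdT-crowdT : rawU (uncrowdT (crowdT la T Q)) ≡ (mu , Q , T)
      uncrowdT-crowdT = trans (cong rawU (trans (cong uncrowd (enc-dec (crowd la U) (proj₁ cv))) (proj₂ cv)))
        (cong₂ _,_ shape≡ (cong₂ _,_ (encU-labels T Q sameLength) (trans (cong dec toD≡) (dec-enc T (svt-rowValid T (proj₁ ss))))))
        where
        cv = crowd-valid la U (parts par) okU

    module _ {k} (k<n : suc k < n) where

      private
        U⟨_⟩ : List (DRow n) → List (URow n)
        U⟨ D ⟩ = uncrowd D

        valid-U : ∀ D → DValid la D → DValid (shapeU U⟨ D ⟩) (toD U⟨ D ⟩)
        valid-U D ok = toD-valid U⟨ D ⟩ (uncrowd-valid la D (parts par) ok)

        toD-uncrowd-sig : ∀ D → sigD k (toD U⟨ D ⟩) ≡ sigD k D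
        toD-uncrowd-sig D = trans (toD-sig k U⟨ D ⟩) (uncrowd-sig k k<n D)

        toD-uncrowd-F : ∀ D D₁ → FD k D D₁ → FD k (toD U⟨ D ⟩) (toD U⟨ D₁ ⟩)
        toD-uncrowd-F D D₁ f = toD-F k (uncrowd-F k k<n {D} {D₁} f)

        rawU-≡ : ∀ D D₁ → FD k D D₁ → rawU U⟨ D₁ ⟩ ≡ (shapeU U⟨ D ⟩ , labels U⟨ D ⟩ , dec (toD U⟨ D₁ ⟩))
        rawU-≡ D D₁ f with FU-shape k U⟨ D ⟩ U⟨ D₁ ⟩ (uncrowd-F k k<n {D} {D₁} f)
        ... | a , b = cong₂ _,_ (sym a) (cong₂ _,_ (sym b) refl)

        0≢suc : ∀ {a b} → a ≡ 0 → a ≡ suc b → ⊥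
        0≢suc refl ()

      -- `fOp-dec` applies to both sides, and their signatures agree, so the operators vanish
      -- together: a nonzero result would need P to be a successor. If both act, `FD-det` identifies
      -- the result on the right with the uncrowding of D₁.
      f-dec : ∀ D → DValid la D →
        (fOp (suc k) (dec D) ≡ nothing × onT (fOp (suc k)) (rawU U⟨ D ⟩) ≡ nothing)
        ⊎ ∃ λ D₁ → DValid la D₁ × fOp (suc k) (dec D) ≡ just (dec D₁) × onT (fOp (suc k)) (rawU U⟨ D ⟩) ≡ just (rawU U⟨ D₁ ⟩)
      f-dec D ok with fOp-dec k<n D ok | fOp-dec k<n (toD U⟨ D ⟩) (valid-U D ok)
      ... | inj₁ (e , _) | inj₁ (e′ , _) = inj₁ (e , cong (Maybe.map _) e′)
      ... | inj₁ (_ , p) | inj₂ (D″ , _ , f) = ⊥-elim (0≢suc p (trans (cong P (sym (toD-uncrowd-sig D))) (proj₁ (FD-moves k _ D″ f))))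
      ... | inj₂ (D₁ , _ , f) | inj₁ (_ , p) = ⊥-elim (0≢suc p (trans (cong P (toD-uncrowd-sig D)) (proj₁ (FD-moves k D D₁ f))))
      ... | inj₂ (D₁ , e , f) | inj₂ (D″ , e′ , f′) = inj₂ (D₁ , FD-valid k la D D₁ f ok , e ,
        trans (cong (Maybe.map _) e′) (cong just (trans (cong (λ V → shapeU U⟨ D ⟩ , labels U⟨ D ⟩ , dec V) (FD-det k _ D″ _ f′ (toD-uncrowd-F D D₁ f))) (sym (rawU-≡ D D₁ f)))))

      -- The same argument with `FD` read backwards: M takes the place of P, and `FD-codet` that of
      -- `FD-det`.
      e-dec : ∀ D → DValid la D →
        (eOp (suc k) (dec D) ≡ nothing × onT (eOp (suc k)) (rawU U⟨ D ⟩) ≡ nothing)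
        ⊎ ∃ λ D₁ → DValid la D₁ × eOp (suc k) (dec D) ≡ just (dec D₁) × onT (eOp (suc k)) (rawU U⟨ D ⟩) ≡ just (rawU U⟨ D₁ ⟩)
      e-dec D ok with eOp-dec k<n D ok | eOp-dec k<n (toD U⟨ D ⟩) (valid-U D ok)
      ... | inj₁ (e , _) | inj₁ (e′ , _) = inj₁ (e , cong (Maybe.map _) e′)
      ... | inj₁ (_ , p) | inj₂ (D″ , _ , f) = ⊥-elim (0≢suc p (trans (cong M (sym (toD-uncrowd-sig D))) (proj₂ (FD-moves k D″ _ f))))
      ... | inj₂ (D₁ , _ , f) | inj₁ (_ , p) = ⊥-elim (0≢suc p (trans (cong M (toD-uncrowd-sig D)) (proj₂ (FD-moves k D₁ D f))))
      ... | inj₂ (D₁ , e , f) | inj₂ (D″ , e′ , f′) = inj₂ (D₁ , FD-valid⁻¹ k la D₁ D f ok , e ,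
        trans (cong (Maybe.map _) e′) (cong just (trans (cong (λ V → shapeU U⟨ D ⟩ , labels U⟨ D ⟩ , dec V) (FD-codet k _ D″ _ f′ (toD-uncrowd-F D₁ D f)))
          (cong (λ r → proj₁ r , proj₁ (proj₂ r) , dec (toD U⟨ D₁ ⟩)) (rawU-≡ D₁ D f)))))

    -- Validity proofs are irrelevant in the elements, so commutation is
    -- expressed by equations between raw data, which can be recomputed.
    Commutes : (Tableau n → Maybe (Tableau n)) → Tableau n → Maybe (Tableau n) → Set
    Commutes op T nothing   = onT op (rawU (uncrowdT T)) ≡ nothing
    Commutes op T (just T₁) = IsSVT la T₁ × onT op (rawU (uncrowdT T)) ≡ just (rawU (uncrowdT T₁))

    commutes : ∀ op T → IsSVT la T →
      (∀ D → DValid la D → (op (dec D) ≡ nothing × onT op (rawU (uncrowd D)) ≡ nothing)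
        ⊎ ∃ λ D₁ → DValid la D₁ × op (dec D) ≡ just (dec D₁) × onT op (rawU (uncrowd D)) ≡ just (rawU (uncrowd D₁)))
      → Commutes op T (op T)
    commutes op T v h with h (enc T) (svt-enc T par v) | dec-enc-svt v
    ... | inj₁ (e , e′) | d rewrite d | e = e′
    ... | inj₂ (D₁ , ok , e , e′) | d rewrite d | e =
      dec-svt D₁ (parts par) ok , trans e′ (cong (λ D → just (rawU (uncrowd D))) (sym (enc-dec D₁ ok)))

    toElt : SVTElt n la → SumElt n la
    toElt (svt T v) = sumElt (shapeU (uncrowdT T)) (to-partition v) (to-contains v) (labels (uncrowdT T)) (to-flagged v)
                             (dec (toD (uncrowdT T))) (to-ssyt v)

    fromElt : SumElt n la → SVTElt n la
    fromElt (sumElt mu pm _ Q fl T ss) = svt (crowdT la T Q) (crowdT-svt pm fl ss)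

    commutesAt : ∀ op (x : SVTElt n la) → .(Commutes op (SVTElt.tab x) (op (SVTElt.tab x))) → CommutesAt (SVT n la) (SumB n la) toElt op (onT op) x
    commutesAt op (svt T v) h = go (op T) refl h
      where
      go : ∀ m → op T ≡ m → .(Commutes op T m) → CommutesAt (SVT n la) (SumB n la) toElt op (onT op) (svt T v)
      go nothing   e h = inj₁ (e , recompute (Maybe.≡-dec _≟ᴿ_ _ _) h)
      go (just T₁) e h = inj₂ (svt T₁ (proj₁ h) , e , recompute (Maybe.≡-dec _≟ᴿ_ _ _) (proj₂ h))

    crystalIso : CrystalIso (SVT n la) (SumB n la)
    crystalIso = record
      { to      = toElt
      ; from    = fromElt
      ; from∘to = λ { (svt T v) → svt-≡ _ _ (recompute (_ ≟ᵀ _) (crowdT-uncrowdT v)) }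
      ; to∘from = λ { (sumElt mu pm _ Q fl T ss) → sum-≡ _ _ (recompute (_ ≟ᴿ _) (uncrowdT-crowdT pm fl ss)) }
      ; wt-pres = λ { (svt T v) → recompute (Vec.≡-dec _≟_ _ _) (wt-uncrowd v) }
      ; f-comm  = λ { (suc k) _ k<n x@(svt T v) → commutesAt (fOp (suc k)) x (commutes (fOp (suc k)) T v (f-dec k<n)) }
      ; e-comm  = λ { (suc k) _ k<n x@(svt T v) → commutesAt (eOp (suc k)) x (commutes (eOp (suc k)) T v (e-dec k<n)) }
      }

theorem3p12 : (n : ℕ) → 2 ≤ n → (la : List ℕ) → IsPartition la
    → CrystalIso (SVT n la) (SumB n la)
theorem3p12 n _ la par = crystalIso par
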